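{- Every doubled pattern with reversal is $3$-avoidable. That is, for every doubled pattern with reversal $p$, there exists an infinite word over a $3$-letter alphabet $\Sigma$ that contains no occurrence of $p$.
   Context: For a word $w=w_1w_2\dots w_n$, its mirror image is $w^R=w_nw_{n-1}\dots w_1$. A pattern with reversal is a non-empty finite word over an alphabet $\Delta=\{A,A^R,B,B^R,C,C^R,\dots\}$, where $A,B,C,\dots$ are the variables of $p$ (an occurrence of either $X$ or $X^R$ in $p$ counts as an occurrence of the variable $X$). Such a pattern is doubled if every variable occurring in it occurs at least twice. An occurrence of $p$ in a word $w$ over $\Sigma$ is a non-erasing morphism $h:\Delta^*\to\Sigma^*$ (i.e. $h(Y)$ is non-empty for every letter $Y$) satisfying $h(X^R)=(h(X))^R$ for every variable $X$, such that $h(p)$ is a factor of $w$. A pattern $p$ is $k$-avoidable if there exists an infinite word over a $k$-letter alphabet containing no occurrence of $p$. -}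

module Defs where

open import Data.Nat using (ℕ; zero; suc; _≤_)
open import Data.Bool using (Bool; true; false)
open import Data.Fin using (Fin)
open import Data.List using (List; []; _∷_; length; reverse; concatMap)
open import Data.List.Membership.Propositional using (_∈_)
open import Data.Product using (Σ; ∃; _×_; _,_)
open import Data.Empty using (⊥)
open import Data.Unit using (⊤)
open import Relation.Binary.PropositionalEquality using (_≡_)
open import Relation.Nullary using (¬_)
open import Data.Nat using (_≡ᵇ_)

Var : Set
Var = ℕ

record PLetter : Set where
  constructor plet
  field
    var      : Var
    reversed : Bool
open PLetter public

Pattern : Set
Pattern = List PLetter

NonEmpty : {A : Set} → List A → Set
NonEmpty [] = ⊥
NonEmpty (_ ∷ _) = ⊤

occ : Var → Pattern → ℕ
occ X [] = 0
occ X (plet Y _ ∷ p) with X ≡ᵇ Y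
... | true  = suc (occ X p)
... | false = occ X p

OccursIn : Var → Pattern → Set
OccursIn X p = Σ Bool λ b → plet X b ∈ p

Doubled : Pattern → Set
Doubled p = ∀ X → OccursIn X p → 2 ≤ occ X p

imgLetter : {Σ' : Set} → (Var → List Σ') → PLetter → List Σ'
imgLetter h (plet X false) = h X
imgLetter h (plet X true)  = reverse (h X)

img : {Σ' : Set} → (Var → List Σ') → Pattern → List Σ'
img h p = concatMap (imgLetter h) p

InfWord : Set → Set
InfWord Σ' = ℕ → Σ'

factorAt : {Σ' : Set} → InfWord Σ' → ℕ → ℕ → List Σ'
factorAt w i zero = []
factorAt w i (suc n) = w i ∷ factorAt w (suc i) n

IsFactor : {Σ' : Set} → List Σ' → InfWord Σ' → Set
IsFactor u w = ∃ λ i → factorAt w i (length u) ≡ u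

OccursInWord : {Σ' : Set} → Pattern → InfWord Σ' → Set
OccursInWord {Σ'} p w =
  Σ (Var → List Σ') λ h → (∀ X → OccursIn X p → NonEmpty (h X)) × IsFactor (img h p) w

Avoidable : ℕ → Pattern → Set
Avoidable k p = Σ (InfWord (Fin k)) λ w → ¬ OccursInWord p w

{-# OPTIONS --safe #-}

-- If p has two adjacent letters with the same variable, every square-free word avoids it, because such a
-- word contains no even palindrome either.  Otherwise p is replaced by its shortest doubled prefix.
--
-- Suppose first that p has at least six variables, or a variable occurring three times.  Letters are
-- chosen greedily so that the total weight of the partially read occurrences of p stays below 1.  A letter
-- still to be read weighs t, and a variable of d occurrences whose first one is still to be read weighs G
-- where 3 t^d (1 + G) ≤ G.  On average over the next letter the total weight is then divided by at least
-- 3 t, while an occurrence starting now contributes the product of the G.  So it suffices that this product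
-- is at most 3 t − 1.  When p starts with distinct variables, their images can be read off the letters
-- already chosen, and each of these variables contributes only H ≥ t / (1 − t).
--
-- The remaining patterns have at most five variables, each occurring twice.  They are avoided by two
-- explicit words in which every factor u of length at least 6 recurs, directly or reversed, only at a
-- distance above D |u|.  In an occurrence of p the longest image recurs at distance at most D times its
-- length, so all images have length at most 5, and the finitely many short factors are checked by computation.
module Submission where

-- Reversal leaves the weights unchanged: once the image of X is known, a later X or X^R prescribes
-- one word of the same length. The factor 3 counts the choices for each letter of an unknown image,
-- whereas an image read back from the history is fixed by its length alone; hence `H` needs only t
-- / (1 - t), while `G` needs 3 t^d / (1 - 3 t^d). A larger `t` widens the bound 3 t - 1 but raises
-- `G`, and for d = 2 the power G^5 exceeds 3 t - 1 for every `t`, so five variables are left over.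
-- Four distinct starting variables need a second value of `t`, as (9/16)^4 is above 2/25. In the
-- explicit words each block shows its index modulo `K`, so a long factor recurs only at multiples
-- of `K` blocks. The binary word underneath then has to avoid close repetitions only at distances
-- divisible by `K`, a condition that survives desubstitution because the length of the morphism is
-- coprime to `K`. A separate word serves the shape A B A B, where D = 2 suffices; the others need D
-- = 8.

open import Defs

-- Factors of infinite words, block expansions, and Boolean tests on words

module Words where

  open import Data.Bool using (Bool; true; false; _∧_; T; if_then_else_)
  open import Data.Fin using (Fin; zero; suc)
  open import Data.List using (List; []; _∷_; _++_; length; concatMap; take; drop)
  open import Data.Bool.ListAction using (all)
  open import Data.List.Properties
  open import Data.List.Membership.Propositional using (_∈_)
  open import Data.List.Relation.Unary.Any using (here; there)
  open import Data.Maybe using (Maybe; just; nothing)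
  open import Data.Nat as ℕ using (ℕ; zero; suc; z≤n; s≤s; _+_; _*_; _∸_; _≤_; _<_; _/_; _%_; _≡ᵇ_; NonZero)
  open import Data.Nat.Properties
  open import Data.Nat.DivMod
  open import Data.Nat.Divisibility using (divides)
  open import Data.Product using (_×_; _,_; proj₁; proj₂)
  open import Data.Unit using (tt)
  open import Relation.Nullary using (yes; no)
  open import Relation.Binary.PropositionalEquality

  private variable A B : Set

  ∧-true : ∀ {a b} → a ∧ b ≡ true → a ≡ true × b ≡ true
  ∧-true {true} {true} _ = refl , refl

  Agree : InfWord A → ℕ → ℕ → ℕ → Set
  Agree v i j n = ∀ t → t < n → v (i + t) ≡ v (j + t)

  length-factorAt : (v : InfWord A) (i n : ℕ) → length (factorAt v i n) ≡ n
  length-factorAt v i zero = refl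
  length-factorAt v i (suc n) = cong suc (length-factorAt v (suc i) n)

  take-factorAt : (v : InfWord A) (i : ℕ) {m n : ℕ} → m ≤ n → take m (factorAt v i n) ≡ factorAt v i m
  take-factorAt v i z≤n = refl
  take-factorAt v i (s≤s m≤n) = cong (v i ∷_) (take-factorAt v (suc i) m≤n)

  drop-factorAt : (v : InfWord A) (i d n : ℕ) → drop d (factorAt v i n) ≡ factorAt v (i + d) (n ∸ d)
  drop-factorAt v i zero n rewrite +-identityʳ i = refl
  drop-factorAt v i (suc d) zero = refl
  drop-factorAt v i (suc d) (suc n) rewrite +-suc i d = drop-factorAt v (suc i) d n

  factorAt-+ : (v : InfWord A) (i m n : ℕ) → factorAt v i (m + n) ≡ factorAt v i m ++ factorAt v (i + m) n
  factorAt-+ v i zero n rewrite +-identityʳ i = refl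
  factorAt-+ v i (suc m) n rewrite +-suc i m = cong (v i ∷_) (factorAt-+ v (suc i) m n)

  agree-tail : (v : InfWord A) {i j n : ℕ} → Agree v i j (suc n) → Agree v (suc i) (suc j) n
  agree-tail v {i} {j} ag t t<n = subst₂ (λ a b → v a ≡ v b) (+-suc i t) (+-suc j t) (ag (suc t) (s≤s t<n))

  agree⇒factorAt : (v : InfWord A) (i j n : ℕ) → Agree v i j n → factorAt v i n ≡ factorAt v j n
  agree⇒factorAt v i j zero ag = refl
  agree⇒factorAt v i j (suc n) ag = cong₂ _∷_
    (subst₂ (λ a b → v a ≡ v b) (+-identityʳ i) (+-identityʳ j) (ag 0 (s≤s z≤n)))
    (agree⇒factorAt v (suc i) (suc j) n (agree-tail v ag))

  factorAt⇒agree : (v : InfWord A) (i j n : ℕ) → factorAt v i n ≡ factorAt v j n → Agree v i j n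
  factorAt⇒agree v i j (suc n) e zero _ = subst₂ (λ a b → v a ≡ v b) (sym (+-identityʳ i)) (sym (+-identityʳ j))
      (∷-injectiveˡ e)
  factorAt⇒agree v i j (suc n) e (suc t) (s≤s t<n) = subst₂ (λ a b → v a ≡ v b) (sym (+-suc i t))
      (sym (+-suc j t))
    (factorAt⇒agree v (suc i) (suc j) n (∷-injectiveʳ e) t t<n)

  nth : A → List A → ℕ → A
  nth d [] n = d
  nth d (x ∷ xs) zero = x
  nth d (x ∷ xs) (suc n) = nth d xs n

  module Expansion {A B : Set} (q : ℕ) .{{_ : NonZero q}} (z : InfWord A) (block : A → List B) (d : B)
    (length-block : ∀ a → length (block a) ≡ q) where

    expanded : InfWord B
    expanded n = nth d (block (z (n / q))) (n % q)

    expanded-at : ∀ k s → s < q → expanded (k * q + s) ≡ nth d (block (z k)) s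
    expanded-at k s s<q = cong₂ (λ a b → nth d (block (z a)) b)
      (trans (+-distrib-/-∣ˡ {k * q} s (divides k refl))
          (trans (cong₂ _+_ (m*n/n≡m k q) (m<n⇒m/n≡0 s<q)) (+-identityʳ k)))
      (trans (cong (_% q) (+-comm (k * q) s)) (trans ([m+kn]%n≡m%n s k q) (m<n⇒m%n≡m s<q)))

    factorAt-nth : ∀ (v : InfWord B) i (u : List B) → (∀ s → s < length u → v (i + s) ≡ nth d u s) → factorAt v
        i (length u) ≡ u
    factorAt-nth v i [] h = refl
    factorAt-nth v i (x ∷ u) h = cong₂ _∷_ (subst (λ k → v k ≡ x) (+-identityʳ i) (h 0 (s≤s z≤n)))
      (factorAt-nth v (suc i) u (λ s s<n → subst (λ k → v k ≡ nth d u s) (+-suc i s) (h (suc s) (s≤s s<n))))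

    factorAt-block : ∀ k → factorAt expanded (k * q) q ≡ block (z k)
    factorAt-block k = subst (λ n → factorAt expanded (k * q) n ≡ block (z k)) (length-block (z k))
      (factorAt-nth expanded (k * q) (block (z k))
          (λ s s<n → expanded-at k s (subst (s <_) (length-block (z k)) s<n)))

    factorAt-blocks : ∀ k m → factorAt expanded (k * q) (m * q) ≡ concatMap block (factorAt z k m)
    factorAt-blocks k zero = refl
    factorAt-blocks k (suc m) = trans (factorAt-+ expanded (k * q) q (m * q))
      (cong₂ _++_ (factorAt-block k)
        (trans (cong (λ i → factorAt expanded i (m * q)) (+-comm (k * q) q)) (factorAt-blocks (suc k) m)))

    -- All finite checks rest on this identity: a factor starting at `i` is read inside the blocks
    -- of the `m` letters from `i / q` on, so finitely many factors of `z` and the `q` offsets cover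
    -- every position.
    window : ∀ i m → factorAt expanded i (m * q ∸ i % q) ≡ drop (i % q) (concatMap block (factorAt z (i / q) m))
    window i m = trans (cong (λ j → factorAt expanded j (m * q ∸ i % q))
        (trans (m≡m%n+[m/n]*n i q) (+-comm (i % q) _)))
      (trans (sym (drop-factorAt expanded (i / q * q) (i % q) (m * q)))
          (cong (drop (i % q)) (factorAt-blocks (i / q) m)))

  below : ℕ → (ℕ → Bool) → Bool
  below zero P = true
  below (suc n) P = P n ∧ below n P

  below-sound : ∀ n P → below n P ≡ true → ∀ {i} → i < n → P i ≡ true
  below-sound (suc n) P e {i} i<n with ∧-true e
  ... | p , ps with i ≟ n
  ...   | yes refl = p
  ...   | no i≢n = below-sound n P ps (≤∧≢⇒< (≤-pred i<n) i≢n)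

  all-sound : (P : A → Bool) (xs : List A) → all P xs ≡ true → ∀ {x} → x ∈ xs → P x ≡ true
  all-sound P (x ∷ xs) e (here refl) = proj₁ (∧-true e)
  all-sound P (x ∷ xs) e (there i) = all-sound P xs (proj₂ (∧-true e)) i

  Letter : Set
  Letter = Fin 3

  _==_ : Letter → Letter → Bool
  zero == zero = true
  suc zero == suc zero = true
  suc (suc zero) == suc (suc zero) = true
  _ == _ = false

  ==-refl : ∀ a → (a == a) ≡ true
  ==-refl zero = refl
  ==-refl (suc zero) = refl
  ==-refl (suc (suc zero)) = refl

  ==-sound : ∀ a b → (a == b) ≡ true → a ≡ b
  ==-sound zero zero _ = refl
  ==-sound (suc zero) (suc zero) _ = refl
  ==-sound (suc (suc zero)) (suc (suc zero)) _ = refl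

  eqWord : List Letter → List Letter → Bool
  eqWord [] [] = true
  eqWord (a ∷ u) (b ∷ v) = if a == b then eqWord u v else false
  eqWord _ _ = false

  eqWord-sound : ∀ u v → eqWord u v ≡ true → u ≡ v
  eqWord-sound [] [] _ = refl
  eqWord-sound (a ∷ u) (b ∷ v) e with a == b in eq
  ... | true = cong₂ _∷_ (==-sound a b eq) (eqWord-sound u v e)

  member : List Letter → List (List Letter) → Bool
  member u [] = false
  member u (v ∷ vs) = if eqWord u v then true else member u vs

  member-sound : ∀ u vs → member u vs ≡ true → u ∈ vs
  member-sound u (v ∷ vs) e with eqWord u v in eq
  ... | true = here (eqWord-sound u v eq)
  ... | false = there (member-sound u vs e)

  -- Tries serve as certificates. Nothing is proved about `insert`; every table is validated by
  -- evaluating `find` on all words concerned.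
  data Trie (V : Set) : Set where
    nil  : Trie V
    leaf : V → Trie V
    node : Trie V → Trie V → Trie V → Trie V

  find : {V : Set} → List Letter → Trie V → Maybe V
  find u (leaf v) = just v
  find (zero ∷ u) (node a b c) = find u a
  find (suc zero ∷ u) (node a b c) = find u b
  find (suc (suc zero) ∷ u) (node a b c) = find u c
  find _ _ = nothing

  insert : {V : Set} → List Letter → V → Trie V → Trie V
  insert [] v t = leaf v
  insert (x ∷ u) v (leaf v') = leaf v'
  insert (zero ∷ u) v nil = node (insert u v nil) nil nil
  insert (suc zero ∷ u) v nil = node nil (insert u v nil) nil
  insert (suc (suc zero) ∷ u) v nil = node nil nil (insert u v nil)
  insert (zero ∷ u) v (node a b c) = node (insert u v a) b c
  insert (suc zero ∷ u) v (node a b c) = node a (insert u v b) c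
  insert (suc (suc zero) ∷ u) v (node a b c) = node a b (insert u v c)

  commonPrefix : List Letter → List Letter → ℕ
  commonPrefix (a ∷ u) (b ∷ v) = if a == b then suc (commonPrefix u v) else 0
  commonPrefix _ _ = 0

  commonPrefix-agree : ∀ (v : InfWord Letter) n {i j m m'} → n ≤ m → n ≤ m' → Agree v i j n →
                       n ≤ commonPrefix (factorAt v i m) (factorAt v j m')
  commonPrefix-agree v zero _ _ _ = z≤n
  commonPrefix-agree v (suc n) {i} {j} (s≤s n≤m) (s≤s n≤m') ag
    rewrite subst₂ (λ a b → v a ≡ v b) (+-identityʳ i) (+-identityʳ j) (ag 0 (s≤s z≤n)) | ==-refl (v j) =
    s≤s (commonPrefix-agree v n n≤m n≤m' (agree-tail v ag))

  eqMaybe : Maybe ℕ → ℕ → Bool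
  eqMaybe (just m) n = m ℕ.≡ᵇ n
  eqMaybe nothing n = false

  eqMaybe-sound : ∀ x n → eqMaybe x n ≡ true → x ≡ just n
  eqMaybe-sound (just m) n e = cong just (≡ᵇ⇒≡ m n (subst T (sym e) tt))

  digit : ℕ → Letter
  digit 0 = zero
  digit 1 = suc zero
  digit _ = suc (suc zero)

  digits : ℕ → ℕ → List Letter → List Letter
  digits zero n u = u
  digits (suc f) n u with n ≡ᵇ 1
  ... | true  = u
  ... | false = digits f (n / 10) (digit (n % 10) ∷ u)

  -- A word is written in decimal behind a leading 1, which protects initial zeros.
  ⟦_⟧ : ℕ → List Letter
  ⟦ n ⟧ = digits 100 n []

  NonEmpty⇒1≤ : {A : Set} (u : List A) → NonEmpty u → 1 ≤ length u
  NonEmpty⇒1≤ (_ ∷ _) _ = s≤s z≤n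

-- Weights of partially read occurrences

module Potential where

  open Words using (Letter)
  open import Data.Bool using (Bool; true; false)
  open import Data.Fin using (Fin; zero; suc)
  import Data.Fin as Fin
  open import Data.List using (List; []; _∷_; _++_; length; reverse; concatMap; map)
  open import Data.List.Properties using (length-reverse; reverse-involutive; length-++)
  open import Data.List.Membership.Propositional using (_∈_; _∉_)
  open import Data.List.Relation.Unary.All as All using (All; []; _∷_)
  open import Data.List.Relation.Unary.All.Properties as AllP using ()
  open import Data.List.Relation.Unary.AllPairs using (AllPairs; []; _∷_)
  open import Data.List.Relation.Unary.Any using (here; there)
  open import Data.Maybe using (Maybe; just; nothing)
  import Data.Maybe as Maybe
  open import Data.Nat as ℕ using (ℕ; zero; suc; z≤n; s≤s)
  import Data.Nat.Properties as ℕ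
  open import Data.Product using (_×_; _,_)
  open import Data.Rational as ℚ using (ℚ; 0ℚ; 1ℚ; _+_; _*_; _≤_; nonNegative)
  import Data.Rational.Properties as ℚ
  open import Data.Rational.Solver using (module +-*-Solver)
  open import Data.Unit using (tt)
  open import Function using (_∘_; case_of_)
  open import Relation.Nullary using (yes; no; contradiction)
  open import Relation.Binary.PropositionalEquality
  open +-*-Solver using (solve; _:=_; _:+_; _:*_; con)

  _[_↦_] : {B : Set} → (Var → B) → Var → B → Var → B
  (f [ X ↦ v ]) Y with X ℕ.≟ Y
  ... | yes _ = v
  ... | no  _ = f Y

  upd-≡ : {B : Set} (f : Var → B) (X : Var) (v : B) → (f [ X ↦ v ]) X ≡ v
  upd-≡ f X v with X ℕ.≟ X
  ... | yes _ = refl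
  ... | no ¬p = contradiction refl ¬p

  upd-≢ : {B : Set} (f : Var → B) {X Y : Var} (v : B) → X ≢ Y → (f [ X ↦ v ]) Y ≡ f Y
  upd-≢ f {X} {Y} v X≢Y with X ℕ.≟ Y
  ... | yes p = contradiction p X≢Y
  ... | no _ = refl

  ≡ᵇ-refl : ∀ X → (X ℕ.≡ᵇ X) ≡ true
  ≡ᵇ-refl zero = refl
  ≡ᵇ-refl (suc X) = ≡ᵇ-refl X

  ≢⇒≡ᵇ : ∀ {X Y} → X ≢ Y → (X ℕ.≡ᵇ Y) ≡ false
  ≢⇒≡ᵇ {X} {Y} X≢Y with X ℕ.≡ᵇ Y in eq
  ... | false = refl
  ... | true = contradiction (ℕ.≡ᵇ⇒≡ X Y (subst Data.Bool.T (sym eq) tt)) X≢Y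

  occ-≡ : ∀ X b q → occ X (plet X b ∷ q) ≡ suc (occ X q)
  occ-≡ X b q rewrite ≡ᵇ-refl X = refl

  occ-≢ : ∀ {X Y} b q → X ≢ Y → occ X (plet Y b ∷ q) ≡ occ X q
  occ-≢ b q X≢Y rewrite ≢⇒≡ᵇ X≢Y = refl

  occ-++ : ∀ X p q → occ X (p ++ q) ≡ occ X p ℕ.+ occ X q
  occ-++ X [] q = refl
  occ-++ X (plet Y b ∷ p) q with X ℕ.≡ᵇ Y
  ... | true = cong suc (occ-++ X p q)
  ... | false = occ-++ X p q

  orient : {A : Set} → Bool → List A → List A
  orient false y = y
  orient true  y = reverse y

  orient-involutive : {A : Set} (b : Bool) (y : List A) → orient b (orient b y) ≡ y
  orient-involutive false y = refl
  orient-involutive true y = reverse-involutive y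

  length-orient : {A : Set} (b : Bool) (y : List A) → length (orient b y) ≡ length y
  length-orient false y = refl
  length-orient true y = length-reverse y

  imgLetter-orient : {A : Set} (h : Var → List A) (X : Var) (b : Bool) → imgLetter h (plet X b) ≡ orient b (h X)
  imgLetter-orient h X false = refl
  imgLetter-orient h X true = refl

  *-monoˡ-≤0 : ∀ {c a b} → 0ℚ ≤ c → a ≤ b → c * a ≤ c * b
  *-monoˡ-≤0 {c} 0≤c = ℚ.*-monoˡ-≤-nonNeg c {{nonNegative 0≤c}}

  *-monoʳ-≤0 : ∀ {c a b} → 0ℚ ≤ c → a ≤ b → a * c ≤ b * c
  *-monoʳ-≤0 {c} 0≤c = ℚ.*-monoʳ-≤-nonNeg c {{nonNegative 0≤c}}

  0≤* : ∀ a b → 0ℚ ≤ a → 0ℚ ≤ b → 0ℚ ≤ a * b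
  0≤* a b 0≤a 0≤b = subst (_≤ a * b) (ℚ.*-zeroʳ a) (*-monoˡ-≤0 0≤a 0≤b)

  0≤+ : ∀ {a b} → 0ℚ ≤ a → 0ℚ ≤ b → 0ℚ ≤ a + b
  0≤+ 0≤a 0≤b = ℚ.+-mono-≤ 0≤a 0≤b

  *-mono-≤0 : ∀ {a b c d} → 0ℚ ≤ a → 0ℚ ≤ d → a ≤ b → c ≤ d → a * c ≤ b * d
  *-mono-≤0 0≤a 0≤d a≤b c≤d = ℚ.≤-trans (*-monoˡ-≤0 0≤a c≤d) (*-monoʳ-≤0 0≤d a≤b)

  power : ℚ → ℕ → ℚ
  power t zero = 1ℚ
  power t (suc n) = t * power t n

  power-+ : ∀ t m n → power t (m ℕ.+ n) ≡ power t m * power t n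
  power-+ t zero n = sym (ℚ.*-identityˡ _)
  power-+ t (suc m) n = trans (cong (t *_) (power-+ t m n)) (sym (ℚ.*-assoc t _ _))

  0≤power : ∀ {t} → 0ℚ ≤ t → ∀ n → 0ℚ ≤ power t n
  0≤power 0≤t zero = ℚ.nonNegative⁻¹ 1ℚ
  0≤power 0≤t (suc n) = 0≤* _ (power _ n) 0≤t (0≤power 0≤t n)

  power≤1 : ∀ {t} → 0ℚ ≤ t → t ≤ 1ℚ → ∀ n → power t n ≤ 1ℚ
  power≤1 0≤t t≤1 zero = ℚ.≤-refl
  power≤1 0≤t t≤1 (suc n) = *-mono-≤0 0≤t (ℚ.nonNegative⁻¹ 1ℚ) t≤1 (power≤1 0≤t t≤1 n)

  power-anti : ∀ {t} → 0ℚ ≤ t → t ≤ 1ℚ → ∀ {m n} → m ℕ.≤ n → power t n ≤ power t m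
  power-anti 0≤t t≤1 {n = n} z≤n = power≤1 0≤t t≤1 n
  power-anti 0≤t t≤1 (s≤s m≤n) = *-monoˡ-≤0 0≤t (power-anti 0≤t t≤1 m≤n)

  3ℚ : ℚ
  3ℚ = 1ℚ + (1ℚ + 1ℚ)

  Env : Set
  Env = Var → Maybe (List Letter)

  lengths : Env → Var → Maybe ℕ
  lengths η X = Maybe.map length (η X)

  -- A guess at a partial occurrence. `match ρ η q` must still read `ρ` and then the image of `q`,
  -- with `η` the images known so far. `read X b y η q` is inside the first occurrence of `X`, has
  -- read `y` of it, and will read at least one more letter of it.
  data State : Set where
    match : List Letter → Env → Pattern → State
    read  : Var → Bool → List Letter → Env → Pattern → State

  -- Both possibilities after `y` are kept, a longer image and an image that ends here. As
  -- `orient b` is an involution, it turns the word read back into the value of `X`.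
  advance : Var → Bool → List Letter → Env → Pattern → List State
  advance X b y η q = read X b y η q ∷ match [] (η [ X ↦ just (orient b y) ]) q ∷ []

  expect : Letter → List Letter → Env → Pattern → List State
  expect a [] η q = []
  expect a (c ∷ ρ) η q with a Fin.≟ c
  ... | yes _ = match ρ η q ∷ []
  ... | no  _ = []

  step : Letter → State → List State
  step a (match (c ∷ ρ) η q) = expect a (c ∷ ρ) η q
  step a (match [] η []) = []
  step a (match [] η (plet X b ∷ q)) with η X
  ... | just y  = expect a (orient b y) η q
  ... | nothing = advance X b (a ∷ []) η q
  step a (read X b y η q) = advance X b (y ++ a ∷ []) η q

  -- Here `u` is the history with its latest letter first and the pattern prefix is reversed too, so
  -- images are cut off the front of `u`. Prepending to `y` restores reading order. One state arises
  -- for each choice of lengths.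
  late     : List PLetter → Env → List Letter → Pattern → List State
  lateFrom : Var → Bool → List PLetter → Env → List Letter → List Letter → Pattern → List State
  late [] η u q = match [] η q ∷ []
  late (plet X b ∷ rp) η u q = lateFrom X b rp η [] u q
  lateFrom X b rp η y [] q = []
  lateFrom X b rp η y (c ∷ u) q =
    late rp (η [ X ↦ just (orient b (c ∷ y)) ]) u q ++ lateFrom X b rp η (c ∷ y) u q

  zeros : (Var → Maybe ℕ) → List PLetter → Var → Maybe ℕ
  zeros σ [] = σ
  zeros σ (l ∷ rp) = zeros (σ [ var l ↦ just 0 ]) rp

  module Weights (t G₂ G₃ H : ℚ) (0≤t : 0ℚ ≤ t) (t≤1 : t ≤ 1ℚ)
    (0≤G₂ : 0ℚ ≤ G₂) (0≤G₃ : 0ℚ ≤ G₃) (0≤H : 0ℚ ≤ H)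
    (super₂ : 3ℚ * (t * (t * (1ℚ + G₂))) ≤ G₂)
    (super₃ : 3ℚ * (t * (t * (t * (1ℚ + G₃)))) ≤ G₃)
    (superH : t * (1ℚ + H) ≤ H) where

    G : ℕ → ℚ
    G (suc (suc (suc _))) = G₃
    G _ = G₂

    0≤G : ∀ n → 0ℚ ≤ G n
    0≤G zero = 0≤G₂
    0≤G (suc zero) = 0≤G₂
    0≤G (suc (suc zero)) = 0≤G₂
    0≤G (suc (suc (suc n))) = 0≤G₃

    tp : ℕ → ℚ
    tp = power t

    0≤tp : ∀ n → 0ℚ ≤ tp n
    0≤tp = 0≤power 0≤t

    -- For `o ≥ 2` later occurrences `tp o ≤ tp 2`, so the constant fitted to exactly three
    -- occurrences serves all larger counts.
    superG : ∀ o → 1 ℕ.≤ o → 3ℚ * (t * (tp o * (1ℚ + G (suc o)))) ≤ G (suc o)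
    superG (suc zero) _ = subst (λ z → 3ℚ * (t * (z * (1ℚ + G₂))) ≤ G₂) (sym (ℚ.*-identityʳ t))
      super₂
    superG (suc (suc o)) _ = ℚ.≤-trans
      (*-monoˡ-≤0 (ℚ.nonNegative⁻¹ 3ℚ) (*-monoˡ-≤0 0≤t
        (ℚ.≤-trans (*-monoʳ-≤0 (0≤+ (ℚ.nonNegative⁻¹ 1ℚ) 0≤G₃)
            (power-anti 0≤t t≤1 {2} {suc (suc o)} (s≤s (s≤s z≤n))))
          (ℚ.≤-reflexive (solve 2 (λ t g → (t :* (t :* con 1ℚ)) :* g := t :* (t :* g)) refl t (1ℚ + G₃))))))
      super₃

    -- Length 0 is recorded for a variable already paid for by its `G`, so that its further
    -- occurrences contribute `tp 0 = 1`.
    wt : (Var → Maybe ℕ) → Pattern → ℚ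
    wt σ [] = 1ℚ
    wt σ (plet X b ∷ q) with σ X
    ... | just n  = tp n * wt σ q
    ... | nothing = G (suc (occ X q)) * wt (σ [ X ↦ just 0 ]) q

    0≤wt : ∀ σ q → 0ℚ ≤ wt σ q
    0≤wt σ [] = ℚ.nonNegative⁻¹ 1ℚ
    0≤wt σ (plet X b ∷ q) with σ X
    ... | just n = 0≤* (tp n) (wt σ q) (0≤tp n) (0≤wt σ q)
    ... | nothing = 0≤* (G (suc (occ X q))) (wt (σ [ X ↦ just 0 ]) q) (0≤G (suc (occ X q))) (0≤wt _ q)

    upd-cong : ∀ {σ τ : Var → Maybe ℕ} → (∀ Y → σ Y ≡ τ Y) → ∀ X v Y → (σ [ X ↦ v ]) Y ≡ (τ [ X ↦ v ]) Y
    upd-cong e X v Y with X ℕ.≟ Y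
    ... | yes _ = refl
    ... | no _ = e Y

    wt-cong : ∀ {σ τ} → (∀ Y → σ Y ≡ τ Y) → ∀ q → wt σ q ≡ wt τ q
    wt-cong e [] = refl
    wt-cong {σ} {τ} e (plet X b ∷ q) with σ X | τ X | e X
    ... | just n  | _ | refl = cong (tp n *_) (wt-cong e q)
    ... | nothing | _ | refl = cong (G (suc (occ X q)) *_) (wt-cong (upd-cong e X (just 0)) q)

    upd-agree : ∀ X Y {σ τ : Var → Maybe ℕ} → (∀ Z → X ≢ Z → σ Z ≡ τ Z) →
                ∀ Z → X ≢ Z → (σ [ Y ↦ just 0 ]) Z ≡ (τ [ Y ↦ just 0 ]) Z
    upd-agree X Y e Z X≢Z with Y ℕ.≟ Z
    ... | yes _ = refl
    ... | no _ = e Z X≢Z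

    wt-scale : ∀ X n {σ τ} → σ X ≡ just n → τ X ≡ just 0 → (∀ Y → X ≢ Y → σ Y ≡ τ Y) →
               ∀ q → wt σ q ≡ tp (n ℕ.* occ X q) * wt τ q
    wt-scale X n eσ eτ e [] rewrite ℕ.*-zeroʳ n = refl
    wt-scale X n {σ} {τ} eσ eτ e (plet Y b ∷ q) with X ℕ.≟ Y
    ... | yes refl rewrite eσ | eτ | occ-≡ X b q | ℕ.*-suc n (occ X q)
        | wt-scale X n {σ} {τ} eσ eτ e q | power-+ t n (n ℕ.* occ X q) =
          solve 3 (λ a b c → a :* (b :* c) := (a :* b) :* (con 1ℚ :* c)) refl (tp n) (tp (n ℕ.* occ X q))
              (wt τ q)
    ... | no X≢Y rewrite occ-≢ {X} {Y} b q X≢Y with σ Y | τ Y | e Y X≢Y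
    ...   | just m  | _ | refl rewrite wt-scale X n {σ} {τ} eσ eτ e q =
            solve 3 (λ a b c → a :* (b :* c) := b :* (a :* c)) refl (tp m) (tp (n ℕ.* occ X q)) (wt τ q)
    ...   | nothing | _ | refl
            rewrite wt-scale X n {σ [ Y ↦ just 0 ]} {τ [ Y ↦ just 0 ]}
                      (trans (upd-≢ σ (just 0) (X≢Y ∘ sym)) eσ) (trans (upd-≢ τ (just 0) (X≢Y ∘ sym)) eτ)
                          (upd-agree X Y e) q =
            solve 3 (λ a b c → a :* (b :* c) := b :* (a :* c)) refl (G (suc (occ Y q))) (tp (n ℕ.* occ X q))
                (wt (τ [ Y ↦ just 0 ]) q)

    base : Env → Var → Pattern → ℚ
    base η X q = wt (lengths η [ X ↦ just 0 ]) q

    -- In a `read` state the image of `X` is longer than `y`. Each later copy is charged for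
    -- `length y` letters now; the unread remainder is left to `G`.
    weight : State → ℚ
    weight (match ρ η q) = tp (length ρ) * wt (lengths η) q
    weight (read X b y η q) = G (suc (occ X q)) * (tp (length y ℕ.* occ X q) * base η X q)

    0≤weight : ∀ s → 0ℚ ≤ weight s
    0≤weight (match ρ η q) = 0≤* (tp (length ρ)) (wt (lengths η) q) (0≤tp (length ρ)) (0≤wt _ q)
    0≤weight (read X b y η q) = 0≤* (G (suc (occ X q))) (tp (length y ℕ.* occ X q) * base η X q)
        (0≤G (suc (occ X q)))
      (0≤* (tp (length y ℕ.* occ X q)) (base η X q) (0≤tp (length y ℕ.* occ X q)) (0≤wt _ q))

    total : List State → ℚ
    total [] = 0ℚ
    total (s ∷ L) = weight s + total L

    0≤total : ∀ L → 0ℚ ≤ total L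
    0≤total [] = ℚ.≤-refl
    0≤total (s ∷ L) = 0≤+ (0≤weight s) (0≤total L)

    total-++ : ∀ L M → total (L ++ M) ≡ total L + total M
    total-++ [] M = sym (ℚ.+-identityˡ _)
    total-++ (s ∷ L) M = trans (cong (weight s +_) (total-++ L M)) (sym (ℚ.+-assoc (weight s) _ _))

    weight≤total : ∀ {s L} → s ∈ L → weight s ≤ total L
    weight≤total {s} {_ ∷ L} (here refl) = ℚ.≤-trans (ℚ.≤-reflexive (sym (ℚ.+-identityʳ _)))
        (ℚ.+-monoʳ-≤ (weight s) (0≤total L))
    weight≤total {s} {r ∷ L} (there m) = ℚ.≤-trans (weight≤total m)
      (ℚ.≤-trans (ℚ.≤-reflexive (sym (ℚ.+-identityˡ _))) (ℚ.+-monoˡ-≤ (total L) (0≤weight r)))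

    wt-known : ∀ η X y q → wt (lengths (η [ X ↦ just y ])) q ≡ tp (length y ℕ.* occ X q) * base η X q
    wt-known η X y q = wt-scale X (length y) (cong (Maybe.map length) (upd-≡ η X (just y)))
      (upd-≡ (lengths η) X (just 0))
      (λ Y X≢Y → trans (cong (Maybe.map length) (upd-≢ η (just y) X≢Y)) (sym (upd-≢ (lengths η) (just 0) X≢Y)))
          q

    total-advance : ∀ X b y η q →
      total (advance X b y η q) ≡ (1ℚ + G (suc (occ X q))) * (tp (length y ℕ.* occ X q) * base η X q)
    total-advance X b y η q rewrite wt-known η X (orient b y) q | length-orient b y =
      solve 2 (λ g w → g :* w :+ (con 1ℚ :* w :+ con 0ℚ) := (con 1ℚ :+ g) :* w) refl
        (G (suc (occ X q))) (tp (length y ℕ.* occ X q) * base η X q)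

    Σ₃ : (Letter → ℚ) → ℚ
    Σ₃ f = f zero + (f (suc zero) + f (suc (suc zero)))

    -- At most one of the three letters agrees with the head of `ρ`, and the surviving state has one
    -- letter fewer to read, which the factor `t` pays for.
    Σ₃-expect : ∀ ρ η q → Σ₃ (λ a → t * total (expect a ρ η q)) ≤ tp (length ρ) * wt (lengths η) q
    Σ₃-expect [] η q = ℚ.≤-trans (ℚ.≤-reflexive
        (solve 1 (λ t → t :* con 0ℚ :+ (t :* con 0ℚ :+ t :* con 0ℚ) := con 0ℚ) refl t))
        (0≤* (tp 0) (wt (lengths η) q) (0≤tp 0) (0≤wt (lengths η) q))
    Σ₃-expect (zero ∷ ρ) η q = ℚ.≤-reflexive (solve 3
        (λ t p w → t :* (p :* w :+ con 0ℚ) :+ (t :* con 0ℚ :+ t :* con 0ℚ) := (t :* p) :* w) refl t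
        (tp (length ρ)) (wt (lengths η) q))
    Σ₃-expect (suc zero ∷ ρ) η q = ℚ.≤-reflexive
        (solve 3 (λ t p w → t :* con 0ℚ :+ (t :* (p :* w :+ con 0ℚ) :+ t :* con 0ℚ) := (t :* p) :* w) refl t
        (tp (length ρ)) (wt (lengths η) q))
    Σ₃-expect (suc (suc zero) ∷ ρ) η q = ℚ.≤-reflexive
        (solve 3 (λ t p w → t :* con 0ℚ :+ (t :* con 0ℚ :+ t :* (p :* w :+ con 0ℚ)) := (t :* p) :* w) refl t
        (tp (length ρ)) (wt (lengths η) q))

    -- Rules out an unknown variable with a single remaining occurrence: no later copy would pay for
    -- the three choices of each letter of its image, and `superG` asks for `1 ≤ o`.
    Good : State → Set
    Good (match ρ η q) = ∀ Y → η Y ≡ nothing → occ Y q ≢ 1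
    Good (read X b y η q) = (1 ℕ.≤ occ X q) × (∀ Y → η Y ≡ nothing → Y ≢ X → occ Y q ≢ 1)

    -- A letter added to the image of `X` lengthens all its later copies by one. The resulting
    -- `tp (occ X q)` stands against three letters and the two continuations counted by `1 + G`, the
    -- balance expressed by `superG`.
    Σ₃-advance : ∀ X b (y : Letter → List Letter) n η q → (∀ a → length (y a) ≡ suc n) → 1 ℕ.≤ occ X q →
      Σ₃ (λ a → t * total (advance X b (y a) η q)) ≤ G (suc (occ X q)) * (tp (n ℕ.* occ X q) * base η X q)
    Σ₃-advance X b y n η q len 1≤o
      rewrite total-advance X b (y zero) η q | total-advance X b (y (suc zero)) η q | total-advance X b
          (y (suc (suc zero))) η q
            | len zero | len (suc zero) | len (suc (suc zero)) | power-+ t (occ X q) (n ℕ.* occ X q) =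
      ℚ.≤-trans
        (ℚ.≤-reflexive (solve 5 (λ t g o m w →
           t :* ((con 1ℚ :+ g) :* ((o :* m) :* w)) :+
               (t :* ((con 1ℚ :+ g) :* ((o :* m) :* w)) :+ t :* ((con 1ℚ :+ g) :* ((o :* m) :* w)))
           := (con 3ℚ :* (t :* (o :* (con 1ℚ :+ g)))) :* (m :* w)) refl
           t (G (suc (occ X q))) (tp (occ X q)) (tp (n ℕ.* occ X q)) (base η X q)))
        (*-monoʳ-≤0 (0≤* (tp (n ℕ.* occ X q)) (base η X q) (0≤tp (n ℕ.* occ X q))
            (0≤wt (lengths η [ X ↦ just 0 ]) q)) (superG (occ X q) 1≤o))

    length-snoc : (y : List Letter) (a : Letter) → length (y ++ a ∷ []) ≡ suc (length y)
    length-snoc y a = trans (length-++ y) (ℕ.+-comm (length y) 1)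

    occ≥1 : ∀ X b q → occ X (plet X b ∷ q) ≢ 1 → 1 ℕ.≤ occ X q
    occ≥1 X b q h with occ X q in eq
    ... | suc _ = s≤s z≤n
    ... | zero = contradiction (trans (occ-≡ X b q) (cong suc eq)) h

    -- Each step multiplies the expected total weight by at most 1 / (3 t).
    drift : ∀ s → Good s → Σ₃ (λ a → t * total (step a s)) ≤ weight s
    drift (match (c ∷ ρ) η q) g = Σ₃-expect (c ∷ ρ) η q
    drift (match [] η []) g = Σ₃-expect [] η []
    drift (match [] η (plet X b ∷ q)) g with η X in eq
    ... | just y = ℚ.≤-trans (Σ₃-expect (orient b y) η q) (ℚ.≤-reflexive
          (trans (cong (λ n → tp n * wt (lengths η) q) (length-orient b y)) (sym (ℚ.*-identityˡ _))))
    ... | nothing = ℚ.≤-trans (Σ₃-advance X b (_∷ []) 0 η q (λ _ → refl) (occ≥1 X b q (g X eq)))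
          (ℚ.≤-reflexive (solve 2 (λ g w → g :* (con 1ℚ :* w) := con 1ℚ :* (g :* w)) refl (G (suc (occ X q)))
              (base η X q)))
    drift (read X b y η q) (1≤o , g) = Σ₃-advance X b (λ a → y ++ a ∷ []) (length y) η q (length-snoc y) 1≤o

    steps : Letter → List State → List State
    steps a = concatMap (step a)

    drifts : ∀ L → All Good L → Σ₃ (λ a → t * total (steps a L)) ≤ total L
    drifts [] [] = ℚ.≤-reflexive (solve 1 (λ t → t :* con 0ℚ :+ (t :* con 0ℚ :+ t :* con 0ℚ) := con 0ℚ) refl t)
    drifts (s ∷ L) (g ∷ gs)
      rewrite total-++ (step zero s) (steps zero L) | total-++ (step (suc zero) s) (steps (suc zero) L)
            | total-++ (step (suc (suc zero)) s) (steps (suc (suc zero)) L) =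
      ℚ.≤-trans
        (ℚ.≤-reflexive (solve 7 (λ t a b c x y z →
          t :* (a :+ x) :+ (t :* (b :+ y) :+ t :* (c :+ z))
          := (t :* a :+ (t :* b :+ t :* c)) :+ (t :* x :+ (t :* y :+ t :* z))) refl
          t (total (step zero s)) (total (step (suc zero) s)) (total (step (suc (suc zero)) s))
          (total (steps zero L)) (total (steps (suc zero) L)) (total (steps (suc (suc zero)) L))))
        (ℚ.+-mono-≤ (drift s g) (drifts L gs))

    all-++ : ∀ {L M} → All Good L → All Good M → All Good (L ++ M)
    all-++ [] gs = gs
    all-++ (g ∷ gs) gs' = g ∷ all-++ gs gs'

    good-expect : ∀ a ρ η q → (∀ Y → η Y ≡ nothing → occ Y q ≢ 1) → All Good (expect a ρ η q)
    good-expect a [] η q g = []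
    good-expect a (c ∷ ρ) η q g with a Fin.≟ c
    ... | yes _ = g ∷ []
    ... | no _ = []

    good-advance : ∀ X b y η q → 1 ℕ.≤ occ X q → (∀ Y → η Y ≡ nothing → Y ≢ X → occ Y q ≢ 1) →
                   All Good (advance X b y η q)
    good-advance X b y η q 1≤o g = (1≤o , g) ∷ known ∷ []
      where
      known : ∀ Y → (η [ X ↦ just (orient b y) ]) Y ≡ nothing → occ Y q ≢ 1
      known Y with X ℕ.≟ Y
      ... | yes _ = λ ()
      ... | no X≢Y = λ e → g Y e (X≢Y ∘ sym)

    good-step : ∀ a s → Good s → All Good (step a s)
    good-step a (match (c ∷ ρ) η q) g = good-expect a (c ∷ ρ) η q g
    good-step a (match [] η []) g = []
    good-step a (match [] η (plet X b ∷ q)) g with η X in eq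
    ... | just y = good-expect a (orient b y) η q unknown
      where
      unknown : ∀ Y → η Y ≡ nothing → occ Y q ≢ 1
      unknown Y e with Y ℕ.≟ X
      ... | yes refl = case trans (sym e) eq of λ ()
      ... | no Y≢X = subst (_≢ 1) (occ-≢ b q Y≢X) (g Y e)
    ... | nothing = good-advance X b (a ∷ []) η q (occ≥1 X b q (g X eq))
                      (λ Y e Y≢X → subst (_≢ 1) (occ-≢ b q Y≢X) (g Y e))
    good-step a (read X b y η q) (1≤o , g) = good-advance X b (y ++ a ∷ []) η q 1≤o g

    good-steps : ∀ a L → All Good L → All Good (steps a L)
    good-steps a [] [] = []
    good-steps a (s ∷ L) (g ∷ gs) = all-++ (good-step a s g) (good-steps a L gs)

    mutual
      good-late : ∀ rp η u q → (∀ Y → η Y ≡ nothing → Y ∉ map var rp → occ Y q ≢ 1) → All Good (late rp η u q)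
      good-late [] η u q g = (λ Y e → g Y e (λ ())) ∷ []
      good-late (plet X b ∷ rp) η u q g = good-lateFrom X b rp η [] u q g

      good-lateFrom : ∀ X b rp η y u q → (∀ Y → η Y ≡ nothing → Y ∉ X ∷ map var rp → occ Y q ≢ 1) →
                      All Good (lateFrom X b rp η y u q)
      good-lateFrom X b rp η y [] q g = []
      good-lateFrom X b rp η y (c ∷ u) q g =
        all-++ (good-late rp _ u q known) (good-lateFrom X b rp η (c ∷ y) u q g)
        where
        known : ∀ Y → (η [ X ↦ just (orient b (c ∷ y)) ]) Y ≡ nothing → Y ∉ map var rp → occ Y q ≢ 1
        known Y with X ℕ.≟ Y
        ... | yes _ = λ ()
        ... | no X≢Y = λ e Y∉ → g Y e λ { (here e') → X≢Y (sym e') ; (there i) → Y∉ i }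

    zeros-agree : ∀ X rp {σ τ} → (∀ Z → X ≢ Z → σ Z ≡ τ Z) → ∀ Z → X ≢ Z → zeros σ rp Z ≡ zeros τ rp Z
    zeros-agree X [] e = e
    zeros-agree X (l ∷ rp) e = zeros-agree X rp (upd-agree X (var l) e)

    zeros-∉ : ∀ X rp {σ} → All (X ≢_) (map var rp) → zeros σ rp X ≡ σ X
    zeros-∉ X [] [] = refl
    zeros-∉ X (l ∷ rp) {σ} (X≢ ∷ X∉) = trans (zeros-∉ X rp X∉) (upd-≢ σ (just 0) (X≢ ∘ sym))

    mutual
      -- The letters of these images are already in the history, so only lengths are summed, without
      -- a factor 3. The geometric series of each variable is bounded by `H`, and `superH` adds one
      -- more length to it.
      total-late : ∀ rp η u q → AllPairs _≢_ (map var rp) → All (λ l → 1 ℕ.≤ occ (var l) q) rp →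
                   total (late rp η u q) ≤ power H (length rp) * wt (zeros (lengths η) rp) q
      total-late [] η u q _ _ = ℚ.≤-reflexive
          (solve 1 (λ w → con 1ℚ :* w :+ con 0ℚ := con 1ℚ :* w) refl (wt (lengths η) q))
      total-late (plet X b ∷ rp) η u q distinct os = ℚ.≤-trans
        (total-lateFrom X b rp η [] u q distinct os)
        (ℚ.≤-reflexive (solve 3 (λ h p w → con 1ℚ :* (h :* (p :* w)) := (h :* p) :* w) refl
          H (power H (length rp)) (wt (zeros (lengths η [ X ↦ just 0 ]) rp) q)))

      total-lateFrom : ∀ X b rp η y u q → AllPairs _≢_ (X ∷ map var rp) →
        All (λ l → 1 ℕ.≤ occ (var l) q) (plet X b ∷ rp) →
        total (lateFrom X b rp η y u q) ≤
          tp (length y) * (H * (power H (length rp) * wt (zeros (lengths η [ X ↦ just 0 ]) rp) q))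
      total-lateFrom X b rp η y [] q _ _ = 0≤* (tp (length y)) _ (0≤tp (length y))
        (0≤* H _ 0≤H (0≤* (power H (length rp)) _ (0≤power 0≤H (length rp))
            (0≤wt (zeros (lengths η [ X ↦ just 0 ]) rp) q)))
      total-lateFrom X b rp η y (c ∷ u) q (X∉ ∷ distinct) (o ∷ os)
        rewrite total-++ (late rp (η [ X ↦ just (orient b (c ∷ y)) ]) u q) (lateFrom X b rp η (c ∷ y) u q) =
        ℚ.≤-trans
          (ℚ.+-mono-≤
            (ℚ.≤-trans (total-late rp (η [ X ↦ just (orient b (c ∷ y)) ]) u q distinct os)
              (*-monoˡ-≤0 (0≤power 0≤H (length rp)) wt-late))
            (total-lateFrom X b rp η (c ∷ y) u q (X∉ ∷ distinct) (o ∷ os)))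
          (ℚ.≤-trans
            (ℚ.≤-reflexive (solve 5 (λ t p h k w →
              (k :* ((t :* p) :* w)) :+ ((t :* p) :* (h :* (k :* w))) := (t :* (con 1ℚ :+ h)) :*
                  (p :* (k :* w))) refl
              t (tp (length y)) H (power H (length rp)) W))
            (ℚ.≤-trans
              (*-monoʳ-≤0 (0≤* (tp (length y)) _ (0≤tp (length y))
                  (0≤* (power H (length rp)) W (0≤power 0≤H (length rp)) 0≤W)) superH)
              (ℚ.≤-reflexive (solve 4 (λ p h k w → h :* (p :* (k :* w)) := p :* (h :* (k :* w))) refl
                (tp (length y)) H (power H (length rp)) W))))
        where
        W = wt (zeros (lengths η [ X ↦ just 0 ]) rp) q
        0≤W = 0≤wt (zeros (lengths η [ X ↦ just 0 ]) rp) q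
        η' = η [ X ↦ just (orient b (c ∷ y)) ]
        lenX : length (orient b (c ∷ y)) ≡ suc (length y)
        lenX = length-orient b (c ∷ y)
        -- One later copy of `X` is enough for the geometric series; further copies only lower the
        -- weight.
        wt-late : wt (zeros (lengths η') rp) q ≤ tp (suc (length y)) * W
        wt-late = ℚ.≤-trans
          (ℚ.≤-reflexive (wt-scale X (suc (length y))
            (trans (zeros-∉ X rp X∉) (trans (cong (Maybe.map length) (upd-≡ η X _)) (cong just lenX)))
            (trans (zeros-∉ X rp X∉) (upd-≡ (lengths η) X (just 0)))
            (zeros-agree X rp (λ Z X≢Z → trans (cong (Maybe.map length) (upd-≢ η _ X≢Z))
                (sym (upd-≢ (lengths η) _ X≢Z)))) q))
          (*-monoʳ-≤0 0≤W (power-anti 0≤t t≤1 (ℕ.m≤m*n (suc (length y)) (occ X q) {{ℕ.>-nonZero o}})))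

-- The greedy word and why it contains no occurrence

module Greedy where

  open Potential
  open Words using (Letter)
  open import Data.Bool using (Bool; true; false)
  open import Data.Fin using (Fin; zero; suc)
  import Data.Fin as Fin
  open import Data.List using (List; []; _∷_; _++_; length; reverse; map; _ʳ++_)
  open import Data.List.Properties
  open import Data.List.Membership.Propositional using (_∈_; _∉_)
  open import Data.List.Membership.Propositional.Properties using (∈-++⁺ˡ; ∈-++⁺ʳ)
  open import Data.List.Relation.Unary.All as All using (All; []; _∷_)
  open import Data.List.Relation.Unary.AllPairs using (AllPairs; []; _∷_)
  open import Data.List.Relation.Unary.Any using (here; there)
  open import Data.Maybe using (just; nothing)
  open import Data.Nat as ℕ using (ℕ; zero; suc)
  import Data.Nat.Properties as ℕ
  open import Data.Product using (∃-syntax; _×_; _,_; proj₁; proj₂)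
  open import Data.Rational as ℚ using (ℚ; 0ℚ; 1ℚ; _+_; _*_; _≤_; _<_)
  import Data.Rational.Properties as ℚ
  open import Data.Rational.Solver using (module +-*-Solver)
  open import Data.Unit using (tt)
  open import Function using (case_of_)
  open import Relation.Nullary using (¬_; yes; no; contradiction)
  open import Relation.Binary.PropositionalEquality
  open +-*-Solver using (solve; _:=_; _:+_; _:*_; con)

  img-++ : {A : Set} (h : Var → List A) (p q : Pattern) → img h (p ++ q) ≡ img h p ++ img h q
  img-++ h p q = concatMap-++ (imgLetter h) p q

  factorAt-++ : {A : Set} (w : InfWord A) (i : ℕ) (u v : List A) →
                factorAt w i (length (u ++ v)) ≡ u ++ v →
                factorAt w i (length u) ≡ u × factorAt w (i ℕ.+ length u) (length v) ≡ v
  factorAt-++ w i [] v e rewrite ℕ.+-identityʳ i = refl , e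
  factorAt-++ w i (c ∷ u) v e with factorAt-++ w (suc i) u v (∷-injectiveʳ e)
  ... | eu , ev = cong₂ _∷_ (∷-injectiveˡ e) eu , subst (λ k → factorAt w k (length v) ≡ v)
      (sym (ℕ.+-suc i (length u))) ev

  Images≢[] : {A : Set} → (Var → List A) → Pattern → Set
  Images≢[] h = All (λ l → NonEmpty (h (var l)))

  NonEmpty-orient : {A : Set} (b : Bool) (y : List A) → NonEmpty y → NonEmpty (orient b y)
  NonEmpty-orient false y ne = ne
  NonEmpty-orient true (c ∷ y) ne with reverse (c ∷ y) | length-reverse (c ∷ y)
  ... | _ ∷ _ | _ = tt

  Agrees : (Var → List Letter) → Env → Set
  Agrees h η = ∀ Y y → η Y ≡ just y → h Y ≡ y

  agrees-upd : ∀ {h η} X y → h X ≡ y → Agrees h η → Agrees h (η [ X ↦ just y ])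
  agrees-upd X y e ag Y z with X ℕ.≟ Y
  ... | yes refl = λ { refl → e }
  ... | no _ = ag Y z

  -- The state agrees with the true images `h`, and `z` is what remains of the occurrence. The
  -- non-empty `y'` separates a `read` state from the `match` state that `advance` produces beside
  -- it.
  Fits : (Var → List Letter) → State → List Letter → Set
  Fits h (match ρ η q) z = Agrees h η × ρ ++ img h q ≡ z
  Fits h (read X b y η q) z =
    Agrees h η × ∃[ y' ] y ++ y' ≡ orient b (h X) × NonEmpty y' × y' ++ img h q ≡ z

  rest : State → Pattern
  rest (match ρ η q) = q
  rest (read X b y η q) = q

  module _ {h : Var → List Letter} where

    Succeeds : List State → Pattern → List Letter → Set
    Succeeds L q z = ∃[ s ] s ∈ L × Images≢[] h (rest s) × Fits h s z

    succeeds-expect : ∀ {a z} ρ η q → Images≢[] h q → NonEmpty ρ → Agrees h η → ρ ++ img h q ≡ a ∷ z →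
                      Succeeds (expect a ρ η q) q z
    succeeds-expect {a} (c ∷ ρ) η q ne _ ag e with a Fin.≟ c
    ... | yes _ = match ρ η q , here refl , ne , ag , ∷-injectiveʳ e
    ... | no a≢c = contradiction (sym (∷-injectiveˡ e)) a≢c

    succeeds-advance : ∀ {z} X b y y' η q → Images≢[] h q → Agrees h η → y ++ y' ≡ orient b (h X) →
                       y' ++ img h q ≡ z → Succeeds (advance X b y η q) q z
    succeeds-advance X b y [] η q ne ag ey e = match [] _ q , there (here refl) , ne ,
      agrees-upd X (orient b y) (sym (trans (cong (orient b) (trans (sym (++-identityʳ y)) ey))
          (orient-involutive b (h X)))) ag , e
    succeeds-advance X b y (c ∷ y') η q ne ag ey e = read X b y η q , here refl , ne , ag , c ∷ y' , ey , tt , e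

    -- Completeness of the bookkeeping: among the guesses produced by the letter that is actually
    -- read, one follows `h`, so a true occurrence never drops out of the list.
    succeeds-step : ∀ {a z} s → Images≢[] h (rest s) → Fits h s (a ∷ z) → Succeeds (step a s) (rest s) z
    succeeds-step (match (c ∷ ρ) η q) ne (ag , e) = succeeds-expect (c ∷ ρ) η q ne tt ag e
    succeeds-step {a} (match [] η (plet X b ∷ q)) (n ∷ ne) (ag , e) with η X in eq
    ... | just y = succeeds-expect (orient b y) η q ne
            (NonEmpty-orient b y (subst NonEmpty (ag X y eq) n)) ag
            (subst (λ u → u ++ img h q ≡ _) (trans (imgLetter-orient h X b) (cong (orient b) (ag X y eq))) e)
    ... | nothing with imgLetter h (plet X b) in eX | subst NonEmpty (sym (imgLetter-orient h X b))
        (NonEmpty-orient b (h X) n)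
    ...   | c ∷ y' | _ with ∷-injectiveˡ e
    ...     | refl = succeeds-advance X b (c ∷ []) y' η q ne ag (trans (sym eX) (imgLetter-orient h X b))
        (∷-injectiveʳ e)
    succeeds-step {a} (read X b y η q) ne (ag , c ∷ y' , ey , _ , e) with ∷-injectiveˡ e
    ... | refl = succeeds-advance X b (y ++ a ∷ []) y' η q ne ag (trans (++-assoc y (a ∷ []) y') ey)
        (∷-injectiveʳ e)

    recentImg : List PLetter → List Letter → List Letter
    recentImg [] u = u
    recentImg (l ∷ rp) u = reverse (imgLetter h l) ++ recentImg rp u

    reverse-img : ∀ rp u → reverse (img h (reverse rp)) ++ u ≡ recentImg rp u
    reverse-img [] u = refl
    reverse-img (l ∷ rp) u rewrite unfold-reverse l rp | img-++ h (reverse rp) (l ∷ []) | ++-identityʳ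
        (imgLetter h l)
      | reverse-++ (img h (reverse rp)) (imgLetter h l) | ++-assoc (reverse (imgLetter h l))
          (reverse (img h (reverse rp))) u
      = cong (reverse (imgLetter h l) ++_) (reverse-img rp u)

    Recalls : List State → Pattern → Set
    Recalls L q = ∃[ η ] Agrees h η × match [] η q ∈ L

    mutual
      recalls-late : ∀ rp η u q → Images≢[] h rp → Agrees h η → Recalls (late rp η (recentImg rp u) q) q
      recalls-late [] η u q _ ag = η , ag , here refl
      recalls-late (plet X b ∷ rp) η u q (n ∷ ne) ag =
        recalls-lateFrom X b rp η [] (reverse (imgLetter h (plet X b))) u q ne
          (subst NonEmpty (cong reverse (sym (imgLetter-orient h X b)))
            (NonEmpty-orient true (orient b (h X)) (NonEmpty-orient b (h X) n)))
          (trans (reverse-involutive (imgLetter h (plet X b))) (imgLetter-orient h X b)) ag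

      -- The current image is split between the part `y` already cut off and the part `s` still in
      -- the history, in reverse; `s ʳ++ y` is the image in reading order.
      recalls-lateFrom : ∀ X b rp η y s u q → Images≢[] h rp → NonEmpty s → s ʳ++ y ≡ orient b (h X) →
        Agrees h η → Recalls (lateFrom X b rp η y (s ++ recentImg rp u) q) q
      recalls-lateFrom X b rp η y (c ∷ []) u q ne _ e ag
        with recalls-late rp (η [ X ↦ just (orient b (c ∷ y)) ]) u q ne
               (agrees-upd X _ (trans (sym (orient-involutive b (h X))) (cong (orient b) (sym e))) ag)
      ... | η' , ag' , i = η' , ag' , ∈-++⁺ˡ i
      recalls-lateFrom X b rp η y (c ∷ d ∷ s) u q ne _ e ag
        with recalls-lateFrom X b rp η (c ∷ y) (d ∷ s) u q ne tt e ag
      ... | η' , ag' , i = η' , ag' , ∈-++⁺ʳ (late rp _ _ q) i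

  module Construction (t G₂ G₃ H : ℚ) (0≤t : 0ℚ ≤ t) (t≤1 : t ≤ 1ℚ)
    (0≤G₂ : 0ℚ ≤ G₂) (0≤G₃ : 0ℚ ≤ G₃) (0≤H : 0ℚ ≤ H)
    (super₂ : 3ℚ * (t * (t * (1ℚ + G₂))) ≤ G₂)
    (super₃ : 3ℚ * (t * (t * (t * (1ℚ + G₃)))) ≤ G₃)
    (superH : t * (1ℚ + H) ≤ H) where

    open Weights t G₂ G₃ H 0≤t t≤1 0≤G₂ 0≤G₃ 0≤H super₂ super₃ superH public

    -- If all three totals were at least 1, adding them with factor `t` would give `3 t ≤ total L`
    -- by `drifts`.
    choose : ∀ L → All Good L → total L < 3ℚ * t → ∃[ a ] total (steps a L) < 1ℚ
    choose L g small with total (steps zero L) ℚ.<? 1ℚ | total (steps (suc zero) L) ℚ.<? 1ℚ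
                        | total (steps (suc (suc zero)) L) ℚ.<? 1ℚ
    ... | yes p | _ | _ = zero , p
    ... | no _ | yes p | _ = suc zero , p
    ... | no _ | no _ | yes p = suc (suc zero) , p
    ... | no p | no q | no r = contradiction (ℚ.<-≤-trans small large) (ℚ.<-irrefl refl)
      where
      large : 3ℚ * t ≤ total L
      large = ℚ.≤-trans
        (ℚ.≤-trans (ℚ.≤-reflexive (solve 1 (λ t → con 3ℚ :* t := t :* con 1ℚ :+ (t :* con 1ℚ :+ t :* con 1ℚ))
            refl t))
          (ℚ.+-mono-≤ (*-monoˡ-≤0 0≤t (ℚ.≮⇒≥ p))
              (ℚ.+-mono-≤ (*-monoˡ-≤0 0≤t (ℚ.≮⇒≥ q)) (*-monoˡ-≤0 0≤t (ℚ.≮⇒≥ r)))))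
        (drifts L g)

    ∈-steps : ∀ {a s s' L} → s ∈ L → s' ∈ step a s → s' ∈ steps a L
    ∈-steps (here refl) i = ∈-++⁺ˡ i
    ∈-steps {a} {L = r ∷ L} (there m) i = ∈-++⁺ʳ (step a r) (∈-steps m i)

    module Avoiding (rp : List PLetter) (q : Pattern) (q≢[] : NonEmpty q)
      (distinct : AllPairs _≢_ (map var rp)) (later : All (λ l → 1 ℕ.≤ occ (var l) q) rp)
      (twice : ∀ Y → Y ∉ map var rp → occ Y q ≢ 1)
      (bound : 1ℚ + power H (length rp) * wt (zeros (λ _ → nothing) rp) q ≤ 3ℚ * t) where

      started : List Letter → List State
      started u = late rp (λ _ → nothing) u q

      record Config : Set where
        field
          history : List Letter
          threats : List State
          light   : total threats < 1ℚ
          good    : All Good threats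
      open Config

      active : Config → List State
      active c = started (history c) ++ threats c

      active-good : ∀ c → All Good (active c)
      active-good c = all-++ (good-late rp _ (history c) q (λ Y _ Y∉ → twice Y Y∉)) (good c)

      active-small : ∀ c → total (active c) < 3ℚ * t
      active-small c = subst (_< 3ℚ * t) (sym (total-++ (started (history c)) (threats c)))
        (ℚ.<-≤-trans
          (ℚ.+-mono-≤-< (total-late rp _ (history c) q distinct later) (light c))
          (ℚ.≤-trans (ℚ.≤-reflexive (ℚ.+-comm (power H (length rp) * wt (zeros (λ _ → nothing) rp) q) 1ℚ))
              bound))

      choice : (c : Config) → ∃[ a ] total (steps a (active c)) < 1ℚ
      choice c = choose (active c) (active-good c) (active-small c)

      next : Config → Config
      next c = record
        { history = proj₁ (choice c) ∷ history c
        ; threats = steps (proj₁ (choice c)) (active c)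
        ; light = proj₂ (choice c)
        ; good = good-steps (proj₁ (choice c)) (active c) (active-good c)
        }

      config : ℕ → Config
      config zero = record { history = [] ; threats = [] ; light = ℚ.positive⁻¹ 1ℚ ; good = [] }
      config (suc n) = next (config n)

      word : InfWord Letter
      word n = proj₁ (choice (config n))

      history-factorAt : ∀ i n → history (config (i ℕ.+ n)) ≡ factorAt word i n ʳ++ history (config i)
      history-factorAt i zero rewrite ℕ.+-identityʳ i = refl
      history-factorAt i (suc n) rewrite ℕ.+-suc i n = history-factorAt (suc i) n

      module _ {h : Var → List Letter} where

        -- A finished occurrence is a state `match [] η []`, whose weight 1 alone exceeds what
        -- `light` permits. Any other state still has letters to read.
        completed : ∀ n s → s ∈ threats (config n) → Images≢[] h (rest s) → ¬ Fits h s []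
        completed n (match [] η []) m ne (ag , e) = contradiction
          (ℚ.≤-<-trans (weight≤total m) (light (config n))) (ℚ.<-irrefl refl)
        completed n (match [] η (plet X b ∷ q)) m (n' ∷ ne) (ag , e) with imgLetter h (plet X b) | subst
            NonEmpty (sym (imgLetter-orient h X b)) (NonEmpty-orient b (h X) n')
        ... | _ ∷ _ | _ = case e of λ ()
        completed n (read X b y η q) m ne (ag , c ∷ y' , _ , _ , ())

        follow : ∀ z n s → NonEmpty z → s ∈ active (config n) → Images≢[] h (rest s) → Fits h s z →
                 factorAt word n (length z) ≢ z
        follow (a ∷ z) n s _ m ne fit e with ∷-injectiveˡ e | succeeds-step s ne fit
        follow (a ∷ []) n s _ m ne fit e | refl | s' , m' , ne' , fit' = completed (suc n) s' (∈-steps m m') ne'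
            fit'
        follow (a ∷ b ∷ z) n s _ m ne fit e | refl | s' , m' , ne' , fit' =
          follow (b ∷ z) (suc n) s' tt (∈-++⁺ʳ (started (history (config (suc n)))) (∈-steps m m')) ne' fit'
              (∷-injectiveʳ e)

        img≢[] : ∀ r → NonEmpty r → Images≢[] h r → NonEmpty (img h r)
        img≢[] (plet X b ∷ r) _ (n ∷ ne) with imgLetter h (plet X b) | subst NonEmpty
            (sym (imgLetter-orient h X b)) (NonEmpty-orient b (h X) n)
        ... | _ ∷ _ | _ = tt

        -- At the moment when the image of `reverse rp` has just been written, the list `started`
        -- contains the correct bindings; from there `follow` traces the image of `q`.
        absent : Images≢[] h rp → Images≢[] h q → ¬ IsFactor (img h (reverse rp ++ q)) word
        absent nrp nq (i , e) with factorAt-++ word i (img h (reverse rp)) (img h q)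
          (subst (λ u → factorAt word i (length u) ≡ u) (img-++ h (reverse rp) q) e)
        ... | eP , eQ with recalls-late rp (λ _ → nothing) (history (config i)) q nrp (λ _ _ ())
        ...   | η , ag , m = follow (img h q) n (match [] η q) (img≢[] q q≢[] nq)
                  (∈-++⁺ˡ (subst (λ u → match [] η q ∈ started u) (sym hist) m)) nq (ag , refl) eQ
          where
          n = i ℕ.+ length (img h (reverse rp))
          hist : history (config n) ≡ recentImg {h} rp (history (config i))
          hist = trans (history-factorAt i (length (img h (reverse rp))))
            (trans (cong (_ʳ++ history (config i)) eP)
              (trans (ʳ++-defn (img h (reverse rp))) (reverse-img rp (history (config i)))))

      avoidable : Avoidable 3 (reverse rp ++ q)
      avoidable = word , λ (h , ne , f) →
        absent {h} (All.tabulate λ {l} i → ne (var l) (reversed l , ∈-++⁺ˡ (∈-reverse i)))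
               (All.tabulate λ {l} i → ne (var l) (reversed l , ∈-++⁺ʳ (reverse rp) i)) f
        where
        ∈-reverse : ∀ {l} → l ∈ rp → l ∈ reverse rp
        ∈-reverse i = Data.List.Relation.Unary.Any.Properties.reverse⁺ i
          where import Data.List.Relation.Unary.Any.Properties

-- Close repetitions in fixed points of uniform morphisms

module Substitutive where

  open Words
  open import Data.Bool using (Bool; true; _∧_; not; T)
  open import Data.Bool.ListAction using (all)
  open import Data.Fin using (zero; suc)
  open import Data.List using (List; _∷_; length; concatMap; take; drop; foldr; upTo)
  open import Data.List.Properties
  open import Data.List.Membership.Propositional using (_∈_)
  open import Data.Maybe using (just)
  open import Data.Nat as ℕ using (ℕ; zero; suc; z≤n; s≤s; _+_; _*_; _∸_; _≤_; _<_; _<ᵇ_; _≡ᵇ_; _/_; _%_;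
      NonZero)
  open import Data.Nat.Properties
  open import Data.Nat.DivMod
  open import Data.Nat.Divisibility using (_∣_; divides)
  open import Data.Nat.Coprimality using (Coprime; coprime-divisor)
  open import Data.Nat.Induction using (<-rec)
  open import Data.Product using (_,_)
  open import Data.Unit using (tt)
  open import Function using (case_of_)
  open import Relation.Nullary using (yes; no; contradiction)
  open import Relation.Binary.PropositionalEquality
  open import Data.Nat.Solver using (module +-*-Solver)

  factorAt-cong : ∀ {A : Set} {v w : InfWord A} → (∀ n → v n ≡ w n) → ∀ i n → factorAt v i n ≡ factorAt w i n
  factorAt-cong e i zero = refl
  factorAt-cong e i (suc n) = cong₂ _∷_ (e i) (factorAt-cong e (suc i) n)

  ≡ᵇ-true⇒≡ : ∀ m n → (m ≡ᵇ n) ≡ true → m ≡ n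
  ≡ᵇ-true⇒≡ m n e = ≡ᵇ⇒≡ m n (subst T (sym e) tt)

  <ᵇ-true⇒< : ∀ m n → (m <ᵇ n) ≡ true → m < n
  <ᵇ-true⇒< m n e = <ᵇ⇒< m n (subst T (sym e) tt)

  %-cancel : ∀ i d q .{{_ : NonZero q}} → i % q ≡ (i + d) % q → q ∣ d
  %-cancel i d q e = subst (q ∣_) (m+n∸m≡n i d) (m%n≡o%n⇒∣ (i + d) i (sym e) (m≤m+n i d))
    where
    m%n≡o%n⇒∣ : ∀ m o → m % q ≡ o % q → o ≤ m → q ∣ m ∸ o
    m%n≡o%n⇒∣ m o eq o≤m = divides (m / q ∸ o / q) (trans (cong₂ _∸_ (m≡m%n+[m/n]*n m q) (m≡m%n+[m/n]*n o q))
      (trans (cong (λ r → (r + m / q * q) ∸ (o % q + o / q * q)) eq)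
        (trans ([m+n]∸[m+o]≡n∸o (o % q) (m / q * q) (o / q * q)) (sym (*-distribʳ-∸ q (m / q) (o / q))))))

  /-shift : ∀ i q e .{{_ : NonZero q}} → (i + e * q) / q ≡ i / q + e
  /-shift i q e = trans (+-distrib-/-∣ʳ i (divides e refl)) (cong (i / q +_) (m*n/n≡m e q))

  separated : Letter → Letter → Letter → Bool
  separated a b c = not (a == b) ∧ (not (a == c) ∧ not (b == c))

  separated-sound : ∀ (f : Letter → Letter) → separated (f zero) (f (suc zero)) (f (suc (suc zero))) ≡ true →
                    ∀ a b → f a ≡ f b → a ≡ b
  separated-sound f e a b fa≡fb with ∧-true e
  ... | p , qr with ∧-true qr
  ...   | q , r = go a b fa≡fb
    where
    clash : ∀ {x y} → not (x == y) ≡ true → x ≢ y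
    clash {x} h refl rewrite ==-refl x = case h of λ ()
    go : ∀ a b → f a ≡ f b → a ≡ b
    go zero zero _ = refl
    go (suc zero) (suc zero) _ = refl
    go (suc (suc zero)) (suc (suc zero)) _ = refl
    go zero (suc zero) h = contradiction h (clash p)
    go zero (suc (suc zero)) h = contradiction h (clash q)
    go (suc zero) (suc (suc zero)) h = contradiction h (clash r)
    go (suc zero) zero h = contradiction (sym h) (clash p)
    go (suc (suc zero)) zero h = contradiction (sym h) (clash q)
    go (suc (suc zero)) (suc zero) h = contradiction (sym h) (clash r)

  residueTrie : ℕ → ℕ → (Letter → List Letter) → List (List Letter) → Trie ℕ
  residueTrie q ℓ σ = foldr (λ φ t → foldr (λ s → insert (take ℓ (drop s (concatMap σ φ))) s) t (upTo q)) nil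

  module Substitution (q : ℕ) .{{_ : NonZero q}} (1<q : 1 < q) (σ : Letter → List Letter)
    (length-σ : ∀ a → length (σ a) ≡ q) (start : nth zero (σ zero) 0 ≡ zero) where

    iterate : ℕ → ℕ → Letter
    iterate zero n = zero
    iterate (suc i) n = nth zero (σ (iterate i (n / q))) (n % q)

    -- Position `n` has its final letter after `n` iterations, because dividing a positive position
    -- by `q ≥ 2` makes it smaller.
    fixed : InfWord Letter
    fixed n = iterate n n

    iterate-0 : ∀ i → iterate i 0 ≡ zero
    iterate-0 zero = refl
    iterate-0 (suc i) = trans (cong₂ (λ k s → nth zero (σ (iterate i k)) s) (0/n≡0 q)
        (m<n⇒m%n≡m (≤-trans (s≤s z≤n) 1<q)))
      (trans (cong (λ a → nth zero (σ a) 0) (iterate-0 i)) start)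

    iterate-stable : ∀ i j n → n ≤ i → n ≤ j → iterate i n ≡ iterate j n
    iterate-stable i j zero _ _ = trans (iterate-0 i) (sym (iterate-0 j))
    iterate-stable (suc i) (suc j) n@(suc _) (s≤s p) (s≤s p') =
      cong (λ a → nth zero (σ a) (n % q)) (iterate-stable i j (n / q) (≤-trans n/q≤ p) (≤-trans n/q≤ p'))
      where
      n/q≤ = ≤-pred (m/n<m n q 1<q)

    fixed-expand : ∀ n → fixed n ≡ nth zero (σ (fixed (n / q))) (n % q)
    fixed-expand zero = sym (trans (cong₂ (λ k s → nth zero (σ (fixed k)) s) (0/n≡0 q)
        (m<n⇒m%n≡m (≤-trans (s≤s z≤n) 1<q))) start)
    fixed-expand n@(suc m) = cong (λ a → nth zero (σ a) (n % q))
      (iterate-stable m (n / q) (n / q) (≤-pred (m/n<m n q 1<q)) ≤-refl)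

    open Expansion q fixed σ zero length-σ

    window-fixed : ∀ i m → factorAt fixed i (m * q ∸ i % q) ≡ drop (i % q)
        (concatMap σ (factorAt fixed (i / q) m))
    window-fixed i m = trans (factorAt-cong fixed-expand i _) (window i m)

    closedCheck : ℕ → List (List Letter) → Bool
    closedCheck m facs = all (λ φ → forText (λ u → member (take m u) facs) (concatMap σ φ)) facs
      where
      forText : (List Letter → Bool) → List Letter → Bool
      forText P u = below q (λ s → P (drop s u))

    syncCheck : ℕ → List (List Letter) → Trie ℕ → Bool
    syncCheck ℓ facs trie = all (λ φ → below q (λ s → eqMaybe (find (take ℓ (drop s (concatMap σ φ))) trie) s))
        facs

    -- Testing the longest agreement, the common prefix, covers all shorter ones; the index `e`
    -- stands for the distance `K * suc e`.
    shortRuns : ℕ → ℕ → ℕ → ℕ → List Letter → Bool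
    shortRuns K D C E u = below E (λ e → D * commonPrefix u (drop (K * suc e) u) + C <ᵇ K * suc e)

    shortCheck : ℕ → ℕ → ℕ → ℕ → List (List Letter) → Bool
    shortCheck K D C E facs = all (λ φ → below q (λ s → shortRuns K D C E (drop s (concatMap σ φ)))) facs

    module Factors (m : ℕ) (1≤m : 1 ≤ m) (facs : List (List Letter))
      (initial : member (factorAt fixed 0 m) facs ≡ true)
      (closed : closedCheck m facs ≡ true) where

      m≤mq∸s : ∀ {s} → s < q → m ≤ m * q ∸ s
      m≤mq∸s {s} s<q = ≤-trans (≤-reflexive (sym (m+n∸n≡m m s))) (∸-monoˡ-≤ s
        (≤-trans (+-monoʳ-≤ m (≤-trans (≤-pred (≤-trans s<q (≤-reflexive (sym (m+[n∸m]≡n (<⇒≤ 1<q))))))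
            (m≤n*m (q ∸ 1) m {{ℕ.>-nonZero 1≤m}})))
          (≤-reflexive (trans (cong (_+ m * (q ∸ 1)) (sym (*-identityʳ m)))
              (trans (sym (*-distribˡ-+ m 1 (q ∸ 1))) (cong (m *_) (m+[n∸m]≡n (<⇒≤ 1<q))))))))

      -- The factor at `n` lies in the image of the factor at the smaller position `n / q`, and the
      -- list is closed under taking such factors. Position 0 is its own ancestor, hence the
      -- separate check `initial`.
      factor∈ : ∀ n → factorAt fixed n m ∈ facs
      factor∈ = <-rec _ λ { zero _ → member-sound _ facs initial ; n@(suc _) ih →
        subst (_∈ facs)
          (trans (cong (take m) (sym (window-fixed n m))) (take-factorAt fixed n (m≤mq∸s (m%n<n n q))))
          (member-sound _ facs (below-sound q _ (all-sound _ facs closed (ih (m/n<m n q 1<q))) (m%n<n n q))) }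

      module Runs (K D C ℓ E : ℕ) .{{_ : NonZero K}} (coprime : Coprime q K) (3≤ℓ : 3 ≤ ℓ)
        (far : D * (ℓ ∸ 1) + C < K * suc E) (room : K * E + ℓ + q ≤ m * q) (trie : Trie ℕ)
        (columns : below q (λ s → separated (nth zero (σ zero) s) (nth zero (σ (suc zero)) s)
            (nth zero (σ (suc (suc zero))) s)) ≡ true)
        (sync : syncCheck ℓ facs trie ≡ true) (short : shortCheck K D C E facs ≡ true)
        where

        L : ℕ → ℕ
        L i = m * q ∸ i % q

        room' : ∀ i → K * E + ℓ ≤ L i
        room' i = ≤-trans (≤-reflexive (sym (m+n∸n≡m (K * E + ℓ) q)))
          (≤-trans (∸-monoˡ-≤ q room) (∸-monoʳ-≤ (m * q) (<⇒≤ (m%n<n i q))))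

        residue : ∀ i → find (factorAt fixed i ℓ) trie ≡ just (i % q)
        residue i = trans
          (cong (λ u → find u trie) (trans (sym (take-factorAt fixed i (≤-trans (m≤n+m ℓ (K * E)) (room' i))))
              (cong (take ℓ) (window-fixed i m))))
          (eqMaybe-sound _ _ (below-sound q _ (all-sound _ facs sync (factor∈ (i / q))) (m%n<n i q)))

        -- Descent through the morphism. An agreement of length at least `ℓ` fixes the residue
        -- modulo `q`; so `q` divides `K e`, hence `e` by coprimality, and the agreement lifts to
        -- the preimages at distance `K (e / q)`. The inequality found there, multiplied by `q`,
        -- suffices because `n ≤ m' q` and `C ≤ C q`. Shorter agreements satisfy it by `far` at
        -- large distances and by computation at the others.
        run : ∀ n i e → 1 ≤ n → 1 ≤ e → Agree fixed i (i + K * e) n → D * n + C < K * e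
        run = <-rec _ go
          where
          go : ∀ n → (∀ {n'} → n' < n → ∀ i e → 1 ≤ n' → 1 ≤ e → Agree fixed i (i + K * e) n' → D * n' + C < K *
              e) →
               ∀ i e → 1 ≤ n → 1 ≤ e → Agree fixed i (i + K * e) n → D * n + C < K * e
          go n ih i (suc e) 1≤n _ ag with n <? ℓ
          ... | yes n<ℓ with e <? E
          ...   | no e≮E = ≤-<-trans (+-monoˡ-≤ C
              (*-monoʳ-≤ D (≤-pred (≤-trans n<ℓ (≤-reflexive (sym (m+[n∸m]≡n (≤-trans (s≤s z≤n) 3≤ℓ))))))))
                    (<-≤-trans far (*-monoʳ-≤ K (s≤s (≮⇒≥ e≮E))))
          ...   | yes e<E = ≤-<-trans (+-monoˡ-≤ C (*-monoʳ-≤ D n≤cp))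
                    (<ᵇ-true⇒< _ _ (below-sound E _
                        (below-sound q _ (all-sound _ facs short (factor∈ (i / q))) (m%n<n i q)) e<E))
            where
            u = drop (i % q) (concatMap σ (factorAt fixed (i / q) m))
            n+Ke≤L : n + K * suc e ≤ L i
            n+Ke≤L = ≤-trans (≤-reflexive (+-comm n _))
                (≤-trans (+-mono-≤ (*-monoʳ-≤ K e<E) (<⇒≤ n<ℓ)) (room' i))
            n≤cp : n ≤ commonPrefix u (drop (K * suc e) u)
            n≤cp rewrite sym (window-fixed i m) | drop-factorAt fixed i (K * suc e) (L i) =
              commonPrefix-agree fixed n (≤-trans (m≤m+n n _) n+Ke≤L)
                (≤-trans (≤-reflexive (sym (m+n∸n≡m n (K * suc e)))) (∸-monoˡ-≤ (K * suc e) n+Ke≤L)) ag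
          go n ih i (suc e) 1≤n _ ag | no n≮ℓ = lift (coprime-divisor coprime q∣Ke)
            where
            d = K * suc e
            ℓ≤n = ≮⇒≥ n≮ℓ
            q∣Ke : q ∣ K * suc e
            q∣Ke = %-cancel i d q (just-inj (trans (sym (residue i)) (trans
              (cong (λ u → find u trie) (agree⇒factorAt fixed i (i + d) ℓ (λ t t<ℓ → ag t (<-≤-trans t<ℓ ℓ≤n))))
                  (residue (i + d)))))
              where
              just-inj : ∀ {x y : ℕ} → just x ≡ just y → x ≡ y
              just-inj refl = refl
            lift : q ∣ suc e → D * n + C < K * suc e
            lift (divides (suc e') eq) = conclude (ih m'<n a (suc e') (s≤s z≤n) (s≤s z≤n) ag')
              where
              a = i / q
              b = (i + (n ∸ 1)) / q
              m' = suc (b ∸ a)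
              last≡ : i + (n ∸ 1) ≡ (i + (n ∸ 1)) % q + b * q
              last≡ = m≡m%n+[m/n]*n (i + (n ∸ 1)) q
              a≤b : a ≤ b
              a≤b = /-monoˡ-≤ q (m≤m+n i (n ∸ 1))
              d≡ : K * suc e ≡ (K * suc e') * q
              d≡ = trans (cong (K *_) eq) (sym (*-assoc K (suc e') q))
              bq≤ : b * q ≤ i + (n ∸ 1)
              bq≤ = ≤-trans (m≤n+m _ _) (≤-reflexive (sym last≡))
              aq≤i : a * q ≤ i
              aq≤i = m/n*n≤m i q
              i<aq+q : i < q + a * q
              i<aq+q = m<n+m/n*n
                where
                m<n+m/n*n : i < q + i / q * q
                m<n+m/n*n = ≤-trans (≤-reflexive (cong suc (m≡m%n+[m/n]*n i q)))
                    (+-monoˡ-≤ (i / q * q) (m%n<n i q))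
              split : b * q ≡ a * q + (b ∸ a) * q
              split = trans (cong (_* q) (sym (m+[n∸m]≡n a≤b))) (*-distribʳ-+ q a (b ∸ a))
              -- the blocks a … b meet the run, and the two ends may stick out by less than q each
              span< : (b ∸ a) * q < q + (n ∸ 1)
              span< = +-cancelˡ-< (a * q) _ _ (≤-<-trans (≤-reflexive (sym split)) (≤-<-trans bq≤
                (<-≤-trans (+-monoˡ-< (n ∸ 1) i<aq+q)
                    (≤-reflexive (trans (cong (_+ (n ∸ 1)) (+-comm q (a * q))) (+-assoc (a * q) q (n ∸ 1)))))))
              n≤m'q : n ≤ m' * q
              n≤m'q = +-cancelˡ-≤ (a * q) _ _ (≤-trans (+-monoˡ-≤ n aq≤i) (≤-trans (≤-reflexive i+n≡)
                (≤-trans (≤-reflexive (cong suc last≡))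
                    (≤-trans (+-monoˡ-≤ (b * q) (m%n<n (i + (n ∸ 1)) q))
                    (≤-reflexive (trans (cong (q +_) split) (shuffle q (a * q) ((b ∸ a) * q))))))))
                where
                i+n≡ : i + n ≡ suc (i + (n ∸ 1))
                i+n≡ = trans (cong (i +_) (sym (m+[n∸m]≡n 1≤n))) (+-suc i (n ∸ 1))
                shuffle : ∀ x y z → x + (y + z) ≡ y + (x + z)
                shuffle x y z = trans (sym (+-assoc x y z)) (trans (cong (_+ z) (+-comm x y)) (+-assoc y x z))
              -- Otherwise `b ∸ a` is at least `n ∸ 1`, and `q ≥ 2` with `n ∸ 1 ≥ 2`, the latter
              -- from `3 ≤ ℓ`, contradicts `span<`.
              m'<n : m' < n
              m'<n = ≰⇒> λ n≤m' → <⇒≱ span< (big (≤-pred (≤-trans (≤-reflexive (m+[n∸m]≡n 1≤n)) n≤m')))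
                where
                2≤n-1 : 2 ≤ n ∸ 1
                2≤n-1 = ∸-monoˡ-≤ 1 (≤-trans 3≤ℓ ℓ≤n)
                big : n ∸ 1 ≤ b ∸ a → q + (n ∸ 1) ≤ (b ∸ a) * q
                big h = ≤-trans (two-products 1<q 2≤n-1) (*-monoˡ-≤ q h)
                  where
                  two-products : ∀ {x y} → 2 ≤ x → 2 ≤ y → x + y ≤ y * x
                  two-products {suc (suc x)} {suc (suc y)} (s≤s (s≤s z≤n)) (s≤s (s≤s z≤n)) =
                    ≤-trans (m≤m+n _ (x + y + x * y)) (≤-reflexive (+-*-Solver.solve 2 (λ x y →
                      (con 2 :+ x) :+ (con 2 :+ y) :+ (x :+ y :+ x :* y) := (con 2 :+ y) :* (con 2 :+ x)) refl x
                          y))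
                    where open +-*-Solver
              -- Columns are injective, so a single letter of a block determines its preimage;
              -- blocks only touched by the run count in full.
              letters : ∀ p → i ≤ p → p < i + n → fixed (p / q) ≡ fixed (p / q + K * suc e')
              letters p i≤p p<i+n = separated-sound (λ c → nth zero (σ c) (p % q))
                  (below-sound q _ columns (m%n<n p q)) _ _
                (trans (sym (fixed-expand p)) (trans (subst (λ k → fixed k ≡ fixed (k + d)) (m+[n∸m]≡n i≤p)
                    (trans (ag (p ∸ i) (+-cancelˡ-< i _ _ (≤-<-trans (≤-reflexive (m+[n∸m]≡n i≤p)) p<i+n)))
                       (cong fixed (trans (+-assoc i d (p ∸ i))
                           (trans (cong (i +_) (+-comm d (p ∸ i))) (sym (+-assoc i (p ∸ i) d)))))))
                  (trans (cong (λ k → fixed (p + k)) d≡) (trans (fixed-expand (p + (K * suc e') * q))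
                    (cong₂ (λ k s → nth zero (σ (fixed k)) s) (/-shift p q (K * suc e'))
                        ([m+kn]%n≡m%n p (K * suc e') q))))))
              ag' : Agree fixed a (a + K * suc e') m'
              -- The first block is tested at `i` itself, since it may begin before the run; all
              -- later ones are tested at their first letter.
              ag' zero _ = subst₂ (λ x y → fixed x ≡ fixed y) (sym (+-identityʳ a))
                  (sym (+-identityʳ (a + K * suc e'))) (letters i ≤-refl (m<m+n i 1≤n))
              ag' (suc t) (s≤s t<) = subst (λ k → fixed k ≡ fixed (a + K * suc e' + suc t))
                  (m*n/n≡m (a + suc t) q)
                (trans (letters p i≤p p<i+n) (cong fixed
                    (trans (cong (_+ K * suc e') (m*n/n≡m (a + suc t) q))
                    (trans (+-assoc a (suc t) _)
                    (trans (cong (a +_) (+-comm (suc t) _)) (sym (+-assoc a _ (suc t))))))))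
                where
                p = (a + suc t) * q
                i≤p : i ≤ p
                i≤p = <⇒≤ (<-≤-trans i<aq+q (≤-trans (≤-reflexive (+-comm q (a * q)))
                    (≤-trans (+-monoʳ-≤ (a * q) (m≤m+n q (t * q)))
                    (≤-reflexive (sym (*-distribʳ-+ q a (suc t)))))))
                p<i+n : p < i + n
                p<i+n = ≤-<-trans (≤-trans (*-monoˡ-≤ q
                    (≤-trans (+-monoʳ-≤ a t<) (≤-reflexive (m+[n∸m]≡n a≤b)))) bq≤)
                  (+-monoʳ-< i (≤-reflexive (m+[n∸m]≡n 1≤n)))
              conclude : D * m' + C < K * suc e' → D * n + C < K * suc e
              conclude h = ≤-<-trans (+-mono-≤ (*-monoʳ-≤ D n≤m'q) (m≤m*n C q))
                (<-≤-trans (≤-<-trans (≤-reflexive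
                    (trans (cong (_+ C * q) (sym (*-assoc D m' q))) (sym (*-distribʳ-+ q (D * m') C))))
                    (*-monoˡ-< q h))
                  (≤-reflexive (sym d≡)))

-- Recurrence distances in words coded by labelled blocks

module BlockCodes where

  open Words
  open Substitutive
  open import Data.Bool using (Bool; true; false; _∧_; not; if_then_else_)
  open import Data.Bool.ListAction using (all)
  open import Data.Fin using (zero; suc)
  open import Data.List using (List; []; _∷_; _++_; length; reverse; concatMap; take; drop; foldr; upTo)
  open import Data.List.Properties
  open import Data.List.Membership.Propositional using (_∈_)
  open import Data.Maybe using (Maybe; just; nothing)
  open import Data.Nat as ℕ using (ℕ; zero; suc; z≤n; s≤s; _+_; _*_; _∸_; _≤_; _<_; _<ᵇ_; _≡ᵇ_; _/_; _%_;
      NonZero)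
  open import Data.Nat.Properties
  open import Data.Nat.DivMod
  open import Data.Nat.Divisibility using (divides)
  open import Data.Product using (∃-syntax; _×_; _,_; proj₁; proj₂)
  open import Data.Sum using (_⊎_; inj₁; inj₂)
  open import Data.Empty using (⊥)
  open import Relation.Nullary using (yes; no; contradiction)
  open import Relation.Binary.PropositionalEquality

  isPrefix : List Letter → List Letter → Bool
  isPrefix [] v = true
  isPrefix (a ∷ p) [] = false
  isPrefix (a ∷ p) (b ∷ v) = if a == b then isPrefix p v else false

  isPrefix-complete : ∀ p v → take (length p) v ≡ p → isPrefix p v ≡ true
  isPrefix-complete [] v _ = refl
  isPrefix-complete (a ∷ p) (b ∷ v) e with ∷-injectiveˡ e
  ... | refl rewrite ==-refl a = isPrefix-complete p v (∷-injectiveʳ e)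

  scan : ℕ → List Letter → List Letter → List Letter → Bool
  scan zero p p' v = true
  scan (suc k) p p' v = not (isPrefix p v) ∧ (not (isPrefix p' v) ∧ scan k p p' (drop 1 v))

  not-true : ∀ {b} → not b ≡ true → b ≡ false
  not-true {false} _ = refl

  scan-sound : ∀ k p p' v → scan k p p' v ≡ true → ∀ {j} → j < k →
               isPrefix p (drop j v) ≡ false × isPrefix p' (drop j v) ≡ false
  scan-sound (suc k) p p' v e {j} j<k with ∧-true {not (isPrefix p v)} e
  ... | e₁ , e₂₃ with ∧-true {not (isPrefix p' v)} e₂₃
  scan-sound (suc k) p p' v e {zero} j<k | e₁ , e₂₃ | e₂ , e₃ = not-true {isPrefix p v} e₁ , not-true
      {isPrefix p' v} e₂
  scan-sound (suc k) p p' v e {suc j} (s≤s j<k) | e₁ , e₂₃ | e₂ , e₃ =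
    subst (λ x → isPrefix p x ≡ false × isPrefix p' x ≡ false) (drop-drop 1 j v)
        (scan-sound k p p' (drop 1 v) e₃ j<k)

  module Labelled (y : InfWord Letter) (K r : ℕ) .{{_ : NonZero K}} .{{_ : NonZero r}}
    (block : ℕ × Letter → List Letter) (length-block : ∀ a → length (block a) ≡ r) where

    labelled : InfWord (ℕ × Letter)
    labelled n = n % K , y n

    open Expansion r labelled block zero length-block public using () renaming
        (expanded to word; window to window-word)

    label : ℕ → List Letter → List (ℕ × Letter)
    label c [] = []
    label c (a ∷ φ) = (c % K , a) ∷ label (suc c) φ

    label-% : ∀ {c c'} φ → c % K ≡ c' % K → label c φ ≡ label c' φ
    label-% [] e = refl
    label-% {c} {c'} (a ∷ φ) e = cong₂ _∷_ (cong (_, a) e)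
      (label-% φ (trans (%-distribˡ-+ 1 c K) (trans (cong (λ x → (1 % K + x) % K) e)
          (sym (%-distribˡ-+ 1 c' K)))))

    factorAt-labelled : ∀ n m → factorAt labelled n m ≡ label n (factorAt y n m)
    factorAt-labelled n zero = refl
    factorAt-labelled n (suc m) = cong ((n % K , y n) ∷_) (factorAt-labelled (suc n) m)

    forText : (ℕ → List Letter → ℕ → List Letter → Bool) → ℕ → List Letter → List Letter → Bool
    forText P c φ u = below r (λ s → P c φ s (drop s u))

    forWindows : List (List Letter) → (ℕ → List Letter → ℕ → List Letter → Bool) → Bool
    forWindows facs P = below K (λ c → all (λ φ → forText P c φ (concatMap block (label c φ))) facs)

    forTail : {Z : Set} → (List Z → Bool) → List Z → Bool
    forTail P v = below r (λ s → P (drop s v))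

    forTails : {Z : Set} → (List Letter → List Z) → List (List Letter) → (List Z → Bool) → Bool
    forTails tr facs P = below K (λ c → all (λ φ → forTail P (tr (concatMap block (label c φ)))) facs)

    head : List Letter → Letter
    head (a ∷ _) = a
    head [] = zero

    addText : ℕ → ℕ → Letter → List Letter → Trie (ℕ × Letter) → Trie (ℕ × Letter)
    addText ℓ c a u t = foldr (λ s → insert (take ℓ (drop s u)) (c * r + s , a)) t (upTo r)

    locationTrie : ℕ → List (List Letter) → Trie (ℕ × Letter)
    locationTrie ℓ facs = foldr (λ c t → foldr (λ φ → addText ℓ c (head φ) (concatMap block (label c φ))) t
        facs) nil (upTo K)

    -- As `tr` commutes with `drop`, it is applied once to a whole text and then cut at every
    -- offset, which keeps the evaluation feasible.
    module Tails (m : ℕ) (facs : List (List Letter)) (factor∈ : ∀ n → factorAt y n m ∈ facs)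
      {Z : Set} (tr : List Letter → List Z) (drop-tr : ∀ s u → drop s (tr u) ≡ tr (drop s u)) where

      record Holds (P : List Z → Bool) : Set where
        field
          tails-ok : forTails tr facs P ≡ true

      forTails-sound : ∀ P → Holds P → ∀ i → P (tr (factorAt word i (m * r ∸ i % r))) ≡ true
      forTails-sound P record { tails-ok = e } i = subst (λ v → P v ≡ true)
        (trans (drop-tr (i % r) (concatMap block (label (i / r % K) (factorAt y (i / r) m))))
          (cong tr (trans (cong (λ b → drop (i % r) (concatMap block b))
            (trans (label-% (factorAt y (i / r) m) (m%n%n≡m%n (i / r) K)) (sym (factorAt-labelled (i / r) m))))
          (sym (window-word i m)))))
        (below-sound r _ (all-sound _ facs (below-sound K _ e (m%n<n (i / r) K)) (factor∈ (i / r))) (m%n<n i r))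

    module Checked (facs : List (List Letter)) (factor∈ : ∀ n → factorAt y n 3 ∈ facs) where

      L : ℕ → ℕ
      L i = 3 * r ∸ i % r

      2r≤L : ∀ i → 2 * r ≤ L i
      2r≤L i = ≤-trans (≤-reflexive (sym (m+n∸m≡n r (2 * r)))) (∸-monoʳ-≤ (3 * r) (<⇒≤ (m%n<n i r)))

      forWindows-sound : ∀ P → forWindows facs P ≡ true →
                         ∀ i → P (i / r % K) (factorAt y (i / r) 3) (i % r) (factorAt word i (L i)) ≡ true
      forWindows-sound P e i = subst (λ u → P (i / r % K) (factorAt y (i / r) 3) (i % r) u ≡ true)
        (trans (cong (λ b → drop (i % r) (concatMap block b))
            (trans (label-% (factorAt y (i / r) 3) (m%n%n≡m%n (i / r) K)) (sym (factorAt-labelled (i / r) 3))))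
          (sym (window-word i 3)))
        (below-sound r _ (all-sound _ facs (below-sound K _ e (m%n<n (i / r) K)) (factor∈ (i / r))) (m%n<n i r))

      -- A factor of length `ℓ` must always reveal its offset and the label of its block, and the
      -- base letter only from offsets up to `S`. The `N` offsets behind `S` are exempt because the
      -- two candidate blocks may read the same from there on.
      module Far (D C ℓ n₀ S N : ℕ) (S+N : suc (S + N) ≡ r)
        (1≤D : 1 ≤ D) (D≤C : D * (N + ℓ) ≤ suc C * r) (D≤K : D * (N + ℓ) ≤ K * r) (room : D * ℓ + ℓ ≤ 2 * r)
        (run : ∀ n i e → 1 ≤ n → 1 ≤ e → Agree y i (i + K * e) n → D * n + C < K * e)
        (trie : Trie (ℕ × Letter)) where

        located : Maybe (ℕ × Letter) → ℕ → List Letter → ℕ → Bool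
        located (just (n , a)) c (b ∷ _) s = (n ≡ᵇ c * r + s) ∧ (if S <ᵇ s then true else (a == b))
        located _ c φ s = false

        isNothing : Maybe (ℕ × Letter) → Bool
        isNothing nothing = true
        isNothing (just _) = false

        isNothing-sound : ∀ x → isNothing x ≡ true → x ≡ nothing
        isNothing-sound nothing _ = refl

        located-sound : ∀ x c b φ s → located x c (b ∷ φ) s ≡ true →
                        ∃[ a ] x ≡ just (c * r + s , a) × (s ≤ S → a ≡ b)
        located-sound (just (n , a)) c b φ s e =
          a , cong (λ n → just (n , a)) (≡ᵇ-true⇒≡ n _ (proj₁ (∧-true {n ≡ᵇ c * r + s} e))) , informative
          where
          informative : s ≤ S → a ≡ b
          informative s≤S with S <ᵇ s in lt | proj₂ (∧-true {n ≡ᵇ c * r + s} e)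
          ... | true  | _  = contradiction (<ᵇ-true⇒< S s lt) (≤⇒≯ s≤S)
          ... | false | e' = ==-sound a b e'

        locates : ℕ → List Letter → ℕ → List Letter → Bool
        locates c φ s u = located (find (take ℓ u) trie) c φ s ∧ isNothing (find (reverse (take ℓ u)) trie)

        scanFor : ℕ → List Letter → List Letter → Bool
        scanFor n u p = scan (suc (D * n ∸ n)) p (reverse p) (drop n u)

        spread : List Letter → Bool
        spread u = below (ℓ ∸ n₀) (λ k → scanFor (n₀ + k) u (take (n₀ + k) u))

        locatesAll spreadAll : Bool
        locatesAll = forWindows facs locates
        spreadAll = forWindows facs (λ _ _ _ → spread)

        -- A record, since comparing two such equations would evaluate the checks again.
        record Checks : Set where
          field
            located-ok : locatesAll ≡ true
            spread-ok  : spreadAll ≡ true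

        module _ (checks : Checks) where

          open Checks checks

          ℓ≤L : ∀ i → ℓ ≤ L i
          ℓ≤L i = ≤-trans (m≤n+m ℓ (D * ℓ)) (≤-trans room (2r≤L i))

          locates-at : ∀ i → locates (i / r % K) (factorAt y (i / r) 3) (i % r) (factorAt word i (L i)) ≡ true
          locates-at = forWindows-sound locates located-ok

          -- Since `location` finds all factors of length `ℓ` in the trie, a word missing from it is
          -- not a factor; long factors therefore never recur reversed.
          no-reverse : ∀ i → find (reverse (factorAt word i ℓ)) trie ≡ nothing
          no-reverse i = trans (cong (λ u → find (reverse u) trie) (sym (take-factorAt word i (ℓ≤L i))))
            (isNothing-sound _ (proj₂ (∧-true (locates-at i))))

          location : ∀ i → ∃[ a ] find (factorAt word i ℓ) trie ≡ just (i / r % K * r + i % r , a) ×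
              (i % r ≤ S → a ≡ y (i / r))
          location i with located-sound (find (take ℓ (factorAt word i (L i))) trie) (i / r % K) (y (i / r))
              (factorAt y (suc (i / r)) 2) (i % r) (proj₁ (∧-true (locates-at i)))
          ... | a , e , h = a , trans (cong (λ u → find u trie) (sym (take-factorAt word i (ℓ≤L i)))) e , h

          same-location : ∀ i j → Agree word i j ℓ →
            i % r ≡ j % r × i / r % K ≡ j / r % K × (i % r ≤ S → y (i / r) ≡ y (j / r))
          same-location i j ag with location i | location j
          ... | a , fi , ai | b , fj , bj with trans (sym fi)
              (trans (cong (λ u → find u trie) (agree⇒factorAt word i j ℓ ag)) fj)
          ...   | eq = s≡ , c≡ , λ s≤S → trans (sym (ai s≤S))
              (trans (label≡ eq) (bj (≤-trans (≤-reflexive (sym s≡)) s≤S)))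
            where
            place≡ : ∀ {m n : ℕ} {a b : Letter} → just (m , a) ≡ just (n , b) → m ≡ n
            place≡ refl = refl
            label≡ : ∀ {m n : ℕ} {a b : Letter} → just (m , a) ≡ just (n , b) → a ≡ b
            label≡ refl = refl
            mod : ∀ c i → (c * r + i % r) % r ≡ i % r
            mod c i = trans (cong (_% r) (+-comm (c * r) (i % r)))
                (trans ([m+kn]%n≡m%n (i % r) c r) (m%n%n≡m%n i r))
            div : ∀ c i → (c * r + i % r) / r ≡ c
            div c i = trans (+-distrib-/-∣ˡ (i % r) (divides c refl))
                (trans (cong₂ _+_ (m*n/n≡m c r) (m<n⇒m/n≡0 (m%n<n i r))) (+-identityʳ c))
            s≡ : i % r ≡ j % r
            s≡ = trans (sym (mod (i / r % K) i)) (trans (cong (_% r) (place≡ eq)) (mod (j / r % K) j))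
            c≡ : i / r % K ≡ j / r % K
            c≡ = trans (sym (div (i / r % K) i)) (trans (cong (_/ r) (place≡ eq)) (div (j / r % K) j))

          -- Equal offsets and labels make `d` a multiple of `K r`, and the agreement descends to
          -- the base word, where `run` applies. If `m` base letters are recovered,
          -- `n < m r + (N + ℓ)`; the loss `N + ℓ` at the two ends is absorbed by the slack `C` of
          -- `run` through `D≤C`.
          far-long : ∀ i d n → ℓ ≤ n → 1 ≤ d → Agree word i (i + d) n → D * n < d
          far-long i d n ℓ≤n 1≤d ag with same-location i (i + d) (λ t t<ℓ → ag t (<-≤-trans t<ℓ ℓ≤n))
          ... | s≡ , c≡ , _ with %-cancel i d r s≡
          ...   | divides d' refl with %-cancel (i / r) d' K (trans c≡ (cong (_% K) (/-shift i r d')))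
          ...     | divides zero refl = contradiction 1≤d λ ()
          ...     | divides (suc e) refl with ((i + N) / r) ≤? ((i + (n ∸ ℓ)) / r)
          -- No base letter is recovered, but then `n < N + ℓ`, and `K r ≤ d` already suffices.
          ...       | no a≰b = <-≤-trans (<-≤-trans (*-monoʳ-< D {{ℕ.>-nonZero 1≤D}} n<) D≤K)
                        (≤-trans (*-monoˡ-≤ r (m≤n*m K (suc e))) ≤-refl)
            where
            n< : n < N + ℓ
            n< = +-cancelˡ-< i _ _ (begin-strict
              i + n                            ≡⟨ cong (i +_) (sym (m∸n+n≡m ℓ≤n)) ⟩
              i + (n ∸ ℓ + ℓ)                  ≡⟨ sym (+-assoc i _ ℓ) ⟩
              i + (n ∸ ℓ) + ℓ                  <⟨ +-monoˡ-< ℓ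
                  (≤-trans (≤-reflexive (cong suc (m≡m%n+[m/n]*n (i + (n ∸ ℓ)) r)))
                  (+-monoˡ-≤ _ (m%n<n (i + (n ∸ ℓ)) r))) ⟩
              suc ((i + (n ∸ ℓ)) / r) * r + ℓ  ≤⟨ +-monoˡ-≤ ℓ (*-monoˡ-≤ r (≰⇒> a≰b)) ⟩
              (i + N) / r * r + ℓ              ≤⟨ +-monoˡ-≤ ℓ (m/n*n≤m (i + N) r) ⟩
              i + N + ℓ                        ≡⟨ +-assoc i N ℓ ⟩
              i + (N + ℓ)                      ∎)
              where open ≤-Reasoning
          ...       | yes a≤b = begin-strict
              D * n                          <⟨ *-monoʳ-< D {{ℕ.>-nonZero 1≤D}} n< ⟩
              D * (m * r + (N + ℓ))          ≡⟨ *-distribˡ-+ D (m * r) (N + ℓ) ⟩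
              D * (m * r) + D * (N + ℓ)      ≤⟨ +-monoʳ-≤ (D * (m * r)) D≤C ⟩
              D * (m * r) + suc C * r        ≡⟨ cong (_+ suc C * r) (sym (*-assoc D m r)) ⟩
              D * m * r + suc C * r          ≡⟨ sym (*-distribʳ-+ r (D * m) (suc C)) ⟩
              (D * m + suc C) * r            ≡⟨ cong (_* r) (+-suc (D * m) C) ⟩
              suc (D * m + C) * r            ≤⟨ *-monoˡ-≤ r (run m a (suc e) (s≤s z≤n) (s≤s z≤n) run-ag) ⟩
              K * suc e * r                  ≡⟨ cong (_* r) (*-comm K (suc e)) ⟩
              suc e * K * r                  ∎
            where
            open ≤-Reasoning
            -- Adding `N` moves to the next block exactly when the offset of `i` exceeds `S`. Block
            -- `b` contains the last position at which a factor of length `ℓ` still fits into the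
            -- agreement.
            a = (i + N) / r
            b = (i + (n ∸ ℓ)) / r
            m = suc (b ∸ a)
            n< : n < m * r + (N + ℓ)
            n< = +-cancelˡ-< i _ _ (begin-strict
              i + n                      ≡⟨ cong (i +_) (sym (m∸n+n≡m ℓ≤n)) ⟩
              i + (n ∸ ℓ + ℓ)            ≡⟨ sym (+-assoc i _ ℓ) ⟩
              i + (n ∸ ℓ) + ℓ            <⟨ +-monoˡ-< ℓ
                  (≤-trans (≤-reflexive (cong suc (m≡m%n+[m/n]*n (i + (n ∸ ℓ)) r)))
                  (+-monoˡ-≤ _ (m%n<n (i + (n ∸ ℓ)) r))) ⟩
              suc b * r + ℓ              ≡⟨ cong (λ k → suc k * r + ℓ) (sym (m+[n∸m]≡n a≤b)) ⟩
              suc (a + (b ∸ a)) * r + ℓ  ≡⟨ cong (λ k → k * r + ℓ) (sym (+-suc a (b ∸ a))) ⟩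
              (a + m) * r + ℓ            ≡⟨ cong (_+ ℓ) (*-distribʳ-+ r a m) ⟩
              a * r + m * r + ℓ          ≤⟨ +-monoˡ-≤ ℓ (+-monoˡ-≤ (m * r) (m/n*n≤m (i + N) r)) ⟩
              i + N + m * r + ℓ          ≡⟨ cong (_+ ℓ) (+-assoc i N (m * r)) ⟩
              i + (N + m * r) + ℓ        ≡⟨ +-assoc i _ ℓ ⟩
              i + (N + m * r + ℓ)        ≡⟨ cong (λ k → i + (k + ℓ)) (+-comm N (m * r)) ⟩
              i + (m * r + N + ℓ)        ≡⟨ cong (i +_) (+-assoc (m * r) N ℓ) ⟩
              i + (m * r + (N + ℓ))      ∎)
            letter : ∀ p → i ≤ p → p ≤ i + (n ∸ ℓ) → p % r ≤ S → y (p / r) ≡ y (p / r + suc e * K)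
            letter p i≤p p≤ s≤S = trans (proj₂ (proj₂ (same-location p (p + suc e * K * r) agp)) s≤S)
                (cong y (/-shift p r (suc e * K)))
              where
              t₀ = p ∸ i
              i+t₀ : i + t₀ ≡ p
              i+t₀ = m+[n∸m]≡n i≤p
              δ = suc e * K * r
              agp : Agree word p (p + suc e * K * r) ℓ
              agp t t<ℓ = subst₂ (λ x z → word x ≡ word z)
                (trans (sym (+-assoc i t₀ t)) (cong (_+ t) i+t₀))
                (trans (+-assoc i δ (t₀ + t))
                    (trans (cong (i +_) (trans (+-comm δ (t₀ + t))
                    (trans (+-assoc t₀ t δ) (cong (t₀ +_) (+-comm t δ)))))
                  (trans (sym (+-assoc i t₀ (δ + t))) (trans (cong (_+ (δ + t)) i+t₀) (sym (+-assoc p δ t))))))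
                (ag (t₀ + t) (≤-trans (+-monoʳ-< t₀ t<ℓ)
                    (≤-trans (+-monoˡ-≤ ℓ (+-cancelˡ-≤ i _ _ (≤-trans (≤-reflexive i+t₀) p≤)))
                    (≤-reflexive (m∸n+n≡m ℓ≤n)))))
            at-block : ∀ k → a ≤ k → k ≤ b → y k ≡ y (k + suc e * K)
            at-block k a≤k k≤b with i ≤? k * r
            ... | yes i≤kr = subst (λ x → y x ≡ y (x + suc e * K)) (m*n/n≡m k r)
                  (letter (k * r) i≤kr (≤-trans (*-monoˡ-≤ r k≤b) (m/n*n≤m (i + (n ∸ ℓ)) r))
                      (≤-trans (≤-reflexive (m*n%n≡0 k r)) z≤n))
            ... | no i≰kr = subst (λ x → y x ≡ y (x + suc e * K)) (sym k≡) (letter i ≤-refl (m≤m+n i _) s≤S)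
              where
              k≤ : k ≤ i / r
              k≤ = ≤-trans (≤-reflexive (sym (m*n/n≡m k r))) (/-monoˡ-≤ r (<⇒≤ (≰⇒> i≰kr)))
              a≥ : i / r ≤ a
              a≥ = /-monoˡ-≤ r (m≤m+n i N)
              k≡ : k ≡ i / r
              k≡ = ≤-antisym k≤ (≤-trans a≥ a≤k)
              s≤S : i % r ≤ S
              s≤S = +-cancelʳ-≤ N _ _ (≤-pred (≤-trans (≤-trans (s≤s ≤-refl) s+N<r) (≤-reflexive (sym S+N))))
                where
                s+N<r : i % r + N < r
                s+N<r = +-cancelʳ-< (i / r * r) _ _ (begin-strict
                  i % r + N + i / r * r    ≡⟨ +-assoc (i % r) N _ ⟩
                  i % r + (N + i / r * r)  ≡⟨ cong (i % r +_) (+-comm N _) ⟩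
                  i % r + (i / r * r + N)  ≡⟨ sym (+-assoc (i % r) _ N) ⟩
                  i % r + i / r * r + N    ≡⟨ cong (_+ N) (sym (m≡m%n+[m/n]*n i r)) ⟩
                  i + N                    ≡⟨ m≡m%n+[m/n]*n (i + N) r ⟩
                  (i + N) % r + a * r      <⟨ +-monoˡ-< (a * r) (m%n<n (i + N) r) ⟩
                  r + a * r                ≤⟨ +-monoʳ-≤ r (*-monoˡ-≤ r (≤-trans a≤k k≤)) ⟩
                  r + i / r * r            ∎)
            run-ag : Agree y a (a + K * suc e) m
            run-ag t t<m = trans (at-block (a + t) (m≤m+n a t)
                (≤-trans (+-monoʳ-≤ a (≤-pred t<m)) (≤-reflexive (m+[n∸m]≡n a≤b))))
              (cong y (trans (+-assoc a t _) (trans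
                  (cong (a +_) (trans (+-comm t _) (cong (_+ t) (*-comm (suc e) K)))) (sym (+-assoc a _ t)))))

          -- Below `ℓ` only the distances from `n` to `D n` have to be excluded, which explains the
          -- `D n ∸ n + 1` tests of `scanFor` behind the first `n` letters. From `ℓ` on, direct
          -- copies fall to `far-long` and reversed ones to `no-reverse`.
          far : ∀ i d n → n₀ ≤ n → 1 ≤ n → n ≤ d →
                factorAt word (i + d) n ≡ factorAt word i n ⊎ factorAt word (i + d) n ≡ reverse
                    (factorAt word i n) → D * n < d
          far i d n n₀≤n 1≤n n≤d e with ℓ ≤? n
          far i d n n₀≤n 1≤n n≤d (inj₁ e) | yes ℓ≤n = far-long i d n ℓ≤n (≤-trans 1≤n n≤d)
              (factorAt⇒agree word i (i + d) n (sym e))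
          far i d n n₀≤n 1≤n n≤d (inj₂ e) | yes ℓ≤n = contradiction
              (trans (sym (proj₁ (proj₂ (location j)))) found) λ ()
            where
            j = i + d + (n ∸ ℓ)
            -- the last ℓ letters of the reversed factor are the reverse of the first ℓ letters
            tail≡ : factorAt word j ℓ ≡ reverse (factorAt word i ℓ)
            tail≡ = ++-cancelˡ-length (factorAt word (i + d) (n ∸ ℓ)) (reverse (factorAt word (i + ℓ) (n ∸ ℓ)))
              (trans (length-factorAt word (i + d) (n ∸ ℓ))
                  (sym (trans (length-reverse (factorAt word (i + ℓ) (n ∸ ℓ)))
                  (length-factorAt word (i + ℓ) (n ∸ ℓ)))))
              (trans (sym (factorAt-+ word (i + d) (n ∸ ℓ) ℓ))
                  (trans (cong (factorAt word (i + d)) (m∸n+n≡m ℓ≤n)) (trans e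
                (trans (cong reverse (trans (cong (factorAt word i) (sym (m+[n∸m]≡n ℓ≤n)))
                    (factorAt-+ word i ℓ (n ∸ ℓ))))
                  (reverse-++ (factorAt word i ℓ) (factorAt word (i + ℓ) (n ∸ ℓ)))))))
              where
              ++-cancelˡ-length : ∀ (a b : List Letter) {u v} → length a ≡ length b → a ++ u ≡ b ++ v → u ≡ v
              ++-cancelˡ-length [] [] _ h = h
              ++-cancelˡ-length (_ ∷ a) (_ ∷ b) l h = ++-cancelˡ-length a b (suc-injective l) (∷-injectiveʳ h)
            found : find (factorAt word j ℓ) trie ≡ nothing
            found = trans (cong (λ u → find u trie) tail≡) (no-reverse i)
          far i d n n₀≤n 1≤n n≤d e | no ℓ≰n = ≰⇒> λ d≤Dn → case-near d≤Dn e
            where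
            n<ℓ = ≰⇒> ℓ≰n
            n≤L : ∀ j → n ≤ L j
            n≤L j = ≤-trans (<⇒≤ n<ℓ) (ℓ≤L j)
            k = n ∸ n₀
            n≡ : n₀ + k ≡ n
            n≡ = m+[n∸m]≡n n₀≤n
            clear : ∀ {j} → j < suc (D * n ∸ n) →
              isPrefix (factorAt word i n) (drop j (drop n (factorAt word i (L i)))) ≡ false ×
              isPrefix (reverse (factorAt word i n)) (drop j (drop n (factorAt word i (L i)))) ≡ false
            clear = subst (λ p → ∀ {j} → j < suc (D * n ∸ n) → isPrefix p
                (drop j (drop n (factorAt word i (L i)))) ≡ false ×
                        isPrefix (reverse p) (drop j (drop n (factorAt word i (L i)))) ≡ false)
              (take-factorAt word i (n≤L i))
              (scan-sound (suc (D * n ∸ n)) (take n (factorAt word i (L i)))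
                  (reverse (take n (factorAt word i (L i)))) (drop n (factorAt word i (L i)))
                  (subst (λ n → scan (suc (D * n ∸ n)) (take n (factorAt word i (L i)))
                  (reverse (take n (factorAt word i (L i)))) (drop n (factorAt word i (L i))) ≡ true) n≡
                (below-sound (ℓ ∸ n₀) _ (forWindows-sound (λ _ _ _ → spread) spread-ok i)
                    (∸-monoˡ-< n<ℓ n₀≤n))))
            case-near : d ≤ D * n → factorAt word (i + d) n ≡ factorAt word i n ⊎ factorAt word (i + d) n ≡
                reverse (factorAt word i n) → ⊥
            case-near d≤Dn e with clear {d ∸ n} (s≤s (∸-monoˡ-≤ n d≤Dn))
            ... | c₁ , c₂ = hit e
              where
              rest≡ : drop (d ∸ n) (drop n (factorAt word i (L i))) ≡ factorAt word (i + d) (L i ∸ d)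
              rest≡ = trans (drop-drop n (d ∸ n) (factorAt word i (L i)))
                  (trans (cong (λ x → drop x (factorAt word i (L i))) (m+[n∸m]≡n n≤d))
                  (drop-factorAt word i d (L i)))
              n≤rest : n ≤ L i ∸ d
              n≤rest = ≤-trans (≤-reflexive (sym (m+n∸m≡n d n))) (∸-monoˡ-≤ d
                (≤-trans (+-mono-≤ (≤-trans d≤Dn (*-monoʳ-≤ D (<⇒≤ n<ℓ))) (<⇒≤ n<ℓ)) (≤-trans room (2r≤L i))))
              prefixed : ∀ p → length p ≡ n → factorAt word (i + d) n ≡ p → isPrefix p
                  (drop (d ∸ n) (drop n (factorAt word i (L i)))) ≡ true
              prefixed p lp h = isPrefix-complete p _
                  (trans (cong₂ take lp rest≡) (trans (take-factorAt word (i + d) n≤rest) h))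
              hit : factorAt word (i + d) n ≡ factorAt word i n ⊎ factorAt word (i + d) n ≡ reverse
                  (factorAt word i n) → ⊥
              hit (inj₁ h) = contradiction (trans (sym c₁) (prefixed _ (length-factorAt word i n) h)) λ ()
              hit (inj₂ h) = contradiction (trans (sym c₂)
                  (prefixed _ (trans (length-reverse (factorAt word i n)) (length-factorAt word i n)) h)) λ ()

-- A backtracking parser for occurrences with short images

module Chords where

  open Words
  open BlockCodes using (isPrefix; isPrefix-complete)
  open Potential using (imgLetter-orient; length-orient; occ-≡; occ-≢)
  open Greedy using (NonEmpty-orient; img-++)
  open import Data.Bool using (Bool; true; false; _∧_; _∨_; if_then_else_)
  open import Data.Bool.Properties using (∨-zeroʳ)
  open import Data.Empty using (⊥-elim)
  open import Data.Fin using (zero; suc)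
  open import Data.List using (List; []; _∷_; _++_; length; reverse; take; drop; _ʳ++_)
  open import Data.List.Properties
  open import Data.List.Membership.Propositional using (_∈_)
  open import Data.List.Membership.Propositional.Properties using (∈-++⁺ˡ)
  open import Data.List.Relation.Unary.All as All using (All; []; _∷_)
  open import Data.List.Relation.Unary.Any using (here; there)
  open import Data.List.Relation.Binary.Pointwise as PW using (Pointwise; []; _∷_)
  open import Data.Nat as ℕ using (ℕ; zero; suc; z≤n; s≤s; _*_; _≤_; _<_)
  open import Data.Nat.Properties
  open import Data.Product using (∃-syntax; _×_; _,_; proj₂)
  open import Data.Sum using (_⊎_; inj₁; inj₂)
  open import Data.Unit using (tt)
  open import Function using (_∘_)
  open import Relation.Nullary using (yes; no)
  open import Relation.Binary.PropositionalEquality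

  Word : Set
  Word = List Letter

  take-++ : ∀ (u v : Word) → take (length u) (u ++ v) ≡ u
  take-++ [] v = refl
  take-++ (x ∷ u) v = cong (x ∷_) (take-++ u v)

  drop-++ : ∀ (u v : Word) → drop (length u) (u ++ v) ≡ v
  drop-++ [] v = refl
  drop-++ (x ∷ u) v = drop-++ u v

  recurs : ℕ → Word → Word → Word → Bool
  recurs zero p p' w = false
  recurs (suc k) p p' w = isPrefix p w ∨ (isPrefix p' w ∨ recurs k p p' (drop 1 w))

  recurs-sound : ∀ k p a v b → length a < k → v ≡ p ⊎ v ≡ reverse p → recurs k p (reverse p) (a ++ (v ++ b)) ≡
      true
  recurs-sound (suc k) p [] v b _ (inj₁ refl) rewrite isPrefix-complete p (p ++ b) (take-++ p b) = refl
  recurs-sound (suc k) p [] v b _ (inj₂ refl)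
    rewrite isPrefix-complete (reverse p) (reverse p ++ b) (take-++ (reverse p) b) = ∨-zeroʳ _
  recurs-sound (suc k) p (x ∷ a) v b (s≤s a<k) h rewrite recurs-sound k p a v b a<k h
    | ∨-zeroʳ (isPrefix (reverse p) (x ∷ a ++ (v ++ b))) = ∨-zeroʳ _

  maxLen : ℕ
  maxLen = 5

  -- The window 50 is ten pattern letters times `maxLen`, enough to reach the second copy of every
  -- variable.
  recursAt : ℕ → Word → Bool
  recursAt n u = recurs 50 (take n u) (reverse (take n u)) (drop n u)

  longestFrom : ℕ → Word → ℕ
  longestFrom zero u = 0
  longestFrom (suc n) u = if recursAt (suc n) u then suc n else longestFrom n u

  longestFrom-sound : ∀ m {n} u → n ≤ m → recursAt n u ≡ true → n ≤ longestFrom m u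
  longestFrom-sound zero u z≤n _ = z≤n
  longestFrom-sound (suc m) {n} u n≤ e with n ≟ suc m
  ... | yes refl rewrite e = ≤-refl
  ... | no n≢ with recursAt (suc m) u
  ...   | true = n≤
  ...   | false = longestFrom-sound m u (≤-pred (≤∧≢⇒< n≤ n≢)) e

  Annotated : Set
  Annotated = List (Letter × ℕ)

  -- Each letter carries the largest length ≤ maxLen of a factor starting there that recurs soon, possibly
  -- reversed; no longer segment needs to be tried.
  annotate : Word → Annotated
  annotate [] = []
  annotate (x ∷ u) = (x , longestFrom maxLen (x ∷ u)) ∷ annotate u

  drop-annotate : ∀ s u → drop s (annotate u) ≡ annotate (drop s u)
  drop-annotate zero u = refl
  drop-annotate (suc s) [] = refl
  drop-annotate (suc s) (x ∷ u) = drop-annotate s u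

  stripThen : Word → (Annotated → Bool) → Annotated → Bool
  stripThen [] k w = k w
  stripThen (a ∷ s) k [] = false
  stripThen (a ∷ s) k ((b , _) ∷ w) = if a == b then stripThen s k w else false

  stripThen-++ : ∀ s k w → stripThen s k (annotate (s ++ w)) ≡ k (annotate w)
  stripThen-++ [] k w = refl
  stripThen-++ (a ∷ s) k w rewrite ==-refl a = stripThen-++ s k w

  -- The possible images of the other occurrence of a variable.
  Segment : Set
  Segment = List Word

  segment : Word → Segment
  segment s = if eqWord s (reverse s) then s ∷ [] else s ∷ reverse s ∷ []

  ∈-segment : ∀ s → s ∈ segment s × reverse s ∈ segment s
  ∈-segment s with eqWord s (reverse s) in eq
  ... | true  = here refl , here (sym (eqWord-sound s (reverse s) eq))
  ... | false = here refl , there (here refl)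

  tryEach : Segment → (Annotated → Bool) → Annotated → Bool
  tryEach [] k w = false
  tryEach (v ∷ vs) k w = stripThen v k w ∨ tryEach vs k w

  tryEach-sound : ∀ {v vs} k w → v ∈ vs → k (annotate w) ≡ true → tryEach vs k (annotate (v ++ w)) ≡ true
  tryEach-sound {v} k w (here refl) e rewrite stripThen-++ v k w | e = refl
  tryEach-sound k w (there i) e rewrite tryEach-sound k w i e = ∨-zeroʳ _

  -- The image accumulates in reverse, which is harmless because a `segment` is closed under
  -- reversal.
  extend : ℕ → (Word → Annotated → Bool) → Word → Annotated → Bool
  extend zero k s w = false
  extend (suc l) k s [] = false
  extend (suc l) k s ((x , _) ∷ w) = k (x ∷ s) w ∨ extend l k (x ∷ s) w

  extend-sound : ∀ l k s v w → NonEmpty v → length v ≤ l → k (v ʳ++ s) (annotate w) ≡ true →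
                 extend l k s (annotate (v ++ w)) ≡ true
  extend-sound (suc l) k s (x ∷ []) w _ _ e rewrite e = refl
  extend-sound (suc l) k s (x ∷ x' ∷ v) w _ (s≤s v≤l) e
    rewrite extend-sound l k (x ∷ s) (x' ∷ v) w tt v≤l e = ∨-zeroʳ _

  openThen : (Word → Annotated → Bool) → Annotated → Bool
  openThen k [] = false
  openThen k w@((_ , m) ∷ _) = extend m k [] w

  openThen-sound : ∀ k v w → NonEmpty v → length v ≤ maxLen → recursAt (length v) (v ++ w) ≡ true →
                   k (v ʳ++ []) (annotate w) ≡ true → openThen k (annotate (v ++ w)) ≡ true
  openThen-sound k v@(x ∷ v') w ne le rc e =
    extend-sound (longestFrom maxLen (v ++ w)) k [] v w tt (longestFrom-sound maxLen (v ++ w) le rc) e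

  -- The lists `pre` and `post` form a zipper around the segment being tried, so that closing it
  -- leaves all others open.
  closeAny : (List Segment → Annotated → Bool) → List Segment → List Segment → Annotated → Bool
  closeAny k pre [] w = false
  closeAny k pre (s ∷ post) w = tryEach s (k (pre ʳ++ post)) w ∨ closeAny k (s ∷ pre) post w

  closeAny-sound : ∀ k pre mid s post v w → v ∈ s → k (pre ʳ++ (mid ++ post)) (annotate w) ≡ true →
                   closeAny k pre (mid ++ s ∷ post) (annotate (v ++ w)) ≡ true
  closeAny-sound k pre [] s post v w i e rewrite tryEach-sound (k (pre ʳ++ post)) w i e = refl
  closeAny-sound k pre (s' ∷ mid) s post v w i e rewrite closeAny-sound k (s' ∷ pre) mid s post v w i e =
      ∨-zeroʳ _

  <⇒<ᵇ-true : ∀ {m n} → m < n → (m ℕ.<ᵇ n) ≡ true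
  <⇒<ᵇ-true {zero} (s≤s _) = refl
  <⇒<ᵇ-true {suc m} (s≤s (s≤s m<n)) = <⇒<ᵇ-true (s≤s m<n)

  -- last holds the segment opened by the latest letter, which the next letter must not close.
  mutual
    pair : ℕ → ℕ → List Segment → List Segment → Annotated → Bool
    pair zero n last o w = false
    pair (suc f) zero last o w = pairClose f zero last o w
    pair (suc f) (suc n) last o w =
      pairClose f (suc n) last o w ∨ openThen (λ s → pair f n (segment s ∷ []) (last ++ o)) w

    pairClose : ℕ → ℕ → List Segment → List Segment → Annotated → Bool
    pairClose f n last o = closeAny (λ o' → pairFinish f n (last ++ o')) [] o

    pairFinish : ℕ → ℕ → List Segment → Annotated → Bool
    -- The budget `n` counts the openings still allowed. From 3 the test demands a variable beyond
    -- the first two, so complete parses of shape A B A B are left to the other word; from 0 or 1 it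
    -- always succeeds.
    pairFinish f n [] w = n ℕ.<ᵇ 3
    pairFinish f n (s ∷ o) w = pair f n [] (s ∷ o) w

  -- The branches mirror the constructors of `TopRun`. The 10 is fuel, one unit per letter, and the
  -- budget 1 after three openings restricts those patterns to four variables.
  conflict : ℕ → Bool → Annotated → Bool
  conflict n three = openThen (λ a → openThen (λ b w →
    pairClose 10 n (segment b ∷ []) (segment a ∷ []) w ∨
    (three ∧ openThen (λ c → pairClose 10 1 (segment c ∷ []) (segment b ∷ segment a ∷ [])) w)))

  split-occ : ∀ X q → 1 ≤ occ X q → ∃[ p₁ ] ∃[ b ] ∃[ p₂ ] q ≡ p₁ ++ plet X b ∷ p₂ × occ X q ≡ suc (occ X p₂)
  split-occ X (plet Y b ∷ q) 1≤ with X ≟ Y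
  ... | yes refl = [] , b , q , refl , occ-≡ X b q
  ... | no X≢Y with split-occ X q (subst (1 ≤_) (occ-≢ b q X≢Y) 1≤)
  ...   | p₁ , b' , p₂ , refl , e = plet Y b ∷ p₁ , b' , p₂ , refl , trans (occ-≢ b q X≢Y) e

  length-imgLetter : (h : Var → Word) (l : PLetter) → length (imgLetter h l) ≡ length (h (var l))
  length-imgLetter h (plet X b) = trans (cong length (imgLetter-orient h X b)) (length-orient b (h X))

  length-img : (h : Var → Word) (n : ℕ) (p : Pattern) → (∀ {l} → l ∈ p → length (h (var l)) ≤ n) → length
      (img h p) ≤ length p * n
  length-img h n [] _ = z≤n
  length-img h n (l ∷ p) le rewrite length-++ (imgLetter h l) {img h p} =
    +-mono-≤ (≤-trans (≤-reflexive (length-imgLetter h l)) (le (here refl))) (length-img h n p (le ∘ there))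

  imgLetter-pair : (h : Var → Word) (X : Var) (b b' : Bool) →
    imgLetter h (plet X b') ≡ imgLetter h (plet X b) ⊎ imgLetter h (plet X b') ≡ reverse
        (imgLetter h (plet X b))
  imgLetter-pair h X false false = inj₁ refl
  imgLetter-pair h X true true = inj₁ refl
  imgLetter-pair h X false true = inj₂ refl
  imgLetter-pair h X true false = inj₂ (sym (reverse-involutive (h X)))

  mutual
    -- An accepting run of the parser seen on the pattern alone. Its derivation says which branch of
    -- each Boolean test succeeds on the image.
    data Run : ℕ → List Var → List Var → Pattern → Set where
      close : ∀ {n last o q} → CloseRun n last o q → Run n last o q
      open′ : ∀ {n last o X b q} → 1 ≤ occ X q → Run n (X ∷ []) (last ++ o) q → Run (suc n) last o
          (plet X b ∷ q)

    data CloseRun : ℕ → List Var → List Var → Pattern → Set where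
      finish : ∀ {n X b} → n < 3 → CloseRun n [] (X ∷ []) (plet X b ∷ [])
      resume : ∀ {n last X b q} mid post → NonEmpty (last ++ (mid ++ post)) → Run n [] (last ++ (mid ++ post)) q
          →
               CloseRun n last (mid ++ X ∷ post) (plet X b ∷ q)

  data TopRun (n : ℕ) (three : Bool) : Pattern → Set where
    aba : ∀ {A a B b q} → 1 ≤ occ A (plet B b ∷ q) → 1 ≤ occ B q → CloseRun n (B ∷ []) (A ∷ []) q → TopRun n
        three (plet A a ∷ plet B b ∷ q)
    abc : ∀ {A a B b C c q} → 1 ≤ occ A (plet B b ∷ plet C c ∷ q) → 1 ≤ occ B (plet C c ∷ q) → 1 ≤ occ C q →
          three ≡ true → CloseRun 1 (C ∷ []) (B ∷ A ∷ []) q →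
          TopRun n three (plet A a ∷ plet B b ∷ plet C c ∷ q)

  module _ {h : Var → Word} where

    Holds : Var → Segment → Set
    Holds X s = h X ∈ s × reverse (h X) ∈ s

    Small : Pattern → Set
    Small = All (λ l → NonEmpty (h (var l)) × length (h (var l)) ≤ maxLen)

    holds-closes : ∀ {X s} b → Holds X s → imgLetter h (plet X b) ∈ s
    holds-closes false (i , _) = i
    holds-closes true (_ , i) = i

    holds-opened : ∀ X b → Holds X (segment (imgLetter h (plet X b) ʳ++ []))
    holds-opened X false with ∈-segment (reverse (h X))
    ... | i , j = subst (_∈ segment (reverse (h X))) (reverse-involutive (h X)) j , i
    holds-opened X true with ∈-segment (reverse (reverse (h X)))
    ... | i , j = subst (_∈ segment (reverse (reverse (h X)))) (reverse-involutive (h X)) i , subst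
        (_∈ segment (reverse (reverse (h X)))) (cong reverse (reverse-involutive (h X))) j

    pointwise-split : ∀ mid {X post os} → Pointwise Holds (mid ++ X ∷ post) os →
      ∃[ ms ] ∃[ s ] ∃[ ps ] os ≡ ms ++ s ∷ ps × Pointwise Holds mid ms × Holds X s × Pointwise Holds post ps
    pointwise-split [] (r ∷ rs) = [] , _ , _ , refl , [] , r , rs
    pointwise-split (Y ∷ mid) (r ∷ rs) with pointwise-split mid rs
    ... | ms , s , ps , refl , h₁ , h₂ , h₃ = _ ∷ ms , s , ps , refl , r ∷ h₁ , h₂ , h₃

    small-recurs : ∀ X b q rest → 1 ≤ occ X q → length q ≤ 10 → Small q →
      recursAt (length (imgLetter h (plet X b))) (imgLetter h (plet X b) ++ (img h q ++ rest)) ≡ true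
    small-recurs X b q rest occurs le sm with split-occ X q occurs
    ... | q₁ , b' , q₂ , refl , _
      rewrite take-++ (imgLetter h (plet X b)) (img h (q₁ ++ plet X b' ∷ q₂) ++ rest)
            | drop-++ (imgLetter h (plet X b)) (img h (q₁ ++ plet X b' ∷ q₂) ++ rest)
            | img-++ h q₁ (plet X b' ∷ q₂)
            | ++-assoc (img h q₁) (imgLetter h (plet X b') ++ img h q₂) rest
            | ++-assoc (imgLetter h (plet X b')) (img h q₂) rest =
      recurs-sound 50 (imgLetter h (plet X b)) (img h q₁) (imgLetter h (plet X b')) (img h q₂ ++ rest)
        (≤-<-trans (length-img h maxLen q₁ (λ i → proj₂ (All.lookup sm (∈-++⁺ˡ i)))) (*-monoˡ-< maxLen shorter))
        (imgLetter-pair h X b b')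
      where
      shorter : length q₁ < 10
      shorter = ≤-trans (≤-trans (≤-reflexive (+-comm 1 (length q₁))) (+-monoʳ-≤ (length q₁) (s≤s z≤n)))
        (≤-trans (≤-reflexive (sym (length-++ q₁ {plet X b' ∷ q₂}))) le)

    open-sound : ∀ k X b q rest → 1 ≤ occ X q → length q ≤ 10 → Small (plet X b ∷ q) →
      k (imgLetter h (plet X b) ʳ++ []) (annotate (img h q ++ rest)) ≡ true →
      openThen k (annotate (img h (plet X b ∷ q) ++ rest)) ≡ true
    open-sound k X b q rest occurs le ((ne , short) ∷ sm) e rewrite ++-assoc (imgLetter h (plet X b)) (img h q)
        rest =
      openThen-sound k (imgLetter h (plet X b)) (img h q ++ rest)
        (subst NonEmpty (sym (imgLetter-orient h X b)) (NonEmpty-orient b (h X) ne))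
        (≤-trans (≤-reflexive (length-imgLetter h (plet X b))) short) (small-recurs X b q rest occurs le sm) e

    mutual
      pair-sound : ∀ {f n last o q ls os} rest → Run n last o q → f ≤ 10 → length q ≤ f → Small q →
        Pointwise Holds last ls → Pointwise Holds o os → pair f n ls os (annotate (img h q ++ rest)) ≡ true
      pair-sound {n = zero} {q = _ ∷ _} rest (close r) (s≤s f≤) (s≤s le) sm pl po =
        pairClose-sound rest r (m≤n⇒m≤1+n f≤) le sm pl po
      pair-sound {n = suc n} {q = _ ∷ _} rest (close r) (s≤s f≤) (s≤s le) sm pl po
        rewrite pairClose-sound rest r (m≤n⇒m≤1+n f≤) le sm pl po = refl
      pair-sound {q = []} rest (close ()) _ _ _ _
      pair-sound {f = suc f} {suc n} {q = plet X b ∷ q} {ls} {os} rest (open′ occurs r) (s≤s f≤) (s≤s le)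
          sm@(_ ∷ sms) pl po
        rewrite open-sound (λ s → pair f n (segment s ∷ []) (ls ++ os)) X b q rest occurs
            (≤-trans le (m≤n⇒m≤1+n f≤)) sm
          (pair-sound rest r (m≤n⇒m≤1+n f≤) le sms (holds-opened X b ∷ []) (PW.++⁺ pl po)) = ∨-zeroʳ _

      pairClose-sound : ∀ {f n last o l q ls os} rest → CloseRun n last o (l ∷ q) → f ≤ 10 → length q ≤ f →
          Small (l ∷ q) →
        Pointwise Holds last ls → Pointwise Holds o os → pairClose f n ls os (annotate (img h (l ∷ q) ++ rest))
            ≡ true
      pairClose-sound {f} {n} {l = plet X b} rest (finish n<3) _ le sm [] (_∷_ {y = s} r [])
        rewrite ++-assoc (imgLetter h (plet X b)) [] rest =
        closeAny-sound (λ o' → pairFinish f n o') [] [] s [] (imgLetter h (plet X b)) rest (holds-closes b r)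
            (<⇒<ᵇ-true n<3)
      pairClose-sound {f} {n} {last} {l = plet X b} {q} {ls} rest (resume mid post ne run) f≤ le (sm ∷ sms) pl
          po
        with pointwise-split mid po
      ... | ms , s , ps , refl , h₁ , h₂ , h₃
        rewrite ++-assoc (imgLetter h (plet X b)) (img h q) rest =
        closeAny-sound (λ o' → pairFinish f n (ls ++ o')) [] ms s ps (imgLetter h (plet X b)) (img h q ++ rest)
          (holds-closes b h₂) (finish-sound ne run (PW.++⁺ pl (PW.++⁺ h₁ h₃)))
        where
        finish-sound : ∀ {o os} → NonEmpty o → Run n [] o q → Pointwise Holds o os →
                       pairFinish f n os (annotate (img h q ++ rest)) ≡ true
        finish-sound {_ ∷ _} _ run po@(_ ∷ _) = pair-sound rest run f≤ le sms [] po

    closeRun≢[] : ∀ {n last o q} → CloseRun n last o q → NonEmpty q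
    closeRun≢[] (finish _) = tt
    closeRun≢[] (resume _ _ _ _) = tt

    conflict-sound : ∀ {n three p} rest → TopRun n three p → length p ≤ 10 → Small p →
                     conflict n three (annotate (img h p ++ rest)) ≡ true
    conflict-sound rest (aba {q = []} _ _ r) _ _ = ⊥-elim (closeRun≢[] r)
    conflict-sound {n} {three} rest (aba {A} {a} {B} {b} {q@(_ ∷ q')} oA oB r) (s≤s (s≤s (s≤s le)))
        sm@(_ ∷ sm₁@(_ ∷ sm₂)) =
      open-sound _ A a (plet B b ∷ q) rest oA (≤-trans (s≤s (s≤s le)) (m≤n+m 9 1)) sm
        (open-sound _ B b q rest oB (≤-trans (s≤s le) (m≤n+m 8 2)) sm₁
        (cong (_∨ (three ∧ openThen (λ c → pairClose 10 1 (segment c ∷ [])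
            (segment (imgLetter h (plet B b) ʳ++ []) ∷ segment (imgLetter h (plet A a) ʳ++ []) ∷ []))
            (annotate (img h q ++ rest))))
          (pairClose-sound {10} {n} rest r ≤-refl (≤-trans le (m≤n+m 7 3)) sm₂ (holds-opened B b ∷ [])
              (holds-opened A a ∷ []))))
    conflict-sound rest (abc {q = []} _ _ _ _ r) _ _ = ⊥-elim (closeRun≢[] r)
    conflict-sound {n} rest (abc {A} {a} {B} {b} {C} {c} {q@(_ ∷ q')} oA oB oC refl r)
        (s≤s (s≤s (s≤s (s≤s le)))) sm@(_ ∷ sm₁@(_ ∷ sm₂@(_ ∷ sm₃))) =
      open-sound _ A a (plet B b ∷ plet C c ∷ q) rest oA (≤-trans (s≤s (s≤s (s≤s le))) (m≤n+m 9 1)) sm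
        (open-sound _ B b (plet C c ∷ q) rest oB (≤-trans (s≤s (s≤s le)) (m≤n+m 8 2)) sm₁
        (trans (cong (pairClose 10 n (segment (imgLetter h (plet B b) ʳ++ []) ∷ [])
            (segment (imgLetter h (plet A a) ʳ++ []) ∷ []) (annotate (img h (plet C c ∷ q) ++ rest)) ∨_)
            (open-sound (λ s → pairClose 10 1 (segment s ∷ [])
                (segment (imgLetter h (plet B b) ʳ++ []) ∷ segment (imgLetter h (plet A a) ʳ++ []) ∷ [])) C c q
                rest oC
              (≤-trans (s≤s le) (m≤n+m 7 3)) sm₂
              (pairClose-sound {10} {1} rest r ≤-refl (≤-trans le (m≤n+m 6 4)) sm₃
                (holds-opened C c ∷ []) (holds-opened B b ∷ holds-opened A a ∷ []))))
          (∨-zeroʳ _)))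

-- Excluding long images and applying the parser

module Instances where

  open Words
  open Chords
  open Potential using (occ-≡; occ-≢; occ-++)
  open Greedy using (img-++; factorAt-++)
  open import Data.Bool using (Bool; true; false)
  open import Data.Empty using (⊥)
  open import Data.List using ([]; _∷_; _++_; length; reverse)
  open import Data.List.Properties
  open import Data.List.Membership.Propositional using (_∈_)
  open import Data.List.Membership.Propositional.Properties using (∈-++⁺ˡ; ∈-++⁺ʳ)
  open import Data.List.Relation.Unary.All as All using (All; []; _∷_)
  open import Data.List.Relation.Unary.Any using (here; there)
  open import Data.Nat as ℕ using (ℕ; suc; z≤n; s≤s; _+_; _*_; _∸_; _≤_; _<_)
  open import Data.Nat.Properties
  open import Data.Product using (∃-syntax; _×_; _,_; proj₁; proj₂)
  open import Data.Sum using (_⊎_; inj₁; inj₂)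
  open import Data.Unit using (tt)
  open import Function using (case_of_)
  open import Relation.Nullary using (¬_; yes; no; contradiction)
  open import Relation.Binary.PropositionalEquality

  longest : (f : PLetter → ℕ) (p : Pattern) → NonEmpty p → ∃[ l ] l ∈ p × (∀ {l'} → l' ∈ p → f l' ≤ f l)
  longest f (l ∷ []) _ = l , here refl , λ { (here refl) → ≤-refl }
  longest f (l ∷ p@(_ ∷ _)) _ with longest f p tt
  ... | m , i , h with f l ≤? f m
  ...   | yes le = m , there i , λ { (here refl) → le ; (there j) → h j }
  ...   | no ≰ = l , here refl , λ { (here refl) → ≤-refl ; (there j) → ≤-trans (h j) (<⇒≤ (≰⇒> ≰)) }

  TwiceEach : Pattern → Set
  TwiceEach p = ∀ X → occ X p ≡ 0 ⊎ occ X p ≡ 2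

  occ-∈ : ∀ {l p} → l ∈ p → 1 ≤ occ (var l) p
  occ-∈ {l} {p} (here refl) = ≤-trans (s≤s z≤n) (≤-reflexive (sym (occ-≡ (var l) (reversed l) _)))
  occ-∈ {l} {plet Y b ∷ p} (there i) with var l ≟ Y
  ... | yes refl = ≤-trans (s≤s z≤n) (≤-reflexive (sym (occ-≡ Y b p)))
  ... | no X≢Y = ≤-trans (occ-∈ i) (≤-reflexive (sym (occ-≢ b p X≢Y)))

  twice-∈ : ∀ {l p} → TwiceEach p → l ∈ p → occ (var l) p ≡ 2
  twice-∈ {l} {p} tw i with tw (var l)
  ... | inj₂ e = e
  ... | inj₁ e = contradiction (subst (1 ≤_) e (occ-∈ i)) λ ()

  two-occurrences : ∀ X p → occ X p ≡ 2 →
    ∃[ p₁ ] ∃[ b ] ∃[ p₂ ] ∃[ b' ] ∃[ p₃ ] p ≡ p₁ ++ plet X b ∷ (p₂ ++ plet X b' ∷ p₃)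
  two-occurrences X p e with split-occ X p (≤-trans (s≤s z≤n) (≤-reflexive (sym e)))
  ... | p₁ , b , q , refl , e₁ with split-occ X q (≤-reflexive (suc-injective (trans (sym e) e₁)))
  ...   | p₂ , b' , p₃ , refl , _ = p₁ , b , p₂ , b' , p₃ , refl

  Within : ℕ → Pattern → Set
  Within D p = ∀ X p₁ b p₂ b' p₃ → p ≡ p₁ ++ plet X b ∷ (p₂ ++ plet X b' ∷ p₃) → length p₂ < D

  mutual
    -- Each open variable costs one closing letter, and each unit of the budget at most an opening
    -- and a closing letter.
    run-length : ∀ {n last o q} → Run n last o q → length q ≤ length last + length o + 2 * n
    run-length (close r) = closeRun-length r
    run-length {suc n} {last} {o} (open′ {X = X} _ r) = ≤-trans (s≤s (run-length r))
      (≤-reflexive (trans (cong (λ k → suc (suc (k + 2 * n))) (length-++ last))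
          (trans (sym (+-suc (suc (length last + length o)) (2 * n)))
        (trans (sym (+-suc (length last + length o) _)) (cong (length last + length o +_) (sym (*-suc 2 n)))))))

    closeRun-length : ∀ {n last o q} → CloseRun n last o q → length q ≤ length last + length o + 2 * n
    closeRun-length (finish _) = s≤s z≤n
    closeRun-length {n} {last} (resume mid post _ r) = ≤-trans (s≤s (run-length r))
      (≤-reflexive (cong (_+ 2 * n) (trans (cong suc
          (trans (length-++ last) (cong (length last +_) (length-++ mid))))
        (trans (sym (+-suc (length last) _)) (cong (length last +_)
            (trans (sym (+-suc (length mid) (length post))) (sym (length-++ mid))))))))

  closes-only : ∀ {n last o A l q} → CloseRun n last o (l ∷ q) → o ≡ A ∷ [] → var l ≡ A
  closes-only (finish _) e = ∷-injectiveˡ e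
  closes-only (resume [] post _ _) e = ∷-injectiveˡ e
  closes-only (resume (_ ∷ []) post _ _) ()
  closes-only (resume (_ ∷ _ ∷ _) post _ _) ()

  topRun-length : ∀ {n three p} → (three ≡ true → 3 ≤ n) → TopRun n three p → length p ≤ 4 + 2 * n
  topRun-length _ (aba _ _ r) = s≤s (s≤s (closeRun-length r))
  topRun-length {n} le (abc _ _ _ e r) = ≤-trans (s≤s (s≤s (s≤s (closeRun-length r))))
      (+-monoʳ-≤ 4 (≤-trans (m≤m+n 4 2) (*-monoʳ-≤ 2 (le e))))

  -- Only the first and the last letter of a pattern of full length `4 + 2 n` could be too far
  -- apart. In `aba` the first variable already returns at the third letter, so a match at the end
  -- would be its third occurrence; an `abc` pattern has at most eight letters.
  topRun-within : ∀ {n three p} → (three ≡ true → 3 ≤ n) → TwiceEach p → TopRun n three p → Within (2 + 2 * n) p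
  topRun-within {n} le tw t X (l ∷ p₁) b p₂ b' p₃ refl = +-cancelˡ-≤ 2 _ _ (≤-trans bound (topRun-length le t))
    where
    bound : 2 + suc (length p₂) ≤ length (l ∷ p₁ ++ plet X b ∷ (p₂ ++ plet X b' ∷ p₃))
    bound = s≤s (≤-trans (≤-trans (s≤s (≤-trans
        (≤-trans (≤-reflexive (+-comm 1 (length p₂))) (+-monoʳ-≤ (length p₂) (s≤s z≤n)))
        (≤-reflexive (sym (length-++ p₂ {plet X b' ∷ p₃})))))
      (m≤n+m _ (length p₁))) (≤-reflexive (sym (length-++ p₁ {plet X b ∷ (p₂ ++ plet X b' ∷ p₃)}))))
  topRun-within le tw (aba _ _ r) X [] b [] b' p₃ e = s≤s z≤n
  topRun-within le tw (aba _ _ r) X [] b (_ ∷ []) b' p₃ e = s≤s (s≤s z≤n)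
  topRun-within {n} le tw (aba {q = _ ∷ _} _ _ r) X [] b (l ∷ l' ∷ p₂) b' p₃ refl with closes-only r refl
  ... | refl = contradiction (trans (sym (twice-∈ {plet (var l') b} tw (here refl))) three-times) λ ()
    where
    X' = var l'
    three-times : occ X' (plet X' b ∷ l ∷ l' ∷ (p₂ ++ plet X' b' ∷ p₃)) ≡ 3 +
        (occ X' (l ∷ []) + occ X' p₂ + occ X' p₃)
    three-times = trans (occ-≡ X' b _) (cong suc (trans (occ-++ X' (l ∷ []) _)
      (trans (cong (occ X' (l ∷ []) +_) (trans (occ-≡ X' (reversed l') _)
          (cong suc (trans (occ-++ X' p₂ _) (trans (cong (occ X' p₂ +_) (occ-≡ X' b' p₃))
          (+-suc (occ X' p₂) _))))))
        (trans (+-suc (occ X' (l ∷ [])) _) (cong suc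
            (trans (+-suc (occ X' (l ∷ [])) _) (cong suc (sym (+-assoc (occ X' (l ∷ [])) _ _)))))))))
  topRun-within {n} le tw (abc _ _ _ e r) X [] b p₂ b' p₃ refl' = ≤-trans
      (+-cancelˡ-≤ 1 _ _ (≤-trans bound len)) (≤-trans (m≤m+n 7 1) (+-monoʳ-≤ 2 (*-monoʳ-≤ 2 (le e))))
    where
    len : length (plet X b ∷ (p₂ ++ plet X b' ∷ p₃)) ≤ 8
    len = ≤-trans (≤-reflexive (cong length (sym refl'))) (s≤s (s≤s (s≤s (closeRun-length r))))
    bound : 1 + suc (length p₂) ≤ length (plet X b ∷ (p₂ ++ plet X b' ∷ p₃))
    bound = s≤s (≤-trans (≤-trans (≤-reflexive (+-comm 1 (length p₂))) (+-monoʳ-≤ (length p₂) (s≤s z≤n)))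
        (≤-reflexive (sym (length-++ p₂ {plet X b' ∷ p₃}))))

  module Avoids (w : InfWord Letter) (n : ℕ) (three : Bool) (three⇒ : three ≡ true → 3 ≤ n) (n≤3 : n ≤ 3)
    (far : ∀ i d m → suc maxLen ≤ m → 1 ≤ m → m ≤ d →
           factorAt w (i + d) m ≡ factorAt w i m ⊎ factorAt w (i + d) m ≡ reverse (factorAt w i m) → (2 + 2 * n)
               * m < d)
    (clean : ∀ i → ∃[ L ] (4 + 2 * n) * maxLen ≤ L × conflict n three (annotate (factorAt w i L)) ≡ false)
    {p : Pattern} (tw : TwiceEach p) (t : TopRun n three p) where

    length≤10 : length p ≤ 10
    length≤10 = ≤-trans (topRun-length three⇒ t) (+-monoʳ-≤ 4 (*-monoʳ-≤ 2 n≤3))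

    p≢[] : NonEmpty p
    p≢[] = case t of λ { (aba _ _ _) → tt ; (abc _ _ _ _ _) → tt }

    module _ {h : Var → Word} (ne : ∀ X → OccursIn X p → NonEmpty (h X)) (i : ℕ)
        (e : factorAt w i (length (img h p)) ≡ img h p) where

      size : PLetter → ℕ
      size l = length (h (var l))

      long : ∀ l → l ∈ p → (∀ {l'} → l' ∈ p → size l' ≤ size l) → ¬ (suc maxLen ≤ size l)
      long l@(plet X _) l∈p most 6≤ with two-occurrences X p (twice-∈ tw l∈p)
      ... | p₁ , b , p₂ , b' , p₃ , refl = contradiction
          (far (i + length (img h p₁)) (length (x ++ img h p₂)) (length (h X)) 6≤ (≤-trans (s≤s z≤n) 6≤) m≤d
              matches)
          (≤⇒≯ d≤)
        where
        x = imgLetter h (plet X b)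
        x' = imgLetter h (plet X b')
        |x| = length-imgLetter h (plet X b)
        |x'| = length-imgLetter h (plet X b')
        i₁ = i + length (img h p₁)
        whole : img h p ≡ img h p₁ ++ ((x ++ img h p₂) ++ (x' ++ img h p₃))
        whole = trans (img-++ h p₁ _) (cong (img h p₁ ++_)
            (trans (cong (x ++_) (img-++ h p₂ _)) (sym (++-assoc x (img h p₂) _))))
        cut₁ = factorAt-++ w i (img h p₁) _ (subst (λ u → factorAt w i (length u) ≡ u) whole e)
        cut₂ = factorAt-++ w i₁ (x ++ img h p₂) (x' ++ img h p₃) (proj₂ cut₁)
        at-x : factorAt w i₁ (length (h X)) ≡ x
        at-x = trans (cong (factorAt w i₁) (sym |x|)) (proj₁ (factorAt-++ w i₁ x (img h p₂) (proj₁ cut₂)))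
        at-x' : factorAt w (i₁ + length (x ++ img h p₂)) (length (h X)) ≡ x'
        at-x' = trans (cong (factorAt w _) (sym |x'|)) (proj₁ (factorAt-++ w _ x' (img h p₃) (proj₂ cut₂)))
        m≤d : length (h X) ≤ length (x ++ img h p₂)
        m≤d = ≤-trans (≤-reflexive (sym |x|)) (≤-trans (m≤m+n _ _) (≤-reflexive (sym (length-++ x))))
        matches : factorAt w (i₁ + length (x ++ img h p₂)) (length (h X)) ≡ factorAt w i₁ (length (h X)) ⊎
                  factorAt w (i₁ + length (x ++ img h p₂)) (length (h X)) ≡ reverse
                      (factorAt w i₁ (length (h X)))
        matches with imgLetter-pair h X b b'
        ... | inj₁ q = inj₁ (trans at-x' (trans q (sym at-x)))
        ... | inj₂ q = inj₂ (trans at-x' (trans q (cong reverse (sym at-x))))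
        d≤ : length (x ++ img h p₂) ≤ (2 + 2 * n) * length (h X)
        d≤ = ≤-trans (≤-reflexive (trans (length-++ x) (cong (_+ length (img h p₂)) |x|)))
          (≤-trans (+-monoʳ-≤ (length (h X)) (length-img h (length (h X)) p₂
              (λ j → most (∈-++⁺ʳ p₁ (there (∈-++⁺ˡ j))))))
            (*-monoˡ-≤ (length (h X)) (topRun-within three⇒ tw t X p₁ b p₂ b' p₃ refl)))

      small : Small {h} p
      small with longest size p p≢[]
      ... | l , l∈p , most = All.tabulate λ {l'} j → ne (var l') (reversed l' , j) , ≤-trans (most j)
          (≮⇒≥ (long l l∈p most))

      absurd : ⊥
      absurd with clean i
      ... | L , enough , c = contradiction (trans (sym c)
          (subst (λ u → conflict n three (annotate u) ≡ true) (sym split)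
          (conflict-sound {h} _ t length≤10 small))) λ ()
        where
        len : length (img h p) ≤ L
        len = ≤-trans (length-img h maxLen p (λ j → proj₂ (All.lookup small j)))
            (≤-trans (*-monoˡ-≤ maxLen (topRun-length three⇒ t)) enough)
        split : factorAt w i L ≡ img h p ++ factorAt w (i + length (img h p)) (L ∸ length (img h p))
        split = trans (cong (factorAt w i) (sym (m+[n∸m]≡n len)))
            (trans (factorAt-+ w i (length (img h p)) _)
            (cong (_++ factorAt w (i + length (img h p)) (L ∸ length (img h p))) e))

    avoids : Avoidable 3 p
    avoids = w , λ (h , ne , i , e) → absurd {h} ne i e

-- Shapes of minimal patterns with at most five variables, each occurring twice

module Classification where

  open Chords
  open Instances
  open Potential using (occ-≡; occ-≢)
  open import Data.Bool using (true; false)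
  open import Data.Empty using (⊥; ⊥-elim)
  open import Data.List using (List; []; _∷_; _++_; _ʳ++_)
  open import Data.List.Properties
  open import Data.List.Membership.Propositional using (_∈_)
  open import Data.List.Membership.Propositional.Properties using (∈-∃++)
  open import Data.List.Relation.Unary.Any using (here; there)
  open import Data.Nat as ℕ using (ℕ; zero; suc; z≤n; s≤s; _+_; _≤_; _<_)
  open import Data.Nat.Properties
  open import Data.Product using (_,_)
  open import Data.Sum using (_⊎_; inj₁; inj₂)
  open import Data.Unit using (tt)
  open import Function using (case_of_)
  open import Relation.Nullary using (¬_; yes; no; contradiction)
  open import Relation.Binary.PropositionalEquality

  indicator : Var → Var → ℕ
  indicator X Y with X ≟ Y
  ... | yes _ = 1
  ... | no  _ = 0

  indicator-refl : ∀ X → indicator X X ≡ 1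
  indicator-refl X with X ≟ X
  ... | yes _ = refl
  ... | no ≢ = contradiction refl ≢

  count : Var → List Var → ℕ
  count X [] = 0
  count X (Y ∷ vs) = indicator X Y + count X vs

  count-++ : ∀ X us vs → count X (us ++ vs) ≡ count X us + count X vs
  count-++ X [] vs = refl
  count-++ X (Y ∷ us) vs = trans (cong (indicator X Y +_) (count-++ X us vs))
      (sym (+-assoc (indicator X Y) _ _))

  count-∈ : ∀ X vs → 1 ≤ count X vs → X ∈ vs
  count-∈ X (Y ∷ vs) le with X ≟ Y
  ... | yes refl = here refl
  ... | no _ = there (count-∈ X vs le)

  ∈-count : ∀ {X vs} → X ∈ vs → 1 ≤ count X vs
  ∈-count {X} {_ ∷ vs} (here refl) = ≤-trans (≤-reflexive (sym (indicator-refl X))) (m≤m+n _ _)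
  ∈-count {X} {Y ∷ vs} (there i) = ≤-trans (∈-count i) (m≤n+m _ (indicator X Y))

  occ-∷ : ∀ X Y b q → occ X (plet Y b ∷ q) ≡ indicator X Y + occ X q
  occ-∷ X Y b q with X ≟ Y
  ... | yes refl = occ-≡ X b q
  ... | no X≢Y = occ-≢ b q X≢Y

  occ-ʳ++ : ∀ X rd q → occ X (rd ʳ++ q) ≡ occ X rd + occ X q
  occ-ʳ++ X [] q = refl
  occ-ʳ++ X (plet Y b ∷ rd) q = trans (occ-ʳ++ X rd (plet Y b ∷ q)) (trans (cong (occ X rd +_) (occ-∷ X Y b q))
    (trans (sym (+-assoc (occ X rd) _ _)) (trans
        (cong (_+ occ X q) (trans (+-comm (occ X rd) _) (sym (occ-∷ X Y b rd)))) refl)))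

  isOne : ℕ → ℕ
  isOne (suc zero) = 1
  isOne _ = 0

  -- vs lists, without repetition, the variables occurring exactly once in the part rd read so far.
  Tracks : Pattern → List Var → Set
  Tracks rd vs = ∀ X → count X vs ≡ isOne (occ X rd)

  tracks-open : ∀ {X b rd} vs → occ X rd ≡ 0 → Tracks rd vs → Tracks (plet X b ∷ rd) (X ∷ vs)
  tracks-open {X} {b} {rd} vs e tr Y with tr Y
  ... | trY rewrite occ-∷ Y X b rd with Y ≟ X
  ...   | yes refl rewrite e = cong suc trY
  ...   | no _ = trY

  tracks-close : ∀ {X b rd} us vs → occ X rd ≡ 1 → Tracks rd (us ++ X ∷ vs) → Tracks (plet X b ∷ rd) (us ++ vs)
  tracks-close {X} {b} {rd} us vs e tr Y with tr Y
  ... | trY rewrite occ-∷ Y X b rd | count-++ Y us (X ∷ vs) | count-++ Y us vs with Y ≟ X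
  ...   | yes refl rewrite e = suc-injective (trans (sym (+-suc (count Y us) (count Y vs))) trY)
  ...   | no _ = trY

  bump : ℕ → ℕ → ℕ
  bump zero m = suc m
  bump (suc _) m = m

  -- The part `rd` already read is stored in reverse; with `rd = []` the value is the number of
  -- variables of the pattern.
  opens : Pattern → Pattern → ℕ
  opens rd [] = 0
  opens rd (l ∷ q) = bump (occ (var l) rd) (opens (l ∷ rd) q)

  NoAdjacent : Pattern → Set
  NoAdjacent p = ∀ rd l l' q → rd ʳ++ (l ∷ l' ∷ q) ≡ p → var l ≢ var l'

  NoDoubledPrefix : Pattern → Set
  NoDoubledPrefix p = ∀ rd q → rd ʳ++ q ≡ p → NonEmpty rd → NonEmpty q → ¬ (∀ X → occ X rd ≢ 1)

  module Derive (p : Pattern) (tw : TwiceEach p) (noAdjacent : NoAdjacent p) (noPrefix : NoDoubledPrefix p)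
      where

    Fresh : List Var → Pattern → Set
    Fresh last q = ∀ Y → Y ∈ last → ∀ {l q'} → q ≡ l ∷ q' → var l ≢ Y

    total : ∀ {rd q} X → rd ʳ++ q ≡ p → occ X rd + occ X q ≡ 0 ⊎ occ X rd + occ X q ≡ 2
    total {rd} {q} X refl = subst (λ n → n ≡ 0 ⊎ n ≡ 2) (occ-ʳ++ X rd q) (tw X)

    later : ∀ {rd q} X → rd ʳ++ q ≡ p → occ X rd ≡ 1 → 1 ≤ occ X q
    later {rd} {q} X e o with total {rd} {q} X e
    ... | inj₁ z rewrite o = contradiction z λ ()
    ... | inj₂ z rewrite o = ≤-reflexive (sym (suc-injective z))

    more-to-come : ∀ {rd q} X → rd ʳ++ q ≡ p → occ X rd ≡ 1 → NonEmpty q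
    more-to-come {rd} {[]} X e o = case later {rd} {[]} X e o of λ ()
    more-to-come {q = _ ∷ _} X e o = tt

    at-most-two : ∀ {rd l q} → rd ʳ++ (l ∷ q) ≡ p → 2 ≤ occ (var l) rd → ⊥
    at-most-two {rd} {plet X b} {q} e 2≤ with total {rd} {plet X b ∷ q} X e
    ... | inj₁ z = contradiction (≤-trans (≤-trans (s≤s z≤n) 2≤) (≤-trans (m≤m+n _ _) (≤-reflexive z))) λ ()
    ... | inj₂ z = contradiction (≤-trans (+-mono-≤ 2≤ (≤-trans (s≤s z≤n) (≤-reflexive (sym (occ-≡ X b q)))))
        (≤-reflexive z)) λ { (s≤s (s≤s ())) }

    fresh[] : ∀ {q} → Fresh [] q
    fresh[] Y ()

    fresh-open : ∀ {rd l q} → rd ʳ++ (l ∷ q) ≡ p → Fresh (var l ∷ []) q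
    fresh-open {rd} {l} e Y (here refl) {l'} {q'} refl h = noAdjacent rd l l' q' e (sym h)

    mutual
      -- An opening lowers `n` and `opens rd q` together, so both bounds persist. At the end `opens`
      -- is 0 and the upper one becomes the `n < 3` that `finish` requires.
      run : ∀ q rd last o n → rd ʳ++ q ≡ p → Tracks rd (last ++ o) → Fresh last q → opens rd q ≤ n → n < 3 +
          opens rd q → NonEmpty q → Run n last o q
      run (l ∷ q) rd last o n e tr fr op hi _ with occ (var l) rd in eo
      run (l ∷ q) rd last o (suc n) e tr fr (s≤s op) (s≤s hi) _ | zero = open′
        (later {l ∷ rd} (var l) e (trans (occ-≡ (var l) (reversed l) rd) (cong suc eo)))
        (run q (l ∷ rd) (var l ∷ []) (last ++ o) n e (tracks-open {b = reversed l} {rd} (last ++ o) eo tr)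
            (fresh-open {rd} e) op hi
          (more-to-come {l ∷ rd} (var l) e (trans (occ-≡ (var l) (reversed l) rd) (cong suc eo))))
      ... | suc zero = close (closing l q rd last o n e tr fr op hi eo)
      ... | suc (suc _) = ⊥-elim (at-most-two {rd} e (≤-trans (s≤s (s≤s z≤n)) (≤-reflexive (sym eo))))

      closing : ∀ l q rd last o n → rd ʳ++ (l ∷ q) ≡ p → Tracks rd (last ++ o) → Fresh last (l ∷ q) →
                opens (l ∷ rd) q ≤ n → n < 3 + opens (l ∷ rd) q → occ (var l) rd ≡ 1 → CloseRun n last o (l ∷ q)
      closing l q rd last o n e tr fr op hi eo with ∈-∃++ (count-∈ (var l) o in-o)
        where
        not-last : count (var l) last ≡ 0
        not-last with count (var l) last in ec
        ... | zero = refl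
        ... | suc _ = contradiction refl (fr (var l)
            (count-∈ (var l) last (≤-trans (s≤s z≤n) (≤-reflexive (sym ec)))) refl)
        in-o : 1 ≤ count (var l) o
        in-o = ≤-reflexive (sym (trans (cong (_+ count (var l) o) (sym not-last))
            (trans (sym (count-++ (var l) last o)) (trans (tr (var l)) (cong isOne eo)))))
      ... | mid , post , refl = continue last mid post tr'
        where
        tr' : Tracks (l ∷ rd) (last ++ (mid ++ post))
        tr' = subst (Tracks (l ∷ rd)) (++-assoc last mid post)
          (tracks-close {b = reversed l} {rd} (last ++ mid) post eo
              (subst (Tracks rd) (sym (++-assoc last mid (var l ∷ post))) tr))
        resumed : ∀ last mid post Y vs → last ++ (mid ++ post) ≡ Y ∷ vs → Tracks (l ∷ rd)
            (last ++ (mid ++ post)) → CloseRun n last (mid ++ var l ∷ post) (l ∷ q)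
        resumed last mid post Y vs eq tr' = resume mid post (subst NonEmpty (sym eq) tt)
          (run q (l ∷ rd) [] (last ++ (mid ++ post)) n e tr' fresh[] op hi (more-to-come {l ∷ rd} Y e once))
          where
          once : occ Y (l ∷ rd) ≡ 1
          once with occ Y (l ∷ rd) | tr' Y
          ... | suc zero | _ = refl
          ... | zero | h = contradiction (≤-trans (∈-count (subst (Y ∈_) (sym eq) (here refl))) (≤-reflexive h))
              λ ()
          ... | suc (suc _) | h = contradiction
              (≤-trans (∈-count (subst (Y ∈_) (sym eq) (here refl))) (≤-reflexive h)) λ ()
        continue : ∀ last mid post → Tracks (l ∷ rd) (last ++ (mid ++ post)) → CloseRun n last
            (mid ++ var l ∷ post) (l ∷ q)
        continue (Y ∷ last) mid post tr' = resumed (Y ∷ last) mid post Y _ refl tr'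
        continue [] (Y ∷ mid) post tr' = resumed [] (Y ∷ mid) post Y _ refl tr'
        continue [] [] (Y ∷ post) tr' = resumed [] [] (Y ∷ post) Y _ refl tr'
        -- With nothing left open the part read is doubled, so `noPrefix` forces the pattern to end
        -- here.
        continue [] [] [] tr' = final q refl
          where
          none : ∀ X → occ X (l ∷ rd) ≢ 1
          none X h with trans (tr' X) (cong isOne h)
          ... | ()
          final : ∀ q' → q' ≡ q → CloseRun n [] (var l ∷ []) (l ∷ q')
          final [] eq = finish (subst (λ r → n < 3 + opens (l ∷ rd) r) (sym eq) hi)
          final (_ ∷ _) eq = ⊥-elim (noPrefix (l ∷ rd) q e tt (subst NonEmpty eq tt) none)

    tracks[] : Tracks [] []
    tracks[] X = refl

    -- A third letter that is not new must repeat the first, which gives `aba`. After three distinct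
    -- letters, two further variables give `late₃`. With at most one further variable the fourth
    -- letter decides: a repeated variable gives `abc`, a new one `late₄`.
    data Shape : Pattern → Set where
      runs₂ : ∀ {q} → TopRun 0 false q → Shape q
      runs₃ : ∀ {q} → TopRun 3 true q → Shape q
      late₃ : ∀ a b c q → occ (var b) (a ∷ []) ≡ 0 → occ (var c) (b ∷ a ∷ []) ≡ 0 →
              opens (c ∷ b ∷ a ∷ []) q ≡ 2 → Shape (a ∷ b ∷ c ∷ q)
      late₄ : ∀ a b c d q → occ (var b) (a ∷ []) ≡ 0 → occ (var c) (b ∷ a ∷ []) ≡ 0 → occ (var d)
          (c ∷ b ∷ a ∷ []) ≡ 0 →
              opens (d ∷ c ∷ b ∷ a ∷ []) q ≡ 0 → Shape (a ∷ b ∷ c ∷ d ∷ q)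

    shape : ∀ q → q ≡ p → NonEmpty q → opens [] q ≤ 5 → Shape q
    shape (a ∷ []) e _ _ = ⊥-elim (more-to-come {a ∷ []} {[]} (var a) e (occ-≡ (var a) (reversed a) []))
    shape (a ∷ b ∷ q) e _ (s≤s v) = second q e (subst (λ k → bump k (opens (b ∷ a ∷ []) q) ≤ 4) b-new v)
      where
      b-new : occ (var b) (a ∷ []) ≡ 0
      b-new = occ-≢ (reversed a) [] (λ h → noAdjacent [] a b q e (sym h))
      once-b : occ (var b) (b ∷ a ∷ []) ≡ 1
      once-b = trans (occ-≡ (var b) (reversed b) (a ∷ [])) (cong suc b-new)
      once-a : occ (var a) (a ∷ []) ≡ 1
      once-a = occ-≡ (var a) (reversed a) []
      tracks₂ : Tracks (b ∷ a ∷ []) (var b ∷ var a ∷ [])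
      tracks₂ = tracks-open {b = reversed b} {a ∷ []} (var a ∷ []) b-new
          (tracks-open {b = reversed a} {[]} [] refl tracks[])
      second : ∀ q → a ∷ b ∷ q ≡ p → suc (opens (b ∷ a ∷ []) q) ≤ 4 → Shape (a ∷ b ∷ q)
      second [] e _ = ⊥-elim (more-to-come {b ∷ a ∷ []} {[]} (var b) e once-b)
      second (c ∷ q) e (s≤s v) with occ (var c) (b ∷ a ∷ []) in ec
      ... | suc (suc _) = ⊥-elim (at-most-two {b ∷ a ∷ []} {c} {q} e
          (≤-trans (s≤s (s≤s z≤n)) (≤-reflexive (sym ec))))
      ... | suc zero = byCount (opens (c ∷ b ∷ a ∷ []) q) refl
        where
        laterA = later {a ∷ []} {b ∷ c ∷ q} (var a) e once-a
        laterB = later {b ∷ a ∷ []} {c ∷ q} (var b) e once-b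
        closes : ∀ n → opens (c ∷ b ∷ a ∷ []) q ≤ n → n < 3 + opens (c ∷ b ∷ a ∷ []) q → CloseRun n (var b ∷ [])
            (var a ∷ []) (c ∷ q)
        closes n le hi = closing c q (b ∷ a ∷ []) (var b ∷ []) (var a ∷ []) n e tracks₂
            (fresh-open {a ∷ []} {b} {c ∷ q} e) le hi ec
        byCount : ∀ n → opens (c ∷ b ∷ a ∷ []) q ≡ n → Shape (a ∷ b ∷ c ∷ q)
        byCount zero eq = runs₂ (aba laterA laterB (closes 0 (≤-reflexive eq) (s≤s z≤n)))
        byCount (suc _) eq = runs₃ (aba laterA laterB
            (closes 3 v (≤-trans (m≤m+n 4 _) (≤-reflexive (cong (3 +_) (sym eq))))))
      ... | zero with v
      ...   | s≤s v' = third q e v'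
        where
        once-c : occ (var c) (c ∷ b ∷ a ∷ []) ≡ 1
        once-c = trans (occ-≡ (var c) (reversed c) (b ∷ a ∷ [])) (cong suc ec)
        third : ∀ q → a ∷ b ∷ c ∷ q ≡ p → opens (c ∷ b ∷ a ∷ []) q ≤ 2 → Shape (a ∷ b ∷ c ∷ q)
        third [] e _ = ⊥-elim (more-to-come {c ∷ b ∷ a ∷ []} {[]} (var c) e once-c)
        third (d ∷ q) e v with opens (c ∷ b ∷ a ∷ []) (d ∷ q) ≤? 1
        ... | no ≰1 = late₃ a b c (d ∷ q) b-new ec (≤-antisym v (≰⇒> ≰1))
        ... | yes v₁ with occ (var d) (c ∷ b ∷ a ∷ []) in ed
        ...   | suc (suc _) = ⊥-elim (at-most-two {c ∷ b ∷ a ∷ []} {d} {q} e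
            (≤-trans (s≤s (s≤s z≤n)) (≤-reflexive (sym ed))))
        ...   | suc zero = runs₃ (abc (later {a ∷ []} {b ∷ c ∷ d ∷ q} (var a) e once-a)
            (later {b ∷ a ∷ []} {c ∷ d ∷ q} (var b) e once-b)
                  (later {c ∷ b ∷ a ∷ []} {d ∷ q} (var c) e once-c) refl
                      (closing d q (c ∷ b ∷ a ∷ []) (var c ∷ []) (var b ∷ var a ∷ []) 1 e
                  (tracks-open {b = reversed c} {b ∷ a ∷ []} (var b ∷ var a ∷ []) ec tracks₂)
                      (fresh-open {b ∷ a ∷ []} {c} {d ∷ q} e) v₁ (s≤s (s≤s z≤n)) ed))
        ...   | zero = late₄ a b c d q b-new ec ed (n≤0⇒n≡0 (≤-pred v₁))

-- Minimal doubled prefixes and the numerical bounds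

module Reduction where

  open Chords
  open Instances
  open Classification
  open Potential
  open Greedy
  open import Data.Bool using (true; false)
  open import Data.List using ([]; _∷_; _++_; length; reverse; map)
  open import Data.List.Properties
  open import Data.List.Membership.Propositional using (_∈_; _∉_)
  open import Data.List.Membership.Propositional.Properties using (∈-++⁺ˡ; ∈-++⁺ʳ)
  open import Data.List.Relation.Unary.All as All using (All; []; _∷_)
  open import Data.List.Relation.Unary.All.Properties using (¬All⇒Any¬)
  open import Data.List.Relation.Unary.AllPairs using (AllPairs; []; _∷_)
  open import Data.List.Relation.Unary.Any as Any using (here; there)
  open import Data.Maybe using (Maybe; just; nothing)
  open import Data.Nat as ℕ using (ℕ; zero; suc; z≤n; s≤s)
  import Data.Nat.Properties as ℕ
  open import Data.Product using (∃-syntax; _×_; _,_; proj₁; proj₂)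
  open import Data.Integer using (+_)
  open import Data.Rational as ℚ using (ℚ; 0ℚ; 1ℚ; _+_; _*_; _≤_; _/_)
  import Data.Rational.Properties as ℚ
  open import Data.Rational.Solver using (module +-*-Solver)
  open import Data.Sum using (_⊎_; inj₁; inj₂)
  open import Data.Unit using (tt)
  open import Function using (_∘_; case_of_)
  open import Relation.Nullary using (¬_; ¬?; yes; no; contradiction)
  open import Relation.Nullary.Decidable using (from-yes)
  open import Relation.Unary using (Decidable)
  open import Relation.Binary.PropositionalEquality
  open +-*-Solver using (solve; _:=_; _:*_)

  avoidable-factor : ∀ {k} a p b → Avoidable k p → Avoidable k (a ++ (p ++ b))
  avoidable-factor a p b (w , avoid) = w , λ (h , ne , i , e) → avoid (h ,
    (λ X (r , m) → ne X (r , ∈-++⁺ʳ a (∈-++⁺ˡ m))) ,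
    i ℕ.+ length (img h a) ,
    proj₁ (factorAt-++ w _ (img h p) (img h b) (subst (λ u → factorAt w _ (length u) ≡ u) (img-++ h p b)
      (proj₂ (factorAt-++ w i (img h a) (img h (p ++ b))
          (subst (λ u → factorAt w i (length u) ≡ u) (img-++ h a (p ++ b)) e))))))

  HasAdjacent : Pattern → Set
  HasAdjacent p = ∃[ a ] ∃[ l ] ∃[ l' ] ∃[ b ] p ≡ a ++ (l ∷ l' ∷ b) × var l ≡ var l'

  adjacent? : ∀ p → HasAdjacent p ⊎ (∀ a l l' b → p ≡ a ++ (l ∷ l' ∷ b) → var l ≢ var l')
  adjacent? [] = inj₂ λ { [] _ _ _ () ; (_ ∷ _) _ _ _ () }
  adjacent? (l ∷ []) = inj₂ λ { [] _ _ _ () ; (_ ∷ []) _ _ _ () ; (_ ∷ _ ∷ _) _ _ _ () }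
  adjacent? (l ∷ p@(l' ∷ q)) with var l ℕ.≟ var l' | adjacent? p
  ... | yes e | _ = inj₁ ([] , l , l' , q , refl , e)
  ... | no _ | inj₁ (a , m , m' , b , e , e') = inj₁ (l ∷ a , m , m' , b , cong (l ∷_) e , e')
  ... | no l≢ | inj₂ none = inj₂ λ { [] _ _ _ refl → l≢ ; (_ ∷ a) m m' b e → none a m m' b (∷-injectiveʳ e) }

  properPrefix? : ∀ {P : Pattern → Set} → Decidable P → ∀ p →
    (∃[ a ] ∃[ b ] p ≡ a ++ b × NonEmpty a × NonEmpty b × P a) ⊎
    (∀ a b → p ≡ a ++ b → NonEmpty a → NonEmpty b → ¬ P a)
  properPrefix? P? [] = inj₂ λ { [] _ _ () ; (_ ∷ _) _ () }
  properPrefix? P? (l ∷ []) = inj₂ λ { [] _ _ () ; (_ ∷ []) [] _ _ () ; (_ ∷ []) (_ ∷ _) () ; (_ ∷ _ ∷ _) _ () }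
  properPrefix? P? (l ∷ q@(_ ∷ _)) with P? (l ∷ []) | properPrefix? (P? ∘ (l ∷_)) q
  ... | yes Pl | _ = inj₁ (l ∷ [] , q , refl , tt , tt , Pl)
  ... | no _ | inj₁ (a , b , e , _ , ne , Pa) = inj₁ (l ∷ a , b , cong (l ∷_) e , tt , ne , Pa)
  ... | no ¬Pl | inj₂ none = inj₂ longer
    where
    longer : ∀ a b → l ∷ q ≡ a ++ b → NonEmpty a → NonEmpty b → ¬ _
    longer (_ ∷ []) b refl _ _ = ¬Pl
    longer (m ∷ a@(_ ∷ _)) b e _ ne with ∷-injectiveˡ e
    ... | refl = none a b (∷-injectiveʳ e) tt ne

  NoneOnce : Pattern → Set
  NoneOnce p = ∀ X → occ X p ≢ 1

  occurs : ∀ X p → 1 ℕ.≤ occ X p → ∃[ b ] plet X b ∈ p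
  occurs X p 1≤ with split-occ X p 1≤
  ... | p₁ , b , p₂ , refl , _ = b , ∈-++⁺ʳ p₁ (here refl)

  noneOnce? : Decidable NoneOnce
  noneOnce? p with All.all? (λ l → ¬? (occ (var l) p ℕ.≟ 1)) p
  ... | yes ok = yes λ X e → All.lookup ok (proj₂ (occurs X p (ℕ.≤-reflexive (sym e)))) e
  ... | no ¬ok = no λ none → ¬ok (All.tabulate λ {l} _ → none (var l))

  doubled⇒noneOnce : ∀ {p} → Doubled p → NoneOnce p
  doubled⇒noneOnce {p} d X e = contradiction (subst (2 ℕ.≤_) e (d X (occurs X p (ℕ.≤-reflexive (sym e))))) λ
      { (s≤s ()) }

  shortest : ∀ n p → length p ℕ.≤ n → NonEmpty p → NoneOnce p →
    ∃[ a ] ∃[ b ] p ≡ a ++ b × NonEmpty a × NoneOnce a ×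
        (∀ c d → a ≡ c ++ d → NonEmpty c → NonEmpty d → ¬ NoneOnce c)
  shortest zero [] _ () _
  shortest zero (_ ∷ _) () _ _
  shortest (suc n) p le ne once with properPrefix? noneOnce? p
  ... | inj₂ none = p , [] , sym (++-identityʳ p) , ne , once , none
  ... | inj₁ (a , b@(_ ∷ _) , refl , nea , neb , oncea)
    with shortest n a (ℕ.≤-pred (ℕ.≤-trans (ℕ.≤-trans (ℕ.≤-reflexive (ℕ.+-comm 1 (length a)))
        (ℕ.+-monoʳ-≤ (length a) (s≤s z≤n))) (ℕ.≤-trans (ℕ.≤-reflexive (sym (length-++ a {b}))) le))) nea oncea
  ...   | c , d , refl , nec , oncec , none = c , d ++ b , ++-assoc c d b , nec , oncec , none

  occ-reverse : ∀ X rd → occ X (reverse rd) ≡ occ X rd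
  occ-reverse X rd = trans (occ-ʳ++ X rd []) (ℕ.+-identityʳ _)

  -- Variables already read contribute factor 1, so under this invariant `wt σ q` is the product of
  -- `G` over the variables that `q` introduces.
  Rel : Pattern → (Var → Maybe ℕ) → Set
  Rel rd σ = ∀ X → (occ X rd ≡ 0 → σ X ≡ nothing) × (1 ℕ.≤ occ X rd → σ X ≡ just 0)

  rel-known : ∀ {l rd σ} → 1 ℕ.≤ occ (var l) rd → Rel rd σ → Rel (l ∷ rd) σ
  rel-known {plet X b} {rd} 1≤ r Y rewrite occ-∷ Y X b rd with Y ℕ.≟ X
  ... | yes refl = (λ ()) , λ _ → proj₂ (r Y) 1≤
  ... | no _ = r Y

  rel-new : ∀ {l rd σ} → Rel rd σ → Rel (l ∷ rd) (σ [ var l ↦ just 0 ])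
  rel-new {plet X b} {rd} {σ} r Y rewrite occ-∷ Y X b rd with Y ℕ.≟ X
  ... | yes refl = (λ ()) , λ _ → upd-≡ σ Y (just 0)
  ... | no Y≢X rewrite upd-≢ σ {X} {Y} (just 0) (Y≢X ∘ sym) = r Y

  data Distinct : Pattern → Set where
    []  : Distinct []
    _∷_ : ∀ {l rd} → occ (var l) rd ≡ 0 → Distinct rd → Distinct (l ∷ rd)

  occ-0⇒∉ : ∀ {X} rd → occ X rd ≡ 0 → All (X ≢_) (map var rd)
  occ-0⇒∉ [] _ = []
  occ-0⇒∉ {X} (plet Y b ∷ rd) e with X ℕ.≟ Y
  ... | yes refl = contradiction (trans (sym e) (occ-≡ X b rd)) λ ()
  ... | no X≢Y = X≢Y ∷ occ-0⇒∉ rd (trans (sym (occ-≢ b rd X≢Y)) e)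

  ∉⇒occ-0 : ∀ {X} rd → X ∉ map var rd → occ X rd ≡ 0
  ∉⇒occ-0 [] _ = refl
  ∉⇒occ-0 (plet Y b ∷ rd) X∉ = trans (occ-≢ b rd (X∉ ∘ here)) (∉⇒occ-0 rd (X∉ ∘ there))

  distinct-pairs : ∀ {rd} → Distinct rd → AllPairs _≢_ (map var rd)
  distinct-pairs [] = []
  distinct-pairs (_∷_ {rd = rd} e d) = occ-0⇒∉ rd e ∷ distinct-pairs d

  distinct-once : ∀ {rd l} → Distinct rd → l ∈ rd → occ (var l) rd ≡ 1
  distinct-once {l = plet X b} (_∷_ {rd = rd} e d) (here refl) = trans (occ-≡ X b rd) (cong suc e)
  distinct-once {l = l} (_∷_ {plet Y b} {rd} e d) (there i) with var l ℕ.≟ Y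
  ... | yes refl = contradiction (trans (sym e) (distinct-once d i)) λ ()
  ... | no ≢ = trans (occ-≢ b rd ≢) (distinct-once d i)

  zeros-rel : ∀ rd {σ} → Distinct rd → (∀ X → σ X ≡ nothing ⊎ σ X ≡ just 0) →
    ∀ X → (occ X rd ≡ 0 → zeros σ rd X ≡ σ X) × (1 ℕ.≤ occ X rd → zeros σ rd X ≡ just 0)
  zeros-rel [] [] h X = (λ _ → refl) , λ ()
  zeros-rel (l@(plet Y b) ∷ rd) {σ} (e ∷ d) h X
    with zeros-rel rd {σ [ Y ↦ just 0 ]} d h' X
    where
    h' : ∀ Z → (σ [ Y ↦ just 0 ]) Z ≡ nothing ⊎ (σ [ Y ↦ just 0 ]) Z ≡ just 0
    h' Z with Y ℕ.≟ Z
    ... | yes _ = inj₂ refl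
    ... | no _ = h Z
  ... | absent , present rewrite occ-∷ X Y b rd with X ℕ.≟ Y
  ...   | yes refl = (λ ()) , λ _ → trans (absent e) (upd-≡ σ X (just 0))
  ...   | no X≢Y = (λ o → trans (absent o) (upd-≢ σ (just 0) (X≢Y ∘ sym))) , present

  module Bounds (t G₂ G₃ H : ℚ) (0≤t : 0ℚ ≤ t) (t≤1 : t ≤ 1ℚ)
    (0≤G₂ : 0ℚ ≤ G₂) (0≤G₃ : 0ℚ ≤ G₃) (0≤H : 0ℚ ≤ H)
    (super₂ : 3ℚ * (t * (t * (1ℚ + G₂))) ≤ G₂)
    (super₃ : 3ℚ * (t * (t * (t * (1ℚ + G₃)))) ≤ G₃)
    (superH : t * (1ℚ + H) ≤ H) (G₃≤G₂ : G₃ ≤ G₂) (G₂≤1 : G₂ ≤ 1ℚ) where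

    open Construction t G₂ G₃ H 0≤t t≤1 0≤G₂ 0≤G₃ 0≤H super₂ super₃ superH

    G≤G₂ : ∀ n → G n ≤ G₂
    G≤G₂ zero = ℚ.≤-refl
    G≤G₂ (suc zero) = ℚ.≤-refl
    G≤G₂ (suc (suc zero)) = ℚ.≤-refl
    G≤G₂ (suc (suc (suc n))) = G₃≤G₂

    wt≤ : ∀ q rd {σ} → Rel rd σ → wt σ q ≤ power G₂ (opens rd q)
    wt≤ [] rd r = ℚ.≤-refl
    wt≤ (plet X b ∷ q) rd {σ} r with occ X rd in eo | σ X in eσ
    ... | zero | nothing = *-mono-≤0 (0≤G (suc (occ X q))) (0≤power 0≤G₂ (opens (plet X b ∷ rd) q))
        (G≤G₂ (suc (occ X q))) (wt≤ q (plet X b ∷ rd) (rel-new {plet X b} {rd} {σ} r))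
    ... | zero | just _ = case trans (sym eσ) (proj₁ (r X) eo) of λ ()
    ... | suc _ | nothing = case trans (sym eσ) (proj₂ (r X) (ℕ.≤-trans (s≤s z≤n) (ℕ.≤-reflexive (sym eo)))) of
        λ ()
    ... | suc _ | just n with trans (sym eσ) (proj₂ (r X) (ℕ.≤-trans (s≤s z≤n) (ℕ.≤-reflexive (sym eo))))
    ...   | refl = ℚ.≤-trans (ℚ.≤-reflexive (ℚ.*-identityˡ (wt σ q)))
                     (wt≤ q (plet X b ∷ rd) (rel-known {plet X b} {rd} {σ}
                         (ℕ.≤-trans (s≤s z≤n) (ℕ.≤-reflexive (sym eo))) r))

    wt≤₃ : ∀ q rd {σ} Y → Rel rd σ → occ Y rd ≡ 0 → 3 ℕ.≤ occ Y q →
           ∃[ m ] opens rd q ≡ suc m × wt σ q ≤ G₃ * power G₂ m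
    wt≤₃ (plet X b ∷ q) rd {σ} Y r oY 3≤ with X ℕ.≟ Y
    wt≤₃ (plet X b ∷ q) rd {σ} X r oY 3≤ | yes refl with σ X in eσ
    ... | just _ = case trans (sym eσ) (proj₁ (r X) oY) of λ ()
    ... | nothing rewrite oY = opens (plet X b ∷ rd) q , refl ,
          *-mono-≤0 (0≤G (suc (occ X q))) (0≤power 0≤G₂ (opens (plet X b ∷ rd) q))
              (ℚ.≤-reflexive (thrice (suc (occ X q)) (subst (3 ℕ.≤_) (occ-≡ X b q) 3≤)))
            (wt≤ q (plet X b ∷ rd) (rel-new {plet X b} {rd} {σ} r))
      where
      thrice : ∀ n → 3 ℕ.≤ n → G n ≡ G₃
      thrice (suc (suc (suc n))) _ = refl
      thrice (suc zero) (s≤s ())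
      thrice (suc (suc zero)) (s≤s (s≤s ()))
    wt≤₃ (plet X b ∷ q) rd {σ} Y r oY 3≤ | no X≢Y with occ X rd in eo | σ X in eσ
    ... | zero | just _ = case trans (sym eσ) (proj₁ (r X) eo) of λ ()
    ... | suc _ | nothing = case trans (sym eσ) (proj₂ (r X) (ℕ.≤-trans (s≤s z≤n) (ℕ.≤-reflexive (sym eo)))) of
        λ ()
    ... | zero | nothing with wt≤₃ q (plet X b ∷ rd) Y (rel-new {plet X b} {rd} {σ} r)
        (trans (occ-≢ b rd (X≢Y ∘ sym)) oY) (subst (3 ℕ.≤_) (occ-≢ b q (X≢Y ∘ sym)) 3≤)
    ...   | m , e , le = suc m , cong suc e , ℚ.≤-trans
              (*-mono-≤0 (0≤G (suc (occ X q))) (0≤* G₃ (power G₂ m) 0≤G₃ (0≤power 0≤G₂ m))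
                  (G≤G₂ (suc (occ X q))) le)
              (ℚ.≤-reflexive (solve 3 (λ g h p → g :* (h :* p) := h :* (g :* p)) refl G₂ G₃ (power G₂ m)))
    wt≤₃ (plet X b ∷ q) rd {σ} Y r oY 3≤ | no X≢Y | suc _ | just n
      with trans (sym eσ) (proj₂ (r X) (ℕ.≤-trans (s≤s z≤n) (ℕ.≤-reflexive (sym eo))))
         | wt≤₃ q (plet X b ∷ rd) Y (rel-known {plet X b} {rd} {σ}
             (ℕ.≤-trans (s≤s z≤n) (ℕ.≤-reflexive (sym eo))) r) (trans (occ-≢ b rd (X≢Y ∘ sym)) oY)
             (subst (3 ℕ.≤_) (occ-≢ b q (X≢Y ∘ sym)) 3≤)
    ...   | refl | m , e , le = m , e , ℚ.≤-trans (ℚ.≤-reflexive (ℚ.*-identityˡ (wt σ q))) le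

    bounded : ∀ j {x y} → 1ℚ + power H j * y ≤ 3ℚ * t → x ≤ y → 1ℚ + power H j * x ≤ 3ℚ * t
    bounded j num le = ℚ.≤-trans (ℚ.+-monoʳ-≤ 1ℚ (*-monoˡ-≤0 (0≤power 0≤H j) le)) num

    rel-none : Rel [] (λ _ → nothing)
    rel-none X = (λ _ → refl) , λ ()

    early : ∀ p → NonEmpty p → NoneOnce p → 1ℚ + power H 0 * wt (λ _ → nothing) p ≤ 3ℚ * t → Avoidable 3 p
    early p ne once num = Avoiding.avoidable [] p ne [] [] (λ Y _ → once Y) num

    many : ∀ n p → NonEmpty p → NoneOnce p → n ℕ.≤ opens [] p → 1ℚ + power H 0 * power G₂ n ≤ 3ℚ * t → Avoidable
        3 p
    many n p ne once n≤ num = early p ne once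
      (bounded 0 num (ℚ.≤-trans (wt≤ p [] rel-none) (power-anti 0≤G₂ G₂≤1 n≤)))

    thrice : ∀ n p Y → NonEmpty p → NoneOnce p → 3 ℕ.≤ occ Y p → suc n ℕ.≤ opens [] p →
             1ℚ + power H 0 * (G₃ * power G₂ n) ≤ 3ℚ * t → Avoidable 3 p
    thrice n p Y ne once 3≤ n≤ num with wt≤₃ p [] Y rel-none refl 3≤
    ... | m , e , le = early p ne once (bounded 0 num (ℚ.≤-trans le (*-monoˡ-≤0 0≤G₃
            (power-anti 0≤G₂ G₂≤1 (ℕ.≤-pred (subst (suc n ℕ.≤_) e n≤))))))

    -- Two occurrences each leave exactly one in `q` for a variable of the distinct prefix and both
    -- for any other; these are the hypotheses `later` and `twice` of `Avoiding`.
    lateStart : ∀ rp q n → TwiceEach (reverse rp ++ q) → NonEmpty rp → Distinct rp → opens rp q ≡ n →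
                1ℚ + power H (length rp) * power G₂ n ≤ 3ℚ * t →
                Avoidable 3 (reverse rp ++ q)
    lateStart rp@(l₀ ∷ _) q n tw _ d op num = Avoiding.avoidable rp q q≢[] (distinct-pairs d)
        (All.tabulate later) notOnce bound
      where
      split : ∀ X → occ X (reverse rp ++ q) ≡ occ X rp ℕ.+ occ X q
      split X = trans (occ-++ X (reverse rp) q) (cong (ℕ._+ occ X q) (occ-reverse X rp))
      later : ∀ {l} → l ∈ rp → 1 ℕ.≤ occ (var l) q
      later {l} i with tw (var l)
      ... | inj₁ e rewrite split (var l) | distinct-once d i = case e of λ ()
      ... | inj₂ e rewrite split (var l) | distinct-once d i = ℕ.≤-reflexive (sym (ℕ.suc-injective e))
      q≢[] : NonEmpty q
      q≢[] = nonEmpty q (later (here refl))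
        where
        nonEmpty : ∀ r → 1 ℕ.≤ occ (var l₀) r → NonEmpty r
        nonEmpty (_ ∷ _) _ = tt
      notOnce : ∀ Y → Y ∉ map var rp → occ Y q ≢ 1
      notOnce Y Y∉ e with tw Y
      ... | inj₁ e' rewrite split Y | ∉⇒occ-0 rp Y∉ | e = case e' of λ ()
      ... | inj₂ e' rewrite split Y | ∉⇒occ-0 rp Y∉ | e = case e' of λ ()
      rel : Rel rp (zeros (λ _ → nothing) rp)
      rel = zeros-rel rp d (λ _ → inj₁ refl)
      bound : 1ℚ + power H (length rp) * wt (zeros (λ _ → nothing) rp) q ≤ 3ℚ * t
      bound = bounded (length rp) num (ℚ.≤-trans (wt≤ q rp rel) (ℚ.≤-reflexive (cong (power G₂) op)))

  -- (7/11)⁶, (7/11)²/6 and (9/16)³ (7/11)² are all below 3 · 9/25 − 1.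
  module A = Bounds (+ 9 / 25) (+ 7 / 11) (+ 1 / 6) (+ 9 / 16)
    (from-yes (0ℚ ℚ.≤? + 9 / 25)) (from-yes (+ 9 / 25 ℚ.≤? 1ℚ)) (from-yes (0ℚ ℚ.≤? + 7 / 11))
        (from-yes (0ℚ ℚ.≤? + 1 / 6)) (from-yes (0ℚ ℚ.≤? + 9 / 16))
    (from-yes (3ℚ * (+ 9 / 25 * (+ 9 / 25 * (1ℚ + + 7 / 11))) ℚ.≤? + 7 / 11))
    (from-yes (3ℚ * (+ 9 / 25 * (+ 9 / 25 * (+ 9 / 25 * (1ℚ + + 1 / 6)))) ℚ.≤? + 1 / 6))
    (from-yes (+ 9 / 25 * (1ℚ + + 9 / 16) ℚ.≤? + 9 / 16))
    (from-yes (+ 1 / 6 ℚ.≤? + 7 / 11)) (from-yes (+ 7 / 11 ℚ.≤? 1ℚ))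

  -- (2/3)⁴ is below 3 · 2/5 − 1.
  module B = Bounds (+ 2 / 5) (+ 12 / 13) (+ 6 / 25) (+ 2 / 3)
    (from-yes (0ℚ ℚ.≤? + 2 / 5)) (from-yes (+ 2 / 5 ℚ.≤? 1ℚ)) (from-yes (0ℚ ℚ.≤? + 12 / 13))
        (from-yes (0ℚ ℚ.≤? + 6 / 25)) (from-yes (0ℚ ℚ.≤? + 2 / 3))
    (from-yes (3ℚ * (+ 2 / 5 * (+ 2 / 5 * (1ℚ + + 12 / 13))) ℚ.≤? + 12 / 13))
    (from-yes (3ℚ * (+ 2 / 5 * (+ 2 / 5 * (+ 2 / 5 * (1ℚ + + 6 / 25)))) ℚ.≤? + 6 / 25))
    (from-yes (+ 2 / 5 * (1ℚ + + 2 / 3) ℚ.≤? + 2 / 3))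
    (from-yes (+ 6 / 25 ℚ.≤? + 12 / 13)) (from-yes (+ 12 / 13 ℚ.≤? 1ℚ))

  occ-two : ∀ {A B} a b a' b' → A ≢ B → TwiceEach (plet A a ∷ plet B b ∷ plet A a' ∷ plet B b' ∷ [])
  occ-two {A} {B} a b a' b' A≢B X
    rewrite occ-∷ X A a (plet B b ∷ plet A a' ∷ plet B b' ∷ []) | occ-∷ X B b (plet A a' ∷ plet B b' ∷ [])
          | occ-∷ X A a' (plet B b' ∷ []) | occ-∷ X B b' [] with X ℕ.≟ A | X ℕ.≟ B
  ... | yes refl | yes refl = contradiction refl A≢B
  ... | yes _ | no _ = inj₂ refl
  ... | no _ | yes _ = inj₂ refl
  ... | no _ | no _ = inj₁ refl

  -- An alternating pattern over two variables already has the doubled prefix A B A B.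
  two-variables : ∀ p → NonEmpty p → NoneOnce p → NoAdjacent p → NoDoubledPrefix p → opens [] p ℕ.≤ 2 →
                  TwiceEach p × TopRun 0 false p
  two-variables (a ∷ []) _ once _ _ _ = contradiction (occ-≡ (var a) (reversed a) []) (once (var a))
  two-variables (a ∷ b ∷ []) _ once adj _ _ = contradiction
      (trans (occ-≡ (var a) (reversed a) (b ∷ [])) (cong suc (occ-≢ (reversed b) [] (adj [] a b [] refl))))
      (once (var a))
  two-variables (a ∷ b ∷ c ∷ q) _ once adj pre v with occ (var b) (a ∷ []) in eb
  ... | suc _ = contradiction (trans (sym eb) (occ-≢ (reversed a) [] (adj [] a b _ refl ∘ sym))) λ ()
  ... | zero with occ (var c) (b ∷ a ∷ []) in ec
  ...   | zero = contradiction v λ { (s≤s (s≤s ())) }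
  ...   | suc _ with var c ℕ.≟ var a
  ...     | no c≢a = contradiction (trans (sym ec)
      (trans (occ-≢ (reversed b) (a ∷ []) (adj (a ∷ []) b c q refl ∘ sym)) (occ-≢ (reversed a) [] c≢a))) λ ()
  ...     | yes refl = fourth q once adj pre v
    where
    a≢b = adj [] a b (c ∷ q) refl
    fourth : ∀ q → NoneOnce (a ∷ b ∷ c ∷ q) → NoAdjacent (a ∷ b ∷ c ∷ q) → NoDoubledPrefix (a ∷ b ∷ c ∷ q) →
             suc (suc (opens (c ∷ b ∷ a ∷ []) q)) ℕ.≤ 2 → TwiceEach (a ∷ b ∷ c ∷ q) × TopRun 0 false
                 (a ∷ b ∷ c ∷ q)
    fourth [] once _ _ _ = contradiction (trans (occ-≢ (reversed a) (b ∷ c ∷ []) (a≢b ∘ sym))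
        (trans (occ-≡ (var b) (reversed b) (c ∷ []))
      (cong suc (occ-≢ (reversed c) [] (a≢b ∘ sym))))) (once (var b))
    fourth (d ∷ q) once adj pre v with var d ℕ.≟ var b
    ... | no d≢b with occ (var d) (c ∷ b ∷ a ∷ []) in ed
    ...   | zero = contradiction v λ { (s≤s (s≤s ())) }
    ...   | suc _ = contradiction (trans (sym ed)
        (trans (occ-≢ (reversed c) (b ∷ a ∷ []) d≢c)
        (trans (occ-≢ (reversed b) (a ∷ []) d≢b) (occ-≢ (reversed a) [] d≢c)))) λ ()
      where
      d≢c : var d ≢ var a
      d≢c = adj (b ∷ a ∷ []) c d q refl ∘ sym
    fourth (d ∷ []) once adj pre v | yes refl = occ-two (reversed a) (reversed b) (reversed c) (reversed d) a≢b
        ,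
      aba (ℕ.≤-trans (s≤s z≤n) (ℕ.≤-reflexive
          (sym (trans (occ-≢ (reversed b) (c ∷ d ∷ []) a≢b) (occ-≡ (var a) (reversed c) (d ∷ []))))))
          (ℕ.≤-trans (s≤s z≤n) (ℕ.≤-reflexive
              (sym (trans (occ-≢ (reversed c) (d ∷ []) (a≢b ∘ sym)) (occ-≡ (var b) (reversed d) [])))))
          (resume [] [] tt (close (finish (s≤s z≤n))))
    fourth (d ∷ q@(_ ∷ _)) once adj pre v | yes refl = contradiction none
        (pre (d ∷ c ∷ b ∷ a ∷ []) q refl tt tt)
      where
      none : NoneOnce (d ∷ c ∷ b ∷ a ∷ [])
      none X e with occ-two (reversed d) (reversed c) (reversed b) (reversed a) (a≢b ∘ sym) X
      ... | inj₁ z = contradiction (trans (sym e) z) λ ()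
      ... | inj₂ z = contradiction (trans (sym e) z) λ ()

  module Main
    (squares : ∀ l l' → var l ≡ var l' → Avoidable 3 (l ∷ l' ∷ []))
    (runs₂-avoidable : ∀ {p} → TwiceEach p → TopRun 0 false p → Avoidable 3 p)
    (runs₃-avoidable : ∀ {p} → TwiceEach p → TopRun 3 true p → Avoidable 3 p) where

    minimal : ∀ p → NonEmpty p → NoneOnce p → NoAdjacent p → NoDoubledPrefix p → Avoidable 3 p
    minimal p ne once adj pre with opens [] p ℕ.≤? 2
    -- Two variables are settled first, so that at least three are present when `A.thrice` needs the
    -- product `G₃ G₂²`.
    ... | yes v≤2 = let tw , t = two-variables p ne once adj pre v≤2 in runs₂-avoidable tw t
    ... | no v≰2 with 6 ℕ.≤? opens [] p
    ...   | yes 6≤v = A.many 6 p ne once 6≤v (from-yes (1ℚ + 1ℚ * power (+ 7 / 11) 6 ℚ.≤? 3ℚ * (+ 9 / 25)))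
    ...   | no 6≰v with All.all? (λ l → occ (var l) p ℕ.≟ 2) p
    ...     | no ¬exact = let l , l∈p , l≢2 = witness in
              A.thrice 2 p (var l) ne once (atLeast3 (occ-∈ l∈p) (once (var l)) l≢2) (ℕ.≰⇒> v≰2)
                  (from-yes (1ℚ + 1ℚ * (+ 1 / 6 * power (+ 7 / 11) 2) ℚ.≤? 3ℚ * (+ 9 / 25)))
      where
      find∃ : ∀ {P : PLetter → Set} {xs} → Any.Any P xs → ∃[ x ] x ∈ xs × P x
      find∃ (here px) = _ , here refl , px
      find∃ (there a) = let x , i , px = find∃ a in x , there i , px
      witness = find∃ (¬All⇒Any¬ (λ l → occ (var l) p ℕ.≟ 2) p ¬exact)
      atLeast3 : ∀ {n} → 1 ℕ.≤ n → n ≢ 1 → n ≢ 2 → 3 ℕ.≤ n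
      atLeast3 {suc zero} _ n≢1 _ = contradiction refl n≢1
      atLeast3 {suc (suc zero)} _ _ n≢2 = contradiction refl n≢2
      atLeast3 {suc (suc (suc n))} _ _ _ = s≤s (s≤s (s≤s z≤n))
    ...     | yes exact = byShape (Derive.shape p tw adj pre p refl ne (ℕ.≤-pred (ℕ.≰⇒> 6≰v))) tw
      where
      tw : TwiceEach p
      tw X with occ X p in e
      ... | zero = inj₁ refl
      ... | suc _ with occurs X p (ℕ.≤-trans (s≤s z≤n) (ℕ.≤-reflexive (sym e)))
      ...   | b , i = inj₂ (trans (sym e) (All.lookup exact i))
      byShape : ∀ {p₀ tw₀ adj₀ pre₀ q} → Derive.Shape p₀ tw₀ adj₀ pre₀ q → TwiceEach q → Avoidable 3 q
      byShape (Derive.runs₂ t) tw = runs₂-avoidable tw t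
      byShape (Derive.runs₃ t) tw = runs₃-avoidable tw t
      byShape (Derive.late₃ a b c q eb ec op) tw =
        A.lateStart (c ∷ b ∷ a ∷ []) q 2 tw tt (ec ∷ eb ∷ refl ∷ []) op
          (from-yes (1ℚ + power (+ 9 / 16) 3 * power (+ 7 / 11) 2 ℚ.≤? 3ℚ * (+ 9 / 25)))
      byShape (Derive.late₄ a b c d q eb ec ed op) tw =
        B.lateStart (d ∷ c ∷ b ∷ a ∷ []) q 0 tw tt (ed ∷ ec ∷ eb ∷ refl ∷ []) op
          (from-yes (1ℚ + power (+ 2 / 3) 4 * power (+ 12 / 13) 0 ℚ.≤? 3ℚ * (+ 2 / 5)))

    theorem : (p : Pattern) → NonEmpty p → Doubled p → Avoidable 3 p
    theorem p ne d with adjacent? p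
    ... | inj₁ (a , l , l' , b , refl , e) = avoidable-factor a (l ∷ l' ∷ []) b (squares l l' e)
    ... | inj₂ none with shortest (length p) p ℕ.≤-refl ne (doubled⇒noneOnce d)
    ...   | p₀ , b , refl , ne₀ , once₀ , min₀ = avoidable-factor [] p₀ b (minimal p₀ ne₀ once₀ adj pre)
      where
      adj : NoAdjacent p₀
      adj rd l l' q e = none (reverse rd) l l' (q ++ b)
          (trans (cong (_++ b) (trans (sym e) (ʳ++-defn rd))) (++-assoc (reverse rd) _ b))
      pre : NoDoubledPrefix p₀
      pre rd q e ne ne' once = min₀ (reverse rd) q (trans (sym e) (ʳ++-defn rd)) (NonEmpty-orient true rd ne)
          ne'
        (λ X o → once X (trans (sym (occ-reverse X rd)) o))

-- Leech's square-free word and adjacent equal variables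

module SquareFree where

  open Words
  open Substitutive
  open Chords using (imgLetter-pair; length-imgLetter)
  open Greedy using (factorAt-++)
  open import Data.Empty using (⊥)
  open import Data.Fin using (zero; suc)
  open import Data.List using (List; []; _∷_; _++_; length; reverse; map)
  open import Data.List.Properties
  open import Data.List.Relation.Unary.Any using (here)
  open import Data.Nat as ℕ using (zero; suc; z≤n; s≤s; _+_; _*_; _≤_)
  open import Data.Nat.Properties
  open import Data.Nat.Coprimality using (coprime?)
  open import Data.Product using (_,_; proj₁; proj₂)
  open import Data.Sum using (_⊎_; inj₁; inj₂)
  open import Relation.Nullary using (contradiction)
  open import Relation.Nullary.Decidable using (from-yes)
  open import Relation.Binary.PropositionalEquality

  leech : Letter → List Letter
  leech zero = ⟦ 10121021201210 ⟧
  leech (suc zero) = ⟦ 11202102012021 ⟧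
  leech (suc (suc zero)) = ⟦ 12010210120102 ⟧

  length-leech : ∀ a → length (leech a) ≡ 13
  length-leech zero = refl
  length-leech (suc zero) = refl
  length-leech (suc (suc zero)) = refl

  module Leech = Substitution 13 (from-yes (1 <? 13)) leech length-leech refl

  leechFactors : List (List Letter)
  leechFactors = map ⟦_⟧ (1010 ∷ 1012 ∷ 1020 ∷ 1021 ∷ 1101 ∷ 1102 ∷ 1120 ∷ 1121 ∷ 1201 ∷ 1202 ∷ 1210 ∷ 1212 ∷
      [])

  module LeechFactors = Leech.Factors 3 (s≤s z≤n) leechFactors refl refl

  -- With `K = D = 1` and `C = 0` the conclusion of `run` reads `n < e`: no agreement is as long as
  -- its distance, which is square-freeness. The first hypothesis is trivial as `K = 1`.
  module LeechRuns = LeechFactors.Runs 1 1 0 8 7 (from-yes (coprime? 13 1)) (from-yes (3 ≤? 8))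
      (from-yes (7 <? 8)) (from-yes (28 ≤? 39))
    (residueTrie 13 8 leech leechFactors) refl refl refl

  squareFree : ∀ i n → 1 ≤ n → factorAt Leech.fixed (i + n) n ≢ factorAt Leech.fixed i n
  squareFree i n 1≤n e = contradiction (LeechRuns.run n i n 1≤n 1≤n ag)
      (≤⇒≯ (≤-reflexive (trans (*-identityˡ n) (sym (trans (+-identityʳ _) (*-identityˡ n))))))
    where
    ag : Agree Leech.fixed i (i + 1 * n) n
    ag = subst (λ d → Agree Leech.fixed i (i + d) n) (sym (*-identityˡ n))
        (factorAt⇒agree Leech.fixed i (i + n) n (sym e))

  -- The two middle letters of an even palindrome are equal and form a square of period 1.
  no-palindrome : ∀ i n → 1 ≤ n → factorAt Leech.fixed (i + n) n ≢ reverse (factorAt Leech.fixed i n)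
  no-palindrome i (suc m) _ e = squareFree (i + m) 1 (s≤s z≤n) (cong (_∷ [])
    (∷-injectiveˡ (trans (cong (λ k → factorAt Leech.fixed k (suc m))
        (trans (+-assoc i m 1) (cong (i +_) (+-comm m 1)))) (trans e
      (trans (cong reverse (trans (cong (factorAt Leech.fixed i) (+-comm 1 m)) (factorAt-+ Leech.fixed i m 1)))
        (reverse-++ (factorAt Leech.fixed i m) (Leech.fixed (i + m) ∷ [])))))))

  squares-avoidable : ∀ l l' → var l ≡ var l' → Avoidable 3 (l ∷ l' ∷ [])
  squares-avoidable l@(plet X b) (plet .X b') refl = Leech.fixed , λ (h , ne , i , e) → absurd h
      (ne X (b , here refl)) i e
    where
    absurd : ∀ h → NonEmpty (h X) → ∀ i → factorAt Leech.fixed i (length (img h (plet X b ∷ plet X b' ∷ []))) ≡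
        img h (plet X b ∷ plet X b' ∷ []) → ⊥
    absurd h ne i e = clash (imgLetter-pair h X b b')
      where
      x = imgLetter h (plet X b)
      x' = imgLetter h (plet X b')
      n = length (h X)
      1≤n : 1 ≤ n
      1≤n = NonEmpty⇒1≤ (h X) ne
      cut = factorAt-++ Leech.fixed i x (x' ++ []) e
      first : factorAt Leech.fixed i n ≡ x
      first = trans (cong (factorAt Leech.fixed i) (sym (length-imgLetter h (plet X b)))) (proj₁ cut)
      second : factorAt Leech.fixed (i + n) n ≡ x'
      second = trans (cong₂ (λ a b → factorAt Leech.fixed (i + a) b) (sym (length-imgLetter h (plet X b)))
          (sym (length-imgLetter h (plet X b'))))
        (trans (cong (factorAt Leech.fixed (i + length x)) (cong length (sym (++-identityʳ x'))))
            (trans (proj₂ cut) (++-identityʳ x')))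
      clash : x' ≡ x ⊎ x' ≡ reverse x → ⊥
      clash (inj₁ q) = squareFree i n 1≤n (trans second (trans q (sym first)))
      clash (inj₂ q) = no-palindrome i n 1≤n (trans second (trans q (cong reverse (sym first))))

-- Tables and finite checks for the two explicit words

module ExplicitWords where

  open Words
  open Substitutive
  open BlockCodes
  open Chords using (Annotated; annotate; drop-annotate; conflict; TopRun; maxLen)
  open Instances
  open import Data.Bool using (Bool; true; false; not)
  open import Data.Bool.ListAction using (all)
  open import Data.Fin using (zero; suc; toℕ)
  open import Data.List using (List; []; _∷_; length; map; take; replicate)
  open import Data.List.Properties
  open import Data.List.Membership.Propositional using (_∈_)
  open import Data.Nat as ℕ using (ℕ; zero; suc; z≤n; s≤s; _+_; _*_; _∸_; _≤_; _%_; _≡ᵇ_)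
  open import Data.Nat.Properties
  open import Data.Nat.DivMod using (m%n<n)
  open import Data.Nat.Coprimality using (coprime?)
  open import Data.Product using (∃-syntax; _×_; _,_; proj₁; proj₂)
  open import Data.Unit using (tt)
  open import Relation.Nullary.Decidable using (from-yes)
  open import Relation.Binary.PropositionalEquality

  -- The images of 0 and 1 are complementary, so all columns are injective as `columns` demands. The
  -- fixed point starts from 0 and stays over 0 and 1; the image of 2 completes the columns.
  toeplitz : Letter → List Letter
  toeplitz zero = ⟦ 10011100 ⟧
  toeplitz (suc zero) = ⟦ 11100011 ⟧
  toeplitz (suc (suc zero)) = ⟦ 12222222 ⟧

  length-toeplitz : ∀ a → length (toeplitz a) ≡ 7
  length-toeplitz zero = refl
  length-toeplitz (suc zero) = refl
  length-toeplitz (suc (suc zero)) = refl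

  module Toeplitz = Substitution 7 (from-yes (1 <? 7)) toeplitz length-toeplitz refl

  -- Length 9 comes from `room` in `Paired`, where `22 · 2 + 7 + 7 ≤ 9 · 7`.
  toeplitzFactors : List (List Letter)
  toeplitzFactors = map ⟦_⟧ (1000011100 ∷ 1000110011 ∷ 1000111000 ∷ 1000111001 ∷ 1000111100 ∷ 1001100011 ∷
    1001100111 ∷ 1001110000 ∷ 1001110011 ∷ 1001111000 ∷ 1011000111 ∷ 1011001110 ∷
    1011100001 ∷ 1011100110 ∷ 1011110001 ∷ 1100001110 ∷ 1100011001 ∷ 1100011110 ∷
    1100110001 ∷ 1100111000 ∷ 1110000111 ∷ 1110001100 ∷ 1110001111 ∷ 1110011000 ∷
    1110011100 ∷ 1111000011 ∷ 1111000110 ∷ 1111000111 ∷ 1111001100 ∷ 1111100011 ∷ [])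

  module ToeplitzFactors = Toeplitz.Factors 9 (s≤s z≤n) toeplitzFactors refl refl

  toeplitzTrie : Trie ℕ
  toeplitzTrie = residueTrie 7 7 toeplitz toeplitzFactors

  toeplitzTriples : List (List Letter)
  toeplitzTriples = map ⟦_⟧ (1000 ∷ 1001 ∷ 1011 ∷ 1100 ∷ 1110 ∷ 1111 ∷ [])

  toeplitz-triple : ∀ n → factorAt Toeplitz.fixed n 3 ∈ toeplitzTriples
  toeplitz-triple n = member-sound (factorAt Toeplitz.fixed n 3) toeplitzTriples
    (all-sound (λ φ → member (take 3 φ) toeplitzTriples) toeplitzFactors refl (ToeplitzFactors.factor∈ n))

  toeplitzPairs : List (List Letter)
  toeplitzPairs = map ⟦_⟧ (100 ∷ 101 ∷ 110 ∷ 111 ∷ [])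

  toeplitz-pair : ∀ n → factorAt Toeplitz.fixed n 2 ∈ toeplitzPairs
  toeplitz-pair n = member-sound (factorAt Toeplitz.fixed n 2) toeplitzPairs
    (all-sound (λ φ → member (take 2 φ) toeplitzPairs) toeplitzFactors refl (ToeplitzFactors.factor∈ n))

  -- Block n of the explicit words depends on n modulo K and on letter n of the fixed point of toeplitz.  The
  -- two blocks for a residue share a long prefix and a long suffix; the tables were found by backtracking.
  blockOf : ℕ → List (List Letter) → ℕ × Letter → List Letter
  blockOf r table (c , a) = nth (replicate r zero) table (2 * c + toℕ a)

  length-blockOf : ∀ r table → all (λ u → length u ≡ᵇ r) table ≡ true → ∀ a → length (blockOf r table a) ≡ r
  length-blockOf r table ok (c , a) = go table ok (2 * c + toℕ a)
    where
    go : ∀ table → all (λ u → length u ≡ᵇ r) table ≡ true → ∀ n → length (nth (replicate r zero) table n) ≡ r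
    go [] _ n = length-replicate r
    go (u ∷ table) ok zero = ≡ᵇ-true⇒≡ (length u) r (proj₁ (∧-true ok))
    go (u ∷ table) ok (suc n) = go table (proj₂ (∧-true {length u ≡ᵇ r} ok)) n

  -- Two consecutive rows belong to one residue modulo 8, for the base letters 0 and 1 in this
  -- order.
  alternatingTable : List (List Letter)
  alternatingTable = map ⟦_⟧ (111121110122022211011210010222122010200012011 ∷
    111121110120220111001112022100122010200012011 ∷
    112022212002211101201000212201121110020122120 ∷
    112022001000200011102211102100121110020122120 ∷
    101021110122101120212001101202210011002201020 ∷
    101021112211200021110221200102210011002201020 ∷
    111120020100122010002010220121110120020102000 ∷
    111120010221101121100102100122110120020102000 ∷
    112201122022120100021022002221110121011001022 ∷
    112201211200022000120111001221110121011001022 ∷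
    112220222111012221121020011021222000111002010 ∷
    112220022112101222000221100210222000111002010 ∷
    102122201000222110120021120221220011121101122 ∷
    102122200121102001220100200112220011121101122 ∷
    110200012022000211201211222011220012101222100 ∷
    110200011222010021202221201120220012101222100 ∷ [])

  alternatingBlock : ℕ × Letter → List Letter
  alternatingBlock = blockOf 44 alternatingTable

  module Alternating where
    module Y = ToeplitzFactors.Runs 8 2 1 7 1 (from-yes (coprime? 7 8)) (from-yes (3 ≤? 7)) (≤ᵇ⇒≤ _ _ tt)
        (≤ᵇ⇒≤ _ _ tt) toeplitzTrie refl refl refl
    module W = Labelled Toeplitz.fixed 8 44 alternatingBlock (length-blockOf 44 alternatingTable refl)
    module V = W.Checked toeplitzTriples toeplitz-triple
    -- In A B A B the copies of a variable start two pattern letters apart, hence `D = 2`; `n₀ = 6`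
    -- is the first length above `maxLen`.
    module F = V.Far 2 1 11 6 23 20 refl (≤ᵇ⇒≤ _ _ tt) (≤ᵇ⇒≤ _ _ tt) (≤ᵇ⇒≤ _ _ tt) (≤ᵇ⇒≤ _ _ tt) Y.run
      (W.locationTrie 11 toeplitzTriples)

    module T = W.Tails 2 toeplitzPairs toeplitz-pair annotate drop-annotate

    checks : F.Checks
    checks = record { located-ok = refl ; spread-ok = refl }

    unpaired : Annotated → Bool
    unpaired v = not (conflict 0 false v)

    parsed : T.Holds unpaired
    parsed = record { tails-ok = refl }

    clean : ∀ i → ∃[ L ] (4 + 2 * 0) * maxLen ≤ L × conflict 0 false (annotate (factorAt W.word i L)) ≡ false
    clean i = 2 * 44 ∸ i % 44 ,
      ≤-trans (≤-trans (≤ᵇ⇒≤ _ 44 tt) (≤-reflexive (sym (m+n∸n≡m 44 44))))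
          (∸-monoʳ-≤ (44 + 44) (<⇒≤ (m%n<n i 44))) ,
      not-true (T.forTails-sound unpaired parsed i)

    avoidable : ∀ {p} → TwiceEach p → TopRun 0 false p → Avoidable 3 p
    avoidable = Avoids.avoids W.word 0 false (λ ()) (≤ᵇ⇒≤ _ _ tt) (F.far checks) clean

  pairedTable : List (List Letter)
  pairedTable = map ⟦_⟧ (1022020122220002121212022222112202002210011112011010221 ∷
    1022020010222220021112211002202112222210011112011010221 ∷
    1011000211011111221002000001112101112220212110020221222 ∷
    1011000002110100222010000221210111112220212110020221222 ∷
    1220022110220012112000002221000110200011112101100112222 ∷
    1220022011000122021120002221010102000011112101100112222 ∷
    1211111022121010011122111021100220000011000120022221120 ∷
    1211111022112212002111012202010112200011000120022221120 ∷
    1222221001102212001221111012000010022010101211000111112 ∷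
    1222221000020112122002201111210011222010101211000111112 ∷
    1010011002211102000102210111200000122000110102011221111 ∷
    1010011002210110200220000012202011120000110102011221111 ∷
    1001111102222211220010211022020012211202200010202021100 ∷
    1001111102221122100110020212222200211202200010202021100 ∷
    1220012000001111201220022111012100121122200012212110111 ∷
    1220012000002211100212022210011112101122200012212110111 ∷
    1112221022000011221201100111221020021120012222201102001 ∷
    1112221010102212100000220112212002021120012222201102001 ∷
    1011222200111020220001112101220010000211221111012121200 ∷
    1011222200210110002202111110012200000211221111012121200 ∷
    1211102221100012122101100222100002201020112211010020000 ∷
    1211102221121002021100222221220110220020112211010020000 ∷
    1010221110212211111001202222100212121202112220001102001 ∷
    1010221001112222011200212202001111221202112220001102001 ∷
    1000022100000111210010220010112020201111100221110122210 ∷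
    1000022100011120220110100222212000121111100221110122210 ∷
    1012211220222221111011221200211212201100121122202121210 ∷
    1012211220201000220000011222220020211100121122202121210 ∷
    1021102200111121010102210001121221010022112221001110211 ∷
    1021102221010011211111000020122220000022112221001110211 ∷
    1221002122222011221111120002200121100002220101122020010 ∷
    1221002111222220110022020111112211110002220101122020010 ∷
    1000020112002201002222200110022120111122002221220222211 ∷
    1000020110122100102111002222210202011122002221220222211 ∷
    1200101100002202122110020211111022200121212002222201221 ∷
    1200101100000220200112221000211102200121212002222201221 ∷
    1122002211021112211110012112022211100211222221011000021 ∷
    1122002212101112202010000022211111200211222221011000021 ∷
    1010102211000201102200122112101111122001000002001120200 ∷
    1010102201120002121122020012111100022001000002001120200 ∷
    1222211012200001121220021202221122200010222011022011111 ∷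
    1222211012002112220000110012022112200010222011022011111 ∷
    1200012121021122111100220102000001221011122200100002211 ∷
    1200012211001020000011202020110102200011122200100002211 ∷ [])

  pairedBlock : ℕ × Letter → List Letter
  pairedBlock = blockOf 54 pairedTable

  module Paired where
    module Y = ToeplitzFactors.Runs 22 8 5 7 2 (from-yes (coprime? 7 22)) (from-yes (3 ≤? 7)) (≤ᵇ⇒≤ _ _ tt)
        (≤ᵇ⇒≤ _ _ tt) toeplitzTrie refl refl refl
    module W = Labelled Toeplitz.fixed 22 54 pairedBlock (length-blockOf 54 pairedTable refl)
    module V = W.Checked toeplitzTriples toeplitz-triple
    -- The factor `D = 8` is `2 + 2 · 3`. Here `room` is an equality, `8 · 12 + 12 = 2 · 54`: two
    -- full blocks just contain every distance scanned.
    module F = V.Far 8 5 12 6 30 23 refl (≤ᵇ⇒≤ _ _ tt) (≤ᵇ⇒≤ _ _ tt) (≤ᵇ⇒≤ _ _ tt) (≤ᵇ⇒≤ _ _ tt) Y.run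
      (W.locationTrie 12 toeplitzTriples)

    module T = W.Tails 2 toeplitzPairs toeplitz-pair annotate drop-annotate

    checks : F.Checks
    checks = record { located-ok = refl ; spread-ok = refl }

    unpaired : Annotated → Bool
    unpaired v = not (conflict 3 true v)

    parsed : T.Holds unpaired
    parsed = record { tails-ok = refl }

    clean : ∀ i → ∃[ L ] (4 + 2 * 3) * maxLen ≤ L × conflict 3 true (annotate (factorAt W.word i L)) ≡ false
    -- At least one block of 54 letters remains behind the offset, and ten images of length at most
    -- 5 need 50.
    clean i = 2 * 54 ∸ i % 54 ,
      ≤-trans (≤-trans (≤ᵇ⇒≤ _ 54 tt) (≤-reflexive (sym (m+n∸n≡m 54 54))))
          (∸-monoʳ-≤ (54 + 54) (<⇒≤ (m%n<n i 54))) ,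
      not-true (T.forTails-sound unpaired parsed i)

    avoidable : ∀ {p} → TwiceEach p → TopRun 3 true p → Avoidable 3 p
    avoidable = Avoids.avoids W.word 3 true (λ _ → ≤-refl) (≤ᵇ⇒≤ _ _ tt) (F.far checks) clean

theorem2 : (p : Pattern) → NonEmpty p → Doubled p → Avoidable 3 p
theorem2 = Reduction.Main.theorem SquareFree.squares-avoidable ExplicitWords.Alternating.avoidable
    ExplicitWords.Paired.avoidable
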